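{- For all positive integers $k\ge 4$ and $s$, let $n=2sk+1$ and let $G$ be the complete graph on vertex set $\{0,1,\ldots,n-1\}$. Then there are $k$ circle graphs $C_1,\ldots,C_k$, each on $n$ vertices, such that $E(C_1),\ldots,E(C_k)$ form a partition of $E(G)$ and such that for every $1\le i\le k$, the largest diameter two subgraph of $C_i$ contains at most $2s+7$ vertices.
   Context: For an integer $n\ge 2$ and a set $S\subseteq\{1,\ldots,\lfloor n/2\rfloor\}$, the circle graph on $n$ vertices determined by $S$ is the graph with vertex set $\{0,1,\ldots,n-1\}$ in which two vertices $x,y$ are adjacent if and only if $(x-y)\bmod n\in S$ or $(y-x)\bmod n\in S$. A diameter two subgraph of a graph $G$ is a subgraph $H$ of $G$ such that for every pair of vertices $x,y$ of $H$ there is a path in $H$ joining $x$ and $y$ with at most two edges; its size is its number of vertices. -}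

module Defs where

open import Data.Nat using (ℕ; suc; _+_; _∸_; _≤_; _/_; _%_)
open import Data.Fin using (Fin; toℕ)
open import Data.Fin.Subset using (Subset; _∈_)
open import Data.Bool using (Bool; true)
open import Data.Product using (_×_; ∃)
open import Data.Sum using (_⊎_)
open import Relation.Binary.PropositionalEquality using (_≡_)

diffMod : (m : ℕ) → Fin (suc m) → Fin (suc m) → ℕ
diffMod m x y = (toℕ x + (suc m ∸ toℕ y)) % suc m

ValidConnSet : (n : ℕ) → (ℕ → Bool) → Set
ValidConnSet n S = ∀ d → S d ≡ true → (1 ≤ d) × (d ≤ n / 2)

CircleAdj : (m : ℕ) → (ℕ → Bool) → Fin (suc m) → Fin (suc m) → Set
CircleAdj m S x y = (S (diffMod m x y) ≡ true) ⊎ (S (diffMod m y x) ≡ true)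

record Subgraph {n : ℕ} (Adj : Fin n → Fin n → Set) : Set₁ where
  field
    V : Subset n
    E : Fin n → Fin n → Set
    E-sym : ∀ x y → E x y → E y x
    E-sub : ∀ x y → E x y → (x ∈ V) × (y ∈ V) × Adj x y

DiameterTwo : {n : ℕ} {Adj : Fin n → Fin n → Set} → Subgraph Adj → Set
DiameterTwo {n} H = ∀ (x y : Fin n) → x ∈ V → y ∈ V →
    (x ≡ y) ⊎ (E x y ⊎ ∃ λ z → E x z × E z y)
  where open Subgraph H

{-# OPTIONS --safe #-}
module Submission where

-- Let n = 2 s k + 1 and, for 0 ≤ b < k, call {b s + 1, …, b s + s} the block b.  Suppose the
-- vertices of a diameter two graph lie on a circle of length n, with x → y when the distance from x
-- to y is in block b; put a = b s.  A closed walk of p forward and q backward edges has length a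
-- multiple of n lying between p (a + 1) - q (a + s) and p (a + s) - q (a + 1), which for p + q ≤ 5
-- leaves few possibilities:
--   * no closed 5-walk: the graph is complete bipartite, of at most 2 s + 2 vertices because
--     differences of two sets of size p and q take at least p + q - 1 values;
--   * all closed 5-walks run in one direction: the graph is a blow-up of a directed pentagon; its
--     five classes lie in arcs whose lengths add up to at most w n - 5 a and 5 (a + s) - w n (w = 1, 2),
--     and one of these is about 2 s at most because w n / s - 5 b is nearly an integer;
--   * every closed walk has p - q = 3 t and length t n: the graph is tripartite and lifts to the
--     threefold cover of the circle, where the three classes are compared as intervals.
-- The last case fails for 3 b + 3 = 2 k, where a block ending just below n / 3 carries a diameter two
-- graph on 3 s vertices.  So the colour classes cannot all be blocks.  But 2 is a unit modulo n, and
-- the blocks 2 j and 2 j + 1 together are also the union of 2 (block j), their even numbers, and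
-- - 2 (block k - 1 - j), their odd numbers.  Splitting the pair j = 0 removes the inconvenient block 1,
-- splitting one more pair removes the bad block when 3 divides k, and k = 6 is treated separately.

-- Length five is the natural limit: diameter two joins every vertex to a fixed one by at most two
-- edges, and an edge between two vertices closes two such paths to a walk of length at most 2 + 1 +
-- 2. Block 1 is inconvenient because there a = s, and for s ≥ 3 the interval of lengths of a walk
-- with three forward and two backward edges contains 0; from block 2 on it does not. The value k =
-- 6 is exceptional because splitting the pair that contains the bad block 3 would produce 2 (block
-- 1), so the even numbers have to be split a second time. A class that is c times a block becomes a
-- plain block once all positions are multiplied by the inverse of c. Positions are therefore
-- arbitrary integers read modulo n, and the geometric arguments speak of N labelled points instead
-- of subsets of {0, ..., n - 1}.

module ProofOfTheorem3 where

  open import Data.Bool.Base using (Bool; true; false)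
  open import Data.Empty using (⊥; ⊥-elim)
  open import Data.Fin.Base as Fin using (Fin; toℕ; fromℕ<)
  import Data.Fin.Properties as Fin
  open import Data.Fin.Properties using (any?)
  open import Data.Fin.Subset as Subset using (Subset; inside; outside)
  open import Data.Integer.Base hiding (pos; suc; pred; neg; positive; negative)
  open import Data.Integer.Properties
  open import Data.Integer.DivMod using (_%ℕ_; _/ℕ_; n%ℕd<d; a≡a%ℕn+[a/ℕn]*n)
  open import Data.Nat.Tactic.RingSolver using () renaming (solve-∀ to ℕ-solve-∀)
  open import Data.List.Base using (List; []; _∷_)
  import Data.Nat.Base as ℕ
  open import Data.Nat.Base using (ℕ; zero; suc; z≤n; s≤s)
  open import Data.Nat.Divisibility using (divides-refl)
  import Data.Nat.DivMod as ℕ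
  import Data.Nat.Properties as ℕ
  open import Data.Product.Base using (∃; ∃₂; _×_; _,_; proj₁; proj₂)
  open import Data.Sum.Base using (_⊎_; inj₁; inj₂; [_,_]′)
  open import Data.Unit.Base using (⊤; tt)
  import Data.Vec.Base as Vec
  open import Defs
  open import Function.Base using (_∘_; id)
  open import Relation.Binary.PropositionalEquality using (_≡_; refl; sym; trans; cong; cong₂; subst; module ≡-Reasoning)
  open import Relation.Nullary using (¬_; Dec; yes; no; does; contradiction)
  open import Relation.Nullary.Decidable using (_×-dec_; _⊎-dec_; map′; dec-true)

  -- Linear arithmetic over ℤ

  ≤⊎≥ : ∀ x y → x ≤ y ⊎ y + + 1 ≤ x
  ≤⊎≥ x y with x ≤? y
  ... | yes x≤y = inj₁ x≤y
  ... | no  x≰y = inj₂ (subst (_≤ x) (+-comm (+ 1) y) (i<j⇒suc[i]≤j (≰⇒> x≰y)))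

  -- Over ℤ the negation of x ≤ y is again a non-strict inequality, y + 1 ≤ x. This lets a
  -- certificate take the negated conclusion as one more hypothesis and profit from integrality.
  by-contra : ∀ {x y} → (y + + 1 ≤ x → ⊥) → x ≤ y
  by-contra {x} {y} f = [ id , ⊥-elim ∘ f ]′ (≤⊎≥ x y)

  -- Certificates for linear arithmetic over ℤ (Farkas): a nonnegative combination of the hypotheses
  -- and the negated conclusion is a negative constant.  Distinct monomials count as distinct unknowns.
  -- The coefficients are listed in the order: negated conclusion, hypotheses from the last to the
  -- first, facts of the context; an equation takes two of them (≤, then ≥), and trailing zeros are
  -- omitted.  A conclusion that is an equation has two certificates.

  module LinearArithmetic where
    open import Data.Bool.Base using (T; if_then_else_)
    open import Data.Integer.Tactic.RingSolver using (solve-∀)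
    open import Data.List.Base using (_++_; length)
    open import Data.List.Properties using (≡-dec)

    infixl 9 _:*_
    infixl 8 _:+_ _:-_
    infix 10 #_ ⊝_
    infix 7 _≼_ _≈_
    infixr 3 _⇒_
    infix 3 ⊩_

    data Exp : Set where
      var         : ℕ → Exp
      #_          : ℕ → Exp
      _:+_ _:-_ _:*_ : Exp → Exp → Exp
      ⊝_          : Exp → Exp

    data Rel : Set where
      _≼_ _≈_ : Exp → Exp → Rel

    data Statement : Set where
      _⇒_    : Rel → Statement → Statement
      ⊩_     : Rel → Statement
      ⊩⊥     : Statement

    lookup : List ℤ → ℕ → ℤ
    lookup []      _       = + 0
    lookup (x ∷ _) zero    = x
    lookup (_ ∷ ρ) (suc i) = lookup ρ i

    ⟦_⟧ : Exp → List ℤ → ℤ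
    ⟦ var i ⟧ ρ = lookup ρ i
    ⟦ # k ⟧   ρ = + k
    ⟦ e :+ f ⟧ ρ = ⟦ e ⟧ ρ + ⟦ f ⟧ ρ
    ⟦ e :- f ⟧ ρ = ⟦ e ⟧ ρ - ⟦ f ⟧ ρ
    ⟦ e :* f ⟧ ρ = ⟦ e ⟧ ρ * ⟦ f ⟧ ρ
    ⟦ ⊝ e ⟧   ρ = - ⟦ e ⟧ ρ

    ⟦_⟧ᵣ : Rel → List ℤ → Set
    ⟦ e ≼ f ⟧ᵣ ρ = ⟦ e ⟧ ρ ≤ ⟦ f ⟧ ρ
    ⟦ e ≈ f ⟧ᵣ ρ = ⟦ e ⟧ ρ ≡ ⟦ f ⟧ ρ

    ⟦_⟧ₛ : Statement → List ℤ → Set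
    ⟦ r ⇒ P ⟧ₛ  ρ = ⟦ r ⟧ᵣ ρ → ⟦ P ⟧ₛ ρ
    ⟦ ⊩ r ⟧ₛ    ρ = ⟦ r ⟧ᵣ ρ
    ⟦ ⊩⊥ ⟧ₛ    ρ = ⊥

    Monomial = List ℕ
    Polynomial = List (ℤ × Monomial)

    evalₘ : Monomial → List ℤ → ℤ
    evalₘ []      ρ = + 1
    evalₘ (i ∷ m) ρ = lookup ρ i * evalₘ m ρ

    evalₚ : Polynomial → List ℤ → ℤ
    evalₚ []            ρ = + 0
    evalₚ ((c , m) ∷ p) ρ = c * evalₘ m ρ + evalₚ p ρ

    _·ᵢ_ : ℕ → Monomial → Monomial
    i ·ᵢ []      = i ∷ []
    i ·ᵢ (j ∷ m) = if i ℕ.≤ᵇ j then i ∷ j ∷ m else j ∷ (i ·ᵢ m)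

    _·ₘ_ : Monomial → Monomial → Monomial
    []      ·ₘ m′ = m′
    (i ∷ m) ·ₘ m′ = i ·ᵢ (m ·ₘ m′)

    insert : ℤ → Monomial → Polynomial → Polynomial
    insert c m []             = (c , m) ∷ []
    insert c m ((d , m′) ∷ p) with ≡-dec ℕ._≟_ m m′
    ... | yes _ = (c + d , m′) ∷ p
    ... | no _  = (d , m′) ∷ insert c m p

    _+ₚ_ : Polynomial → Polynomial → Polynomial
    []            +ₚ q = q
    ((c , m) ∷ p) +ₚ q = insert c m (p +ₚ q)

    _·ₜ_ : ℤ × Monomial → Polynomial → Polynomial
    _ ·ₜ []                    = []
    (c , m) ·ₜ ((d , m′) ∷ p)  = insert (c * d) (m ·ₘ m′) ((c , m) ·ₜ p)

    _*ₚ_ : Polynomial → Polynomial → Polynomial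
    []      *ₚ q = []
    (t ∷ p) *ₚ q = (t ·ₜ q) +ₚ (p *ₚ q)

    constant : ℤ → Polynomial
    constant c = (c , []) ∷ []

    normalise : Exp → Polynomial
    normalise (var i) = (+ 1 , i ∷ []) ∷ []
    normalise (# k)   = constant (+ k)
    normalise (e :+ f) = normalise e +ₚ normalise f
    normalise (e :- f) = normalise e +ₚ (constant (- + 1) *ₚ normalise f)
    normalise (e :* f) = normalise e *ₚ normalise f
    normalise (⊝ e)   = constant (- + 1) *ₚ normalise e

    module _ (ρ : List ℤ) where

      swap-factors : ∀ a b c → a * (b * c) ≡ b * (a * c)
      swap-factors = solve-∀

      eval-·ᵢ : ∀ i m → evalₘ (i ·ᵢ m) ρ ≡ lookup ρ i * evalₘ m ρ
      eval-·ᵢ i []      = refl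
      eval-·ᵢ i (j ∷ m) with i ℕ.≤ᵇ j
      ... | true  = refl
      ... | false = trans (cong (lookup ρ j *_) (eval-·ᵢ i m)) (swap-factors (lookup ρ j) (lookup ρ i) (evalₘ m ρ))

      eval-·ₘ : ∀ m m′ → evalₘ (m ·ₘ m′) ρ ≡ evalₘ m ρ * evalₘ m′ ρ
      eval-·ₘ []      m′ = sym (*-identityˡ (evalₘ m′ ρ))
      eval-·ₘ (i ∷ m) m′ = trans (eval-·ᵢ i (m ·ₘ m′))
        (trans (cong (lookup ρ i *_) (eval-·ₘ m m′)) (sym (*-assoc (lookup ρ i) (evalₘ m ρ) (evalₘ m′ ρ))))

      collect : ∀ c d m p → (c + d) * m + p ≡ c * m + (d * m + p)
      collect = solve-∀

      skip : ∀ x y p → x + (y + p) ≡ y + (x + p)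
      skip = solve-∀

      eval-insert : ∀ c m p → evalₚ (insert c m p) ρ ≡ c * evalₘ m ρ + evalₚ p ρ
      eval-insert c m []             = refl
      eval-insert c m ((d , m′) ∷ p) with ≡-dec ℕ._≟_ m m′
      ... | yes refl = collect c d (evalₘ m ρ) (evalₚ p ρ)
      ... | no _     = trans (cong (λ t → d * evalₘ m′ ρ + t) (eval-insert c m p))
                             (skip (d * evalₘ m′ ρ) (c * evalₘ m ρ) (evalₚ p ρ))

      eval-+ₚ : ∀ p q → evalₚ (p +ₚ q) ρ ≡ evalₚ p ρ + evalₚ q ρ
      eval-+ₚ []            q = sym (+-identityˡ (evalₚ q ρ))
      eval-+ₚ ((c , m) ∷ p) q = trans (eval-insert c m (p +ₚ q))
        (trans (cong (λ t → c * evalₘ m ρ + t) (eval-+ₚ p q)) (sym (+-assoc (c * evalₘ m ρ) (evalₚ p ρ) (evalₚ q ρ))))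

      distribute : ∀ c d m m′ p → c * d * (m * m′) + c * m * p ≡ c * m * (d * m′ + p)
      distribute = solve-∀

      eval-·ₜ : ∀ c m p → evalₚ ((c , m) ·ₜ p) ρ ≡ c * evalₘ m ρ * evalₚ p ρ
      eval-·ₜ c m []             = sym (*-zeroʳ (c * evalₘ m ρ))
      eval-·ₜ c m ((d , m′) ∷ p) = trans (eval-insert (c * d) (m ·ₘ m′) ((c , m) ·ₜ p))
        (trans (cong₂ (λ t u → c * d * t + u) (eval-·ₘ m m′) (eval-·ₜ c m p))
               (distribute c d (evalₘ m ρ) (evalₘ m′ ρ) (evalₚ p ρ)))

      eval-*ₚ : ∀ p q → evalₚ (p *ₚ q) ρ ≡ evalₚ p ρ * evalₚ q ρ
      eval-*ₚ []            q = refl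
      eval-*ₚ ((c , m) ∷ p) q = trans (eval-+ₚ ((c , m) ·ₜ q) (p *ₚ q))
        (trans (cong₂ _+_ (eval-·ₜ c m q) (eval-*ₚ p q)) (sym (*-distribʳ-+ (evalₚ q ρ) (c * evalₘ m ρ) (evalₚ p ρ))))

      eval-constant : ∀ c → evalₚ (constant c) ρ ≡ c
      eval-constant c = trans (+-identityʳ (c * + 1)) (*-identityʳ c)

      eval-neg : ∀ p → evalₚ (constant (- + 1) *ₚ p) ρ ≡ - evalₚ p ρ
      eval-neg p = trans (eval-*ₚ (constant (- + 1)) p)
        (trans (cong (_* evalₚ p ρ) (eval-constant (- + 1))) (-1*i≡-i (evalₚ p ρ)))

      normalise-sound : ∀ e → evalₚ (normalise e) ρ ≡ ⟦ e ⟧ ρ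
      normalise-sound (var i) = trans (eval-variable (lookup ρ i)) refl
        where
        eval-variable : ∀ x → + 1 * (x * + 1) + + 0 ≡ x
        eval-variable = solve-∀
      normalise-sound (# k)   = eval-constant (+ k)
      normalise-sound (e :+ f) = trans (eval-+ₚ (normalise e) (normalise f)) (cong₂ _+_ (normalise-sound e) (normalise-sound f))
      normalise-sound (e :- f) = trans (eval-+ₚ (normalise e) (constant (- + 1) *ₚ normalise f))
        (cong₂ _+_ (normalise-sound e) (trans (eval-neg (normalise f)) (cong -_ (normalise-sound f))))
      normalise-sound (e :* f) = trans (eval-*ₚ (normalise e) (normalise f)) (cong₂ _*_ (normalise-sound e) (normalise-sound f))
      normalise-sound (⊝ e)   = trans (eval-neg (normalise e)) (cong -_ (normalise-sound e))

    -- The constants are accumulated in `a`. Every other monomial must carry the literal coefficient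
    -- + 0, since `insert` merges equal monomials but keeps cancelled ones in the list.
    negative : ℤ → Polynomial → Bool
    negative a []                  = if does (+ 0 ≤? a) then false else true
    negative a ((c , []) ∷ p)      = negative (a + c) p
    negative a ((+ 0 , _ ∷ _) ∷ p) = negative a p
    negative a (_ ∷ _)             = false

    negative-sound : ∀ ρ a p → T (negative a p) → ¬ + 0 ≤ a + evalₚ p ρ
    negative-sound ρ a [] t h with + 0 ≤? a
    ... | no a<0 = a<0 (subst (+ 0 ≤_) (+-identityʳ a) h)
    negative-sound ρ a ((c , []) ∷ p) t h =
      negative-sound ρ (a + c) p t (subst (+ 0 ≤_) (regroup a c (evalₚ p ρ)) h)
      where
      regroup : ∀ a c p → a + (c * + 1 + p) ≡ a + c + p
      regroup = solve-∀
    negative-sound ρ a ((+ 0 , _ ∷ _) ∷ p) t h =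
      negative-sound ρ a p t (subst (+ 0 ≤_) (cong (λ t → a + t) (+-identityˡ (evalₚ p ρ))) h)

    inequalities : Rel → List (Exp × Exp) → List (Exp × Exp)
    inequalities (e ≼ f) hs = (e , f) ∷ hs
    inequalities (e ≈ f) hs = (e , f) ∷ (f , e) ∷ hs

    Hold : List (Exp × Exp) → List ℤ → Set
    Hold []             ρ = ⊤
    Hold ((e , f) ∷ hs) ρ = ⟦ e ⟧ ρ ≤ ⟦ f ⟧ ρ × Hold hs ρ

    hold : ∀ r {hs ρ} → ⟦ r ⟧ᵣ ρ → Hold hs ρ → Hold (inequalities r hs) ρ
    hold (e ≼ f) h H = h , H
    hold (e ≈ f) h H = ≤-reflexive h , ≤-reflexive (sym h) , H

    combine : List (Exp × Exp) → List ℕ → Polynomial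
    combine ((e , f) ∷ hs) (zero ∷ cs)  = combine hs cs
    combine ((e , f) ∷ hs) (suc c ∷ cs) = (constant (+ suc c) *ₚ normalise (f :- e)) +ₚ combine hs cs
    combine _              _            = []

    combine-nonneg : ∀ hs cs ρ → Hold hs ρ → + 0 ≤ evalₚ (combine hs cs) ρ
    combine-nonneg []             _            ρ _       = ≤-refl
    combine-nonneg (_ ∷ _)        []           ρ _       = ≤-refl
    combine-nonneg (_ ∷ hs)       (zero ∷ cs)  ρ (_ , H) = combine-nonneg hs cs ρ H
    combine-nonneg ((e , f) ∷ hs) (suc c ∷ cs) ρ (h , H) = subst (+ 0 ≤_) (sym value)
      (+-mono-≤ (subst (_≤ + suc c * (⟦ f ⟧ ρ - ⟦ e ⟧ ρ)) (*-zeroʳ (+ suc c)) (*-monoˡ-≤-nonNeg (+ suc c) (i≤j⇒0≤j-i h)))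
                (combine-nonneg hs cs ρ H))
      where
      value : evalₚ (combine ((e , f) ∷ hs) (suc c ∷ cs)) ρ ≡ + suc c * (⟦ f ⟧ ρ - ⟦ e ⟧ ρ) + evalₚ (combine hs cs) ρ
      value = trans (eval-+ₚ ρ (constant (+ suc c) *ₚ normalise (f :- e)) (combine hs cs))
        (cong (_+ evalₚ (combine hs cs) ρ) (trans (eval-*ₚ ρ (constant (+ suc c)) (normalise (f :- e)))
          (cong₂ _*_ (eval-constant ρ (+ suc c)) (normalise-sound ρ (f :- e)))))

    refute : ∀ hs cs ρ → T (negative (+ 0) (combine hs cs)) → Hold hs ρ → ⊥
    refute hs cs ρ t H = negative-sound ρ (+ 0) (combine hs cs) t
      (subst (+ 0 ≤_) (sym (+-identityˡ (evalₚ (combine hs cs) ρ))) (combine-nonneg hs cs ρ H))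

    Certifies : List (Exp × Exp) → Statement → List ℕ → List ℕ → Set
    Certifies hs (r ⇒ P)     cs ds = Certifies (inequalities r hs) P cs ds
    Certifies hs (⊩ (e ≼ f)) cs ds = T (negative (+ 0) (combine ((f :+ # 1 , e) ∷ hs) cs))
    Certifies hs (⊩ (e ≈ f)) cs ds = Certifies hs (⊩ (e ≼ f)) cs [] × Certifies hs (⊩ (f ≼ e)) ds []
    Certifies hs ⊩⊥          cs ds = T (negative (+ 0) (combine hs cs))

    certified : ∀ hs P cs ds → Certifies hs P cs ds → ∀ ρ → Hold hs ρ → ⟦ P ⟧ₛ ρ
    certified hs (r ⇒ P)     cs ds c ρ H = λ h → certified (inequalities r hs) P cs ds c ρ (hold r h H)
    certified hs (⊩ (e ≼ f)) cs ds c ρ H = by-contra λ h → refute ((f :+ # 1 , e) ∷ hs) cs ρ c (h , H)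
    certified hs (⊩ (e ≈ f)) cs ds c ρ H =
      ≤-antisym (certified hs (⊩ (e ≼ f)) cs [] (proj₁ c) ρ H) (certified hs (⊩ (f ≼ e)) ds [] (proj₂ c) ρ H)
    certified hs ⊩⊥          cs ds c ρ H = refute hs cs ρ c H

    -- Higher-order syntax: a statement in k variables is a function of k expressions, so that
    -- certificates can be attached to formulas with named variables.
    Function : ℕ → Set → Set
    Function zero    B = B
    Function (suc k) B = Exp → Function k B

    apply : ∀ {B} i m {k} → Function (m ℕ.+ k) B → Function k B
    apply i zero    f = f
    apply i (suc m) f = apply (suc i) m (f (var i))

    instantiate : ∀ {B} i k → Function k B → B
    instantiate i zero    f = f
    instantiate i (suc k) f = instantiate (suc i) k (f (var i))

    relations : List Rel → List (Exp × Exp)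
    relations []       = []
    relations (r ∷ rs) = inequalities r (relations rs)

    Holdᵣ : List Rel → List ℤ → Set
    Holdᵣ []       ρ = ⊤
    Holdᵣ (r ∷ rs) ρ = ⟦ r ⟧ᵣ ρ × Holdᵣ rs ρ

    holdᵣ : ∀ rs {ρ} → Holdᵣ rs ρ → Hold (relations rs) ρ
    holdᵣ []       _       = tt
    holdᵣ (r ∷ rs) (h , H) = hold r h (holdᵣ rs H)

    -- Quantities fixed in a module, such as n, a and s, occupy the first variables; their `facts`
    -- serve as hypotheses of every certificate there without being passed each time.
    record Context : Set where
      constructor context
      field
        values : List ℤ
        facts  : Function (length values) (List Rel)

      size = length values

      known : List Rel
      known = instantiate 0 size facts

      field
        true-facts : ∀ ρ → Holdᵣ known (values ++ ρ)

    open Context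

    ∅ : Context
    ∅ = context [] [] (λ _ → tt)

    Holds : (Γ : Context) → ∀ i k → Function k Statement → List ℤ → Set
    Holds Γ i zero    P ρ = ⟦ P ⟧ₛ (values Γ ++ ρ)
    Holds Γ i (suc k) f ρ = ∀ x → Holds Γ (suc i) k (f (var i)) (ρ ++ (x ∷ []))

    -- The check is an implicit argument: for a correct certificate it evaluates to a unit type or a
    -- product of such and is filled in by η, for a wrong one it involves the empty type.
    farkas₂ : ∀ Γ k (f : Function (size Γ ℕ.+ k) Statement) cs ds →
              {Certifies (relations (known Γ)) (instantiate (size Γ) k (apply 0 (size Γ) f)) cs ds} →
              Holds Γ (size Γ) k (apply 0 (size Γ) f) []
    farkas₂ Γ k f cs ds {c} = go (size Γ) k (apply 0 (size Γ) f) c []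
      where
      go : ∀ i k f → Certifies (relations (known Γ)) (instantiate i k f) cs ds → ∀ ρ → Holds Γ i k f ρ
      go i zero    P c ρ = certified (relations (known Γ)) P cs ds c (values Γ ++ ρ) (holdᵣ (known Γ) (true-facts Γ ρ))
      go i (suc k) f c ρ = λ x → go (suc i) k (f (var i)) c (ρ ++ (x ∷ []))

    farkas : ∀ Γ k (f : Function (size Γ ℕ.+ k) Statement) cs →
             {Certifies (relations (known Γ)) (instantiate (size Γ) k (apply 0 (size Γ) f)) cs []} →
             Holds Γ (size Γ) k (apply 0 (size Γ) f) []
    farkas Γ k f cs {c} = farkas₂ Γ k f cs [] {c}

  open LinearArithmetic
    using (#_; ⊝_; _:+_; _:-_; _:*_; _≼_; _≈_; _⇒_; ⊩_; ⊩⊥; Context; context; ∅; farkas; farkas₂)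

  mult-≤ : ∀ {a b} n → + 1 ≤ n → a ≤ b → a * n ≤ b * n
  mult-≤ n n≥1 = *-monoʳ-≤-nonNeg n
    where instance _ = nonNegative (≤-trans (+≤+ z≤n) n≥1)

  *-cancel-gap : ∀ u w n → + 1 ≤ n → u * n + + 1 ≤ w * n → u + + 1 ≤ w
  *-cancel-gap u w n n≥1 h = by-contra λ w<u+1 → strict u w n h (mult-≤ n n≥1 (below u w w<u+1))
    where
    below = farkas ∅ 2 (λ u w → w :+ # 1 ≼ u :+ # 1 ⇒ ⊩ w ≼ u) (1 ∷ 1 ∷ [])

    strict = farkas ∅ 3 (λ u w n → u :* n :+ # 1 ≼ w :* n ⇒ w :* n ≼ u :* n ⇒ ⊩⊥) (1 ∷ 1 ∷ [])

  -- Counting by injections into intervals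

  -- An injection replaces the cardinality of P, and the bound is an integer so that spreads and
  -- differences can be inserted and added by certificates.
  record Bounded {N : ℕ} (P : Fin N → Set) (L : ℤ) : Set where
    field
      size     : ℕ
      size≤    : + size ≤ L
      code     : ∀ x → P x → Fin size
      code-inj : ∀ {x y} (p : P x) (q : P y) → code x p ≡ code y q → x ≡ y

  open Bounded

  bounded-all : ∀ {N P L} → Bounded {N} P L → (∀ x → P x) → + N ≤ L
  bounded-all B p =
    ≤-trans (+≤+ (Fin.injective⇒≤ {f = λ x → code B x (p x)} (code-inj B _ _))) (size≤ B)

  bounded-≤ : ∀ {N P L M} → L ≤ M → Bounded {N} P L → Bounded P M
  bounded-≤ L≤M B = record
    { size = size B ; size≤ = ≤-trans (size≤ B) L≤M ; code = code B ; code-inj = code-inj B }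

  bounded-⊎ : ∀ {N} {P Q R : Fin N → Set} {L M} → (∀ x → P x → Q x ⊎ R x) →
              Bounded Q L → Bounded R M → Bounded P (L + M)
  bounded-⊎ {P = P} {Q} {R} split B C = record
    { size     = size B ℕ.+ size C
    ; size≤    = +-mono-≤ (size≤ B) (size≤ C)
    ; code     = λ x p → Fin.join _ _ (side x (split x p))
    ; code-inj = λ p q e → side-inj (split _ p) (split _ q)
        (trans (sym (Fin.splitAt-join _ _ _)) (trans (cong (Fin.splitAt _) e) (Fin.splitAt-join _ _ _)))
    }
    where
    side : ∀ x → Q x ⊎ R x → Fin (size B) ⊎ Fin (size C)
    side x (inj₁ q) = inj₁ (code B x q)
    side x (inj₂ r) = inj₂ (code C x r)

    side-inj : ∀ {x y} (p : Q x ⊎ R x) (q : Q y ⊎ R y) → side x p ≡ side y q → x ≡ y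
    side-inj (inj₁ p) (inj₁ q) e = code-inj B p q (inj₁-injective e)
      where open import Data.Sum.Properties using (inj₁-injective)
    side-inj (inj₂ p) (inj₂ q) e = code-inj C p q (inj₂-injective e)
      where open import Data.Sum.Properties using (inj₂-injective)

  bounded-∅ : ∀ {N P L} → + 0 ≤ L → (∀ x → ¬ P x) → Bounded {N} P L
  bounded-∅ L≥0 ¬p = record
    { size = 0 ; size≤ = L≥0 ; code = λ x p → ⊥-elim (¬p x p) ; code-inj = λ p _ _ → ⊥-elim (¬p _ p) }

  -- The key may depend on the proof of P x: `pair-bounded` places a vertex differently according to
  -- the class it comes from.
  bounded-window : ∀ {N P} {L} (g : ∀ (x : Fin N) → P x → ℤ) m → + 0 ≤ L →
                   (∀ x p → m ≤ g x p × g x p + + 1 ≤ m + L) →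
                   (∀ {x y} p q → g x p ≡ g y q → x ≡ y) → Bounded P L
  bounded-window {P = P} {+ ℓ} g m _ range inj = record
    { size     = ℓ
    ; size≤    = ≤-refl
    ; code     = λ x p → fromℕ< (offset< x p)
    ; code-inj = λ {x} {y} p q e → inj p q (trans (sym (offset≡ x p))
        (trans (cong (λ t → m + + t) (Fin.fromℕ<-injective _ _ (offset< x p) (offset< y q) e)) (offset≡ y q)))
    }
    where
    offset : ∀ x → P x → ℕ
    offset x p = ∣ g x p - m ∣

    offset-abs : ∀ x p → + offset x p ≡ g x p - m
    offset-abs x p = 0≤i⇒+∣i∣≡i (i≤j⇒0≤j-i (proj₁ (range x p)))

    offset≡ : ∀ x p → m + + offset x p ≡ g x p
    offset≡ x p = trans (cong (λ t → m + t) (offset-abs x p)) (cancel m (g x p))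
      where
      cancel = farkas₂ ∅ 2 (λ a b → ⊩ a :+ (b :- a) ≈ b) (1 ∷ []) (1 ∷ [])

    offset< : ∀ x p → offset x p ℕ.< ℓ
    offset< x p = drop‿+≤+ (subst (λ t → + 1 + t ≤ + ℓ) (sym (offset-abs x p)) (shift (g x p) m (+ ℓ) (proj₂ (range x p))))
      where
      shift = farkas ∅ 3 (λ a m l → a :+ # 1 ≼ m :+ l ⇒ ⊩ # 1 :+ (a :- m) ≼ l) (1 ∷ 1 ∷ [])

  bounded-interval : ∀ {N P} {L} (g : Fin N → ℤ) m → + 0 ≤ L →
                     (∀ x → P x → m ≤ g x × g x + + 1 ≤ m + L) →
                     (∀ {x y} → P x → P y → g x ≡ g y → x ≡ y) → Bounded P L
  bounded-interval g = bounded-window (λ x _ → g x)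

  record Extremes {N : ℕ} (P : Fin N → Set) (g : Fin N → ℤ) : Set where
    field
      bot top : Fin N
      bot∈    : P bot
      top∈    : P top
      bot≤    : ∀ {x} → P x → g bot ≤ g x
      ≤top    : ∀ {x} → P x → g x ≤ g top

  open Extremes

  argmin : ∀ {N} {P : Fin N → Set} → (∀ x → Dec (P x)) → (g : Fin N → ℤ) →
           (∀ x → ¬ P x) ⊎ ∃ λ m → P m × (∀ {x} → P x → g m ≤ g x)
  argmin {zero}          P? g = inj₁ λ ()
  argmin {suc N} {P} P? g with argmin (P? ∘ Fin.suc) (g ∘ Fin.suc) | P? Fin.zero
  ... | inj₁ none           | no ¬p = inj₁ λ { Fin.zero → ¬p ; (Fin.suc x) → none x }
  ... | inj₁ none           | yes p = inj₂ (Fin.zero , p , λ { {Fin.zero} _ → ≤-refl ; {Fin.suc x} q → ⊥-elim (none x q) })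
  ... | inj₂ (m , m∈ , min) | no ¬p = inj₂ (Fin.suc m , m∈ , λ { {Fin.zero} q → ⊥-elim (¬p q) ; {Fin.suc x} q → min q })
  ... | inj₂ (m , m∈ , min) | yes p with ≤-total (g Fin.zero) (g (Fin.suc m))
  ...   | inj₁ z≤m = inj₂ (Fin.zero , p , λ { {Fin.zero} _ → ≤-refl ; {Fin.suc x} q → ≤-trans z≤m (min q) })
  ...   | inj₂ m≤z = inj₂ (Fin.suc m , m∈ , λ { {Fin.zero} _ → m≤z ; {Fin.suc x} q → min q })

  extremes : ∀ {N} {P : Fin N → Set} → (∀ x → Dec (P x)) → (g : Fin N → ℤ) →
             (∀ x → ¬ P x) ⊎ Extremes P g
  extremes P? g with argmin P? g | argmin P? (-_ ∘ g)
  ... | inj₁ none            | _                    = inj₁ none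
  ... | inj₂ _               | inj₁ none            = inj₁ none
  ... | inj₂ (m , m∈ , min)  | inj₂ (M , M∈ , max)  = inj₂ (record
    { bot = m ; top = M ; bot∈ = m∈ ; top∈ = M∈ ; bot≤ = min ; ≤top = λ p → neg-cancel-≤ (max p) })

  extremes-of : ∀ {N} {P : Fin N → Set} {v} → (∀ x → Dec (P x)) → (g : Fin N → ℤ) → P v → Extremes P g
  extremes-of P? g p with extremes P? g
  ... | inj₁ none = ⊥-elim (none _ p)
  ... | inj₂ ext  = ext

  spread : ∀ {N P g} → Extremes {N} P g → ℤ
  spread {g = g} e = g (top e) - g (bot e)

  spread≥0 : ∀ {N P g} (e : Extremes {N} P g) → + 0 ≤ spread e
  spread≥0 e = i≤j⇒0≤j-i (bot≤ e (top∈ e))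

  bounded-spread : ∀ {N P g} (e : Extremes {N} P g) →
                   (∀ {x y} → P x → P y → g x ≡ g y → x ≡ y) → Bounded P (spread e + + 1)
  bounded-spread {g = g} e inj =
    bounded-interval g (g (bot e)) (+-mono-≤ (spread≥0 e) (+≤+ z≤n))
      (λ x p → bot≤ e p , widen (g x) (g (bot e)) (g (top e)) (≤top e p)) inj
    where
    widen = farkas ∅ 3 (λ a m M → a ≼ M ⇒ ⊩ a :+ # 1 ≼ m :+ (M :- m :+ # 1)) (1 ∷ 1 ∷ [])

  -- Points on a circle of length n

  -- N distinct residues mod n, placed on a circle of length n; off x y is the clockwise
  -- distance from x to y.

  record Circle (N : ℕ) (n : ℤ) : Set where
    field
      pos     : Fin N → ℤ
      off quo : Fin N → Fin N → ℤ
      off≥0   : ∀ x y → + 0 ≤ off x y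
      off<n   : ∀ x y → off x y + + 1 ≤ n
      off-eq  : ∀ x y → pos y ≡ pos x + off x y + quo x y * n
      pos-inj : ∀ {x y} w → pos y ≡ pos x + w * n → x ≡ y

  -- Cancelling n > 0 leaves u - 1 < w < u + 1. Winding numbers are read off from bounds on lengths
  -- in this way.
  mult-unique : ∀ w n u → + 1 ≤ n → (u - + 1) * n + + 1 ≤ w * n → w * n + + 1 ≤ (u + + 1) * n → w ≡ u
  mult-unique w n u n≥1 lo hi = ≤-antisym (below w u (*-cancel-gap w (u + + 1) n n≥1 hi)) (above w u (*-cancel-gap (u - + 1) w n n≥1 lo))
    where
    below = farkas ∅ 2 (λ w u → w :+ # 1 ≼ u :+ # 1 ⇒ ⊩ w ≼ u) (1 ∷ 1 ∷ [])

    above = farkas ∅ 2 (λ w u → u :- # 1 :+ # 1 ≼ w ⇒ ⊩ u ≼ w) (1 ∷ 1 ∷ [])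

  mult-none : ∀ w n u → + 1 ≤ n → u * n + + 1 ≤ w * n → w * n + + 1 ≤ (u + + 1) * n → ⊥
  mult-none w n u n≥1 lo hi = absurd w u (*-cancel-gap u w n n≥1 lo) (*-cancel-gap w (u + + 1) n n≥1 hi)
    where
    absurd = farkas ∅ 2 (λ w u → u :+ # 1 ≼ w ⇒ w :+ # 1 ≼ u :+ # 1 ⇒ ⊩⊥) (1 ∷ 1 ∷ [])

  module CircleProperties {N : ℕ} {n : ℤ} (C : Circle N n) where
    open Circle C

    n≥1 : Fin N → + 1 ≤ n
    n≥1 x = go (off x x) n (off≥0 x x) (off<n x x)
      where
      go = farkas ∅ 2 (λ o n → # 0 ≼ o ⇒ o :+ # 1 ≼ n ⇒ ⊩ # 1 ≼ n) (1 ∷ 1 ∷ 1 ∷ [])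

    off-unique : ∀ {x y} d w → pos y ≡ pos x + d + w * n → + 0 ≤ d → d + + 1 ≤ n → off x y ≡ d
    off-unique {x} {y} d w e d≥0 d<n =
      finish (off x y) d (quo x y) w n (pos x) (pos y) (off-eq x y) e
        (mult-unique (quo x y - w) n (+ 0) (n≥1 x) (lo (off x y) d (quo x y) w n (pos x) (pos y) (off-eq x y) e (off<n x y) d≥0)
          (hi (off x y) d (quo x y) w n (pos x) (pos y) (off-eq x y) e (off≥0 x y) d<n))
      where
      lo = farkas ∅ 7 (λ o d q w n px py →
          py ≈ px :+ o :+ q :* n ⇒ py ≈ px :+ d :+ w :* n ⇒ o :+ # 1 ≼ n ⇒ # 0 ≼ d ⇒
          ⊩ (# 0 :- # 1) :* n :+ # 1 ≼ (q :- w) :* n) (1 ∷ 1 ∷ 1 ∷ 0 ∷ 1 ∷ 1 ∷ [])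

      hi = farkas ∅ 7 (λ o d q w n px py →
          py ≈ px :+ o :+ q :* n ⇒ py ≈ px :+ d :+ w :* n ⇒ # 0 ≼ o ⇒ d :+ # 1 ≼ n ⇒
          ⊩ (q :- w) :* n :+ # 1 ≼ (# 0 :+ # 1) :* n) (1 ∷ 1 ∷ 1 ∷ 1 ∷ 0 ∷ 0 ∷ 1 ∷ [])

      finish : ∀ o d q w n px py → py ≡ px + o + q * n → py ≡ px + d + w * n → q - w ≡ + 0 → o ≡ d
      finish o d q w n px py e₁ e₂ e₃ = begin
        o                            ≡⟨ lhs o q w n px ⟩
        (px + o + q * n) - px - w * n - (q - w) * n  ≡⟨ cong₂ (λ t u → t - px - w * n - u * n) (trans (sym e₁) e₂) e₃ ⟩
        (px + d + w * n) - px - w * n - + 0 * n      ≡⟨ rhs d w n px ⟩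
        d                            ∎
        where
        open ≡-Reasoning

        lhs = farkas₂ ∅ 5 (λ o q w n px →
            ⊩ o ≈ px :+ o :+ q :* n :- px :- w :* n :- (q :- w) :* n) (1 ∷ []) (1 ∷ [])

        rhs = farkas₂ ∅ 4 (λ d w n px →
            ⊩ px :+ d :+ w :* n :- px :- w :* n :- # 0 :* n ≈ d) (1 ∷ []) (1 ∷ [])

    -- A sum of two offsets lies between 0 and 2 n - 2, so reducing it modulo n takes away at most
    -- one turn.
    off-add : ∀ x y z → off x y + off y z ≡ off x z ⊎ off x y + off y z ≡ off x z + n
    off-add x y z with ≤⊎≥ n (off x y + off y z)
    ... | inj₂ lt = inj₁ (sym (off-unique (off x y + off y z) (quo x y + quo y z)
      (compose (pos x) (pos y) (pos z) (off x y) (off y z) (quo x y) (quo y z) n (off-eq x y) (off-eq y z))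
      (+-mono-≤ (off≥0 x y) (off≥0 y z)) lt))
      where
      compose = farkas₂ ∅ 8 (λ px py pz d e w v n →
          py ≈ px :+ d :+ w :* n ⇒ pz ≈ py :+ e :+ v :* n ⇒ ⊩ pz ≈ px :+ (d :+ e) :+ (w :+ v) :* n)
          (1 ∷ 1 ∷ 0 ∷ 1 ∷ []) (1 ∷ 0 ∷ 1 ∷ 0 ∷ 1 ∷ [])

    ... | inj₁ ge = inj₂ (shift (off x y) (off y z) (off x z) n (off-unique (off x y + off y z - n) (quo x y + quo y z + + 1)
      (compose (pos x) (pos y) (pos z) (off x y) (off y z) (quo x y) (quo y z) n (off-eq x y) (off-eq y z))
      (i≤j⇒0≤j-i ge) (below (off x y) (off y z) n (off<n x y) (off<n y z))))
      where
      compose = farkas₂ ∅ 8 (λ px py pz d e w v n →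
          py ≈ px :+ d :+ w :* n ⇒ pz ≈ py :+ e :+ v :* n ⇒
          ⊩ pz ≈ px :+ (d :+ e :- n) :+ (w :+ v :+ # 1) :* n)
          (1 ∷ 1 ∷ 0 ∷ 1 ∷ []) (1 ∷ 0 ∷ 1 ∷ 0 ∷ 1 ∷ [])

      below = farkas ∅ 3 (λ d e n →
          d :+ # 1 ≼ n ⇒ e :+ # 1 ≼ n ⇒ ⊩ d :+ e :- n :+ # 1 ≼ n) (1 ∷ 1 ∷ 1 ∷ [])

      shift = farkas₂ ∅ 4 (λ d e o n →
          o ≈ d :+ e :- n ⇒ ⊩ d :+ e ≈ o :+ n) (1 ∷ 0 ∷ 1 ∷ []) (1 ∷ 1 ∷ [])

    off-sum : ∀ x y z → off x y + off y z + + 1 ≤ n → off x z ≡ off x y + off y z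
    off-sum x y z lt with off-add x y z
    ... | inj₁ e = sym e
    ... | inj₂ e = ⊥-elim (absurd (off x y + off y z) (off x z) n lt e (off≥0 x z))
      where
      absurd = farkas ∅ 3 (λ t o n → t :+ # 1 ≼ n ⇒ t ≈ o :+ n ⇒ # 0 ≼ o ⇒ ⊩⊥) (1 ∷ 0 ∷ 1 ∷ 1 ∷ [])

    off-diff : ∀ x y z → off x y ≤ off x z → off y z ≡ off x z - off x y
    off-diff x y z le with off-add x y z
    ... | inj₁ e = finish (off x y) (off y z) (off x z) e
      where
      finish = farkas₂ ∅ 3 (λ d e o → d :+ e ≈ o ⇒ ⊩ e ≈ o :- d) (1 ∷ 1 ∷ []) (1 ∷ 0 ∷ 1 ∷ [])

    ... | inj₂ e = ⊥-elim (absurd (off x y) (off y z) (off x z) n e le (off<n y z))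
      where
      absurd = farkas ∅ 4 (λ d e o n →
          d :+ e ≈ o :+ n ⇒ d ≼ o ⇒ e :+ # 1 ≼ n ⇒ ⊩⊥) (1 ∷ 1 ∷ 0 ∷ 1 ∷ [])

    off-refl : ∀ x → off x x ≡ + 0
    off-refl x = off-unique (+ 0) (+ 0) (loop (pos x) n) ≤-refl (n≥1 x)
      where
      loop = farkas₂ ∅ 2 (λ p n → ⊩ p ≈ p :+ # 0 :+ # 0 :* n) (1 ∷ []) (1 ∷ [])

    off-flip : ∀ {x y} → ¬ x ≡ y → off x y + off y x ≡ n
    off-flip {x} {y} x≢y with off-add x y x
    ... | inj₂ e = trans e (trans (cong (_+ n) (off-refl x)) (+-identityˡ n))
    ... | inj₁ e = contradiction
      (pos-inj (quo x y) (drop (pos x) (pos y) (off x y) (quo x y) n (off-eq x y) zero-off)) x≢y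
      where
      drop = farkas₂ ∅ 5 (λ px py d q n →
          py ≈ px :+ d :+ q :* n ⇒ d ≈ # 0 ⇒ ⊩ py ≈ px :+ q :* n)
          (1 ∷ 1 ∷ 0 ∷ 1 ∷ []) (1 ∷ 0 ∷ 1 ∷ 0 ∷ 1 ∷ [])

      collapse = farkas₂ ∅ 2 (λ d e →
          # 0 ≼ d ⇒ # 0 ≼ e ⇒ d :+ e ≈ # 0 ⇒ ⊩ d ≈ # 0) (1 ∷ 1 ∷ 0 ∷ 1 ∷ []) (1 ∷ 0 ∷ 0 ∷ 0 ∷ 1 ∷ [])

      zero-off : off x y ≡ + 0
      zero-off = collapse (off x y) (off y x) (off≥0 x y) (off≥0 y x) (trans e (off-refl x))

    off-inj : ∀ {v x y} → off v x ≡ off v y → x ≡ y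
    off-inj {v} {x} {y} e = pos-inj (quo v y - quo v x)
      (link (pos v) (pos x) (pos y) (off v x) (off v y) (quo v x) (quo v y) n (off-eq v x) (off-eq v y) e)
      where
      link = farkas₂ ∅ 8 (λ pv px py d e w u n →
          px ≈ pv :+ d :+ w :* n ⇒ py ≈ pv :+ e :+ u :* n ⇒ d ≈ e ⇒ ⊩ py ≈ px :+ (u :- w) :* n)
          (1 ∷ 0 ∷ 1 ∷ 1 ∷ 0 ∷ 0 ∷ 1 ∷ []) (1 ∷ 1 ∷ 0 ∷ 0 ∷ 1 ∷ 1 ∷ [])

  -- The graph of one block and its signed walks

  module Circulant {N : ℕ} {n : ℤ} (C : Circle N n) (a s : ℤ) where
    open Circle C
    open CircleProperties C

    infix 4 _⟶_ _⟶?_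

    _⟶_ : Fin N → Fin N → Set
    x ⟶ y = a + + 1 ≤ off x y × off x y ≤ a + s

    _⟶?_ : ∀ x y → Dec (x ⟶ y)
    x ⟶? y = (a + + 1 ≤? off x y) ×-dec (off x y ≤? a + s)

    Adj : Fin N → Fin N → Set
    Adj x y = x ⟶ y ⊎ y ⟶ x

    Adj-sym : ∀ {x y} → Adj x y → Adj y x
    Adj-sym (inj₁ e) = inj₂ e
    Adj-sym (inj₂ e) = inj₁ e

    DiamTwo : Set
    DiamTwo = ∀ x y → x ≡ y ⊎ Adj x y ⊎ ∃ λ z → Adj x z × Adj z y

    -- The indices count forward and backward edges, because these two numbers alone fix the
    -- interval in which the signed length can lie.
    data Walk : Fin N → Fin N → ℕ → ℕ → Set where
      stop : ∀ {x} → Walk x x 0 0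
      fwd  : ∀ {x y z p q} → x ⟶ y → Walk y z p q → Walk x z (suc p) q
      bwd  : ∀ {x y z p q} → y ⟶ x → Walk y z p q → Walk x z p (suc q)

    snoc-fwd : ∀ {x y z p q} → Walk x y p q → y ⟶ z → Walk x z (suc p) q
    snoc-fwd stop      e = fwd e stop
    snoc-fwd (fwd d W) e = fwd d (snoc-fwd W e)
    snoc-fwd (bwd d W) e = bwd d (snoc-fwd W e)

    snoc-bwd : ∀ {x y z p q} → Walk x y p q → z ⟶ y → Walk x z p (suc q)
    snoc-bwd stop      e = bwd e stop
    snoc-bwd (fwd d W) e = fwd d (snoc-bwd W e)
    snoc-bwd (bwd d W) e = bwd d (snoc-bwd W e)

    _++_ : ∀ {x y z p q p′ q′} → Walk x y p q → Walk y z p′ q′ → Walk x z (p ℕ.+ p′) (q ℕ.+ q′)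
    stop    ++ W′ = W′
    fwd e W ++ W′ = fwd e (W ++ W′)
    bwd e W ++ W′ = bwd e (W ++ W′)

    reverse : ∀ {x y p q} → Walk x y p q → Walk y x q p
    reverse stop      = stop
    reverse (fwd e W) = snoc-bwd (reverse W) e
    reverse (bwd e W) = snoc-fwd (reverse W) e

    sum : ∀ {x y p q} → Walk x y p q → ℤ
    sum stop                  = + 0
    sum (fwd {x} {y} e W)     = off x y + sum W
    sum (bwd {x} {y} e W)     = sum W - off y x

    sum-++ : ∀ {x y z p q p′ q′} (W : Walk x y p q) (W′ : Walk y z p′ q′) → sum (W ++ W′) ≡ sum W + sum W′
    sum-++ stop W′ = sym (+-identityˡ (sum W′))
    sum-++ (fwd {x} {y} e W) W′ =
      trans (cong (λ t → off x y + t) (sum-++ W W′)) (sym (+-assoc (off x y) (sum W) (sum W′)))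
    sum-++ (bwd {x} {y} e W) W′ =
      trans (cong (_- off y x) (sum-++ W W′)) (swap (sum W) (sum W′) (off y x))
      where
      swap = farkas₂ ∅ 3 (λ a b c → ⊩ a :+ b :- c ≈ a :- c :+ b) (1 ∷ []) (1 ∷ [])

    sum-snoc-fwd : ∀ {x y z p q} (W : Walk x y p q) (e : y ⟶ z) → sum (snoc-fwd W e) ≡ sum W + off y z
    sum-snoc-fwd {y = y} {z} stop e = +-comm (off y z) (+ 0)
    sum-snoc-fwd {y = y} {z} (fwd {x} {x′} d W) e =
      trans (cong (λ t → off x x′ + t) (sum-snoc-fwd W e)) (sym (+-assoc (off x x′) (sum W) (off y z)))
    sum-snoc-fwd {y = y} {z} (bwd {x} {x′} d W) e =
      trans (cong (_- off x′ x) (sum-snoc-fwd W e)) (swap (sum W) (off y z) (off x′ x))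
      where
      swap = farkas₂ ∅ 3 (λ a b c → ⊩ a :+ b :- c ≈ a :- c :+ b) (1 ∷ []) (1 ∷ [])

    sum-snoc-bwd : ∀ {x y z p q} (W : Walk x y p q) (e : z ⟶ y) → sum (snoc-bwd W e) ≡ sum W - off z y
    sum-snoc-bwd stop e = refl
    sum-snoc-bwd {y = y} {z} (fwd {x} {x′} d W) e =
      trans (cong (λ t → off x x′ + t) (sum-snoc-bwd W e)) (sym (+-assoc (off x x′) (sum W) (- off z y)))
    sum-snoc-bwd {y = y} {z} (bwd {x} {x′} d W) e =
      trans (cong (_- off x′ x) (sum-snoc-bwd W e)) (swap (sum W) (off z y) (off x′ x))
      where
      swap = farkas₂ ∅ 3 (λ a b c → ⊩ a :- b :- c ≈ a :- c :- b) (1 ∷ []) (1 ∷ [])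

    sum-reverse : ∀ {x y p q} (W : Walk x y p q) → sum (reverse W) ≡ - sum W
    sum-reverse stop = refl
    sum-reverse (fwd {x} {y} e W) =
      trans (sum-snoc-bwd (reverse W) e) (trans (cong (_- off x y) (sum-reverse W)) (negate (sum W) (off x y)))
      where
      negate = farkas₂ ∅ 2 (λ a b → ⊩ ⊝ a :- b ≈ ⊝ (b :+ a)) (1 ∷ []) (1 ∷ [])

    sum-reverse (bwd {x} {y} e W) =
      trans (sum-snoc-fwd (reverse W) e) (trans (cong (_+ off y x) (sum-reverse W)) (negate (sum W) (off y x)))
      where
      negate = farkas₂ ∅ 2 (λ a b → ⊩ ⊝ a :+ b ≈ ⊝ (a :- b)) (1 ∷ []) (1 ∷ [])

    turns : ∀ {x y p q} → Walk x y p q → ℤ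
    turns stop                = + 0
    turns (fwd {x} {y} e W)   = quo x y + turns W
    turns (bwd {x} {y} e W)   = turns W - quo y x

    sum-eq : ∀ {x y p q} (W : Walk x y p q) → pos y ≡ pos x + sum W + turns W * n
    sum-eq {x} stop = loop (pos x) n
      where
      loop = farkas₂ ∅ 2 (λ p n → ⊩ p ≈ p :+ # 0 :+ # 0 :* n) (1 ∷ []) (1 ∷ [])

    sum-eq (fwd {x} {y} {z} e W) =
      step (pos x) (pos y) (pos z) (off x y) (quo x y) (sum W) (turns W) n (off-eq x y) (sum-eq W)
      where
      step = farkas₂ ∅ 8 (λ px py pz d q σ w n →
          py ≈ px :+ d :+ q :* n ⇒ pz ≈ py :+ σ :+ w :* n ⇒ ⊩ pz ≈ px :+ (d :+ σ) :+ (q :+ w) :* n)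
          (1 ∷ 1 ∷ 0 ∷ 1 ∷ []) (1 ∷ 0 ∷ 1 ∷ 0 ∷ 1 ∷ [])

    sum-eq (bwd {x} {y} {z} e W) =
      step (pos x) (pos y) (pos z) (off y x) (quo y x) (sum W) (turns W) n (off-eq y x) (sum-eq W)
      where
      step = farkas₂ ∅ 8 (λ px py pz d q σ w n →
          px ≈ py :+ d :+ q :* n ⇒ pz ≈ py :+ σ :+ w :* n ⇒ ⊩ pz ≈ px :+ (σ :- d) :+ (w :- q) :* n)
          (1 ∷ 1 ∷ 0 ∷ 0 ∷ 1 ∷ []) (1 ∷ 0 ∷ 1 ∷ 1 ∷ [])

    sum-lo : ∀ {x y p q} (W : Walk x y p q) → + p * (a + + 1) - + q * (a + s) ≤ sum W
    sum-lo stop = ≤-reflexive (zero-sum a s)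
      where
      zero-sum = farkas₂ ∅ 2 (λ a s → ⊩ # 0 :* (a :+ # 1) :- # 0 :* (a :+ s) ≈ # 0) (1 ∷ []) (1 ∷ [])

    sum-lo (fwd {x} {y} {_} {p} {q} (lo , _) W) = step (+ p) (+ q) a s (off x y) (sum W) lo (sum-lo W)
      where
      step = farkas ∅ 6 (λ P Q a s d σ →
          a :+ # 1 ≼ d ⇒ P :* (a :+ # 1) :- Q :* (a :+ s) ≼ σ ⇒
          ⊩ (# 1 :+ P) :* (a :+ # 1) :- Q :* (a :+ s) ≼ d :+ σ) (1 ∷ 1 ∷ 1 ∷ [])

    sum-lo (bwd {x} {y} {_} {p} {q} (_ , hi) W) = step (+ p) (+ q) a s (off y x) (sum W) hi (sum-lo W)
      where
      step = farkas ∅ 6 (λ P Q a s d σ →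
          d ≼ a :+ s ⇒ P :* (a :+ # 1) :- Q :* (a :+ s) ≼ σ ⇒
          ⊩ P :* (a :+ # 1) :- (# 1 :+ Q) :* (a :+ s) ≼ σ :- d) (1 ∷ 1 ∷ 1 ∷ [])

    sum-hi : ∀ {x y p q} (W : Walk x y p q) → sum W ≤ + p * (a + s) - + q * (a + + 1)
    sum-hi stop = ≤-reflexive (zero-sum a s)
      where
      zero-sum = farkas₂ ∅ 2 (λ a s → ⊩ # 0 ≈ # 0 :* (a :+ s) :- # 0 :* (a :+ # 1)) (1 ∷ []) (1 ∷ [])

    sum-hi (fwd {x} {y} {_} {p} {q} (_ , hi) W) = step (+ p) (+ q) a s (off x y) (sum W) hi (sum-hi W)
      where
      step = farkas ∅ 6 (λ P Q a s d σ →
          d ≼ a :+ s ⇒ σ ≼ P :* (a :+ s) :- Q :* (a :+ # 1) ⇒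
          ⊩ d :+ σ ≼ (# 1 :+ P) :* (a :+ s) :- Q :* (a :+ # 1)) (1 ∷ 1 ∷ 1 ∷ [])

    sum-hi (bwd {x} {y} {_} {p} {q} (lo , _) W) = step (+ p) (+ q) a s (off y x) (sum W) lo (sum-hi W)
      where
      step = farkas ∅ 6 (λ P Q a s d σ →
          a :+ # 1 ≼ d ⇒ σ ≼ P :* (a :+ s) :- Q :* (a :+ # 1) ⇒
          ⊩ σ :- d ≼ P :* (a :+ s) :- (# 1 :+ Q) :* (a :+ # 1)) (1 ∷ 1 ∷ 1 ∷ [])

    closed-sum : ∀ {x p q} (W : Walk x x p q) → sum W ≡ - turns W * n
    closed-sum {x} W = go (pos x) (sum W) (turns W) n (sum-eq W)
      where
      go = farkas₂ ∅ 4 (λ p σ w n →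
          p ≈ p :+ σ :+ w :* n ⇒ ⊩ σ ≈ ⊝ w :* n) (1 ∷ 0 ∷ 1 ∷ []) (1 ∷ 1 ∷ [])

    -- The two hypotheses put the sum of a (p, q)-walk strictly between u n and (u + 1) n.
    no-closed : ∀ {x p q} u → u * n + + 1 ≤ + p * (a + + 1) - + q * (a + s) →
                + p * (a + s) - + q * (a + + 1) + + 1 ≤ (u + + 1) * n → ¬ Walk x x p q
    no-closed {x} u lo hi W = mult-none (- turns W) n u (n≥1 x)
      (≤-trans lo (≤-trans (sum-lo W) (≤-reflexive (closed-sum W))))
      (≤-trans (+-monoˡ-≤ (+ 1) (≤-trans (≤-reflexive (sym (closed-sum W))) (sum-hi W))) hi)

    record Pentagon : Set where
      constructor pentagon
      field
        {v₀ v₁ v₂ v₃ v₄} : Fin N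
        e₀₁ : v₀ ⟶ v₁
        e₁₂ : v₁ ⟶ v₂
        e₂₃ : v₂ ⟶ v₃
        e₃₄ : v₃ ⟶ v₄
        e₄₀ : v₄ ⟶ v₀

    open Pentagon

    -- Five rotations give P back definitionally, by η for records; the cyclic sums over a pentagon
    -- close up because of this.
    rot : Pentagon → Pentagon
    rot P = pentagon (e₁₂ P) (e₂₃ P) (e₃₄ P) (e₄₀ P) (e₀₁ P)

  -- One-directional closed 5-walks: blow-ups of a directed pentagon

  module Unidirectional {N : ℕ} {n : ℤ} (C : Circle N n) (a s : ℤ)
    (s≥1 : + 1 ≤ s) (a≥2s : + 2 * s ≤ a) (n>2a+2s : + 2 * a + + 2 * s + + 1 ≤ n)
    (n≉3a : n ≤ + 3 * a - s + + 3 ⊎ + 3 * a + + 4 * s ≤ n)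
    (diam : Circulant.DiamTwo C a s) where

    open Circle C
    open CircleProperties C
    open Circulant C a s
    open Pentagon

    Γ : Context
    Γ = context (n ∷ a ∷ s ∷ []) (λ n a s → (# 1 ≼ s) ∷ (# 2 :* s ≼ a) ∷ (# 2 :* a :+ # 2 :* s :+ # 1 ≼ n) ∷ [])
      λ _ → s≥1 , a≥2s , n>2a+2s , tt

    short = farkas Γ 2 (λ n a s d e →
        d ≼ a :+ s ⇒ e ≼ a :+ s ⇒ d :+ e ≈ n ⇒ ⊩⊥) (0 ∷ 1 ∷ 1 ∷ 1 ∷ 0 ∷ 0 ∷ 1 ∷ [])

    loop = farkas Γ 1 (λ n a s d → a :+ # 1 ≼ d ⇒ d ≈ # 0 ⇒ ⊩⊥) (1 ∷ 0 ∷ 1 ∷ 2 ∷ 1 ∷ [])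

    asym : ∀ {x y} → x ⟶ y → y ⟶ x → ⊥
    asym {x} {y} e f with x Fin.≟ y
    ... | no x≢y  = short (off x y) (off y x) (proj₂ e) (proj₂ f) (off-flip x≢y)
    ... | yes x≡y = loop (off x y) (proj₁ e) (trans (cong (off x) (sym x≡y)) (off-refl x))

    -- The length lies between a + 3 - 2 s, positive because a ≥ 2 s, and a + 3 s - 2, which is less
    -- than n.
    no-32 : ∀ {x} → ¬ Walk x x 3 2
    no-32 = no-closed (+ 0) lo hi
      where
      lo = farkas Γ 0 (λ n a s →
          ⊩ # 0 :* n :+ # 1 ≼ # 3 :* (a :+ # 1) :- # 2 :* (a :+ s)) (1 ∷ 0 ∷ 1 ∷ [])

      hi = farkas Γ 0 (λ n a s →
          ⊩ # 3 :* (a :+ s) :- # 2 :* (a :+ # 1) :+ # 1 ≼ (# 0 :+ # 1) :* n) (1 ∷ 1 ∷ 1 ∷ 1 ∷ [])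

    -- The length lies between 3 a + 4 - s and 3 a + 4 s - 1. The hypothesis `n≉3a` says precisely
    -- that n is outside this interval, and 0 and 2 n are outside too.
    no-41 : ∀ {x} → ¬ Walk x x 4 1
    no-41 = [ over , under ]′ n≉3a
      where
      over : n ≤ + 3 * a - s + + 3 → ∀ {x} → ¬ Walk x x 4 1
      over h = no-closed (+ 1) (lo h) hi
        where
        lo = farkas Γ 0 (λ n a s →
            n ≼ # 3 :* a :- s :+ # 3 ⇒ ⊩ # 1 :* n :+ # 1 ≼ # 4 :* (a :+ # 1) :- # 1 :* (a :+ s))
            (1 ∷ 1 ∷ [])

        hi = farkas Γ 0 (λ n a s →
            ⊩ # 4 :* (a :+ s) :- # 1 :* (a :+ # 1) :+ # 1 ≼ (# 1 :+ # 1) :* n) (1 ∷ 2 ∷ 1 ∷ 2 ∷ [])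

      under : + 3 * a + + 4 * s ≤ n → ∀ {x} → ¬ Walk x x 4 1
      under h = no-closed (+ 0) lo (hi h)
        where
        lo = farkas Γ 0 (λ n a s →
            ⊩ # 0 :* n :+ # 1 ≼ # 4 :* (a :+ # 1) :- # 1 :* (a :+ s)) (1 ∷ 5 ∷ 3 ∷ [])

        hi = farkas Γ 0 (λ n a s →
            # 3 :* a :+ # 4 :* s ≼ n ⇒
            ⊩ # 4 :* (a :+ s) :- # 1 :* (a :+ # 1) :+ # 1 ≼ (# 0 :+ # 1) :* n) (1 ∷ 1 ∷ [])

    -- A backward second edge would make the closed 5-walk use both directions, so its edge counts
    -- would be (4, 1) or (3, 2) up to reversal.
    next-edge : ∀ {x y z u v} → x ⟶ y → Adj y z → Adj z u → Adj u v → Adj v x → y ⟶ z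
    next-edge e (inj₁ f) _ _ _ = f
    next-edge e (inj₂ f) (inj₁ g) (inj₁ h) (inj₁ i) = ⊥-elim (no-41 (fwd e (bwd f (fwd g (fwd h (fwd i stop))))))
    next-edge e (inj₂ f) (inj₁ g) (inj₁ h) (inj₂ i) = ⊥-elim (no-32 (fwd e (bwd f (fwd g (fwd h (bwd i stop))))))
    next-edge e (inj₂ f) (inj₁ g) (inj₂ h) (inj₁ i) = ⊥-elim (no-32 (fwd e (bwd f (fwd g (bwd h (fwd i stop))))))
    next-edge e (inj₂ f) (inj₂ g) (inj₁ h) (inj₁ i) = ⊥-elim (no-32 (fwd e (bwd f (bwd g (fwd h (fwd i stop))))))
    next-edge e (inj₂ f) (inj₁ g) (inj₂ h) (inj₂ i) = ⊥-elim (no-32 (reverse (fwd e (bwd f (fwd g (bwd h (bwd i stop)))))))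
    next-edge e (inj₂ f) (inj₂ g) (inj₁ h) (inj₂ i) = ⊥-elim (no-32 (reverse (fwd e (bwd f (bwd g (fwd h (bwd i stop)))))))
    next-edge e (inj₂ f) (inj₂ g) (inj₂ h) (inj₁ i) = ⊥-elim (no-32 (reverse (fwd e (bwd f (bwd g (bwd h (fwd i stop)))))))
    next-edge e (inj₂ f) (inj₂ g) (inj₂ h) (inj₂ i) = ⊥-elim (no-41 (reverse (fwd e (bwd f (bwd g (bwd h (bwd i stop)))))))

    orient : ∀ {x y z u v} → x ⟶ y → Adj y z → Adj z u → Adj u v → Adj v x → Pentagon
    orient e f g h i = pentagon e f⟶ g⟶ h⟶ i⟶
      where
      f⟶ = next-edge e f g h i
      g⟶ = next-edge f⟶ g h i (inj₁ e)
      h⟶ = next-edge g⟶ h i (inj₁ e) (inj₁ f⟶)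
      i⟶ = next-edge h⟶ i (inj₁ e) (inj₁ f⟶) (inj₁ g⟶)

    -- The closed walk v, y, u, w, x starts forward, so its last edge would have to run from x to v,
    -- against v ⟶ x.
    fork : ∀ {v x y u w} → v ⟶ x → v ⟶ y → Adj y u → Adj u w → Adj w x → ⊥
    fork e f g h i = asym e (e₄₀ (orient f g h i (inj₂ e)))

    -- Running back and forth along one edge turns a triangle into a closed 5-walk, and such an edge
    -- is used in both directions.
    triangle-free : ∀ {x y z} → Adj x y → Adj y z → Adj z x → ⊥
    triangle-free (inj₁ e) f g = asym e (e₁₂ (orient e (inj₂ e) (inj₁ e) f g))
    triangle-free (inj₂ e) f g = asym e (e₁₂ (orient e (inj₂ e) (inj₁ e) (Adj-sym g) (Adj-sym f)))

    -- The vertices that can replace v₀ in the pentagon.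
    Class : Pentagon → Fin N → Set
    Class P x = v₄ P ⟶ x × x ⟶ v₁ P

    -- If x is adjacent to v₂ or v₃, a pentagon through x reveals its class. Otherwise x reaches
    -- both v₂ and v₃ in two steps, and the two resulting closed 5-walks orient the edge between x
    -- and v₀ in opposite ways.
    neighbours-of-v₀ : ∀ P {x} → Adj x (v₀ P) → Class (rot P) x ⊎ Class (rot (rot (rot (rot P)))) x
    neighbours-of-v₀ P {x} a₀ with diam x (v₂ P) | diam x (v₃ P)
    ... | inj₁ refl | _ = ⊥-elim (triangle-free (inj₁ (e₀₁ P)) (inj₁ (e₁₂ P)) a₀)
    ... | inj₂ (inj₁ a₂) | _ = inj₁ (e₃₄ Q , e₄₀ Q)
      where Q = orient (e₂₃ P) (inj₁ (e₃₄ P)) (inj₁ (e₄₀ P)) (Adj-sym a₀) a₂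
    ... | inj₂ (inj₂ _) | inj₁ refl = ⊥-elim (triangle-free (inj₁ (e₃₄ P)) (inj₁ (e₄₀ P)) (Adj-sym a₀))
    ... | inj₂ (inj₂ _) | inj₂ (inj₁ a₃) = inj₂ (e₃₄ Q , e₄₀ Q)
      where Q = orient (e₀₁ P) (inj₁ (e₁₂ P)) (inj₁ (e₂₃ P)) (Adj-sym a₃) a₀
    ... | inj₂ (inj₂ (y , xy , y2)) | inj₂ (inj₂ (z , xz , z3)) = ⊥-elim (asym
      (e₂₃ (orient (e₃₄ P) (inj₁ (e₄₀ P)) (Adj-sym a₀) xz z3))
      (e₄₀ (orient (e₀₁ P) (inj₁ (e₁₂ P)) (Adj-sym y2) (Adj-sym xy) a₀)))

    -- Both y and v₀ are out-neighbours of v₄, and v₀, z, x, y would be a walk of length three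
    -- between them, which `fork` forbids.
    no-common-neighbour : ∀ P {x y z} → Class P y → Class (rot P) z → Adj x y → Adj x z → ⊥
    no-common-neighbour P (4y , _) (0z , _) xy xz =
      fork 4y (e₄₀ P) (inj₁ 0z) (Adj-sym xz) xy

    -- If x has distance two from v₀, a common neighbour lies in the class of v₁ or v₄. Then x is
    -- compared with that vertex: a second common neighbour would lie in a class next to the first
    -- one, against `no-common-neighbour`.
    cover : ∀ P x → Class P x ⊎ Class (rot P) x ⊎ Class (rot (rot P)) x
          ⊎ Class (rot (rot (rot P))) x ⊎ Class (rot (rot (rot (rot P)))) x
    cover P x with diam x (v₀ P)
    ... | inj₁ refl = inj₁ (e₄₀ P , e₀₁ P)
    ... | inj₂ (inj₁ x0) = [ (λ c → inj₂ (inj₁ c)) , (λ c → inj₂ (inj₂ (inj₂ (inj₂ c)))) ]′ (neighbours-of-v₀ P x0)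
    ... | inj₂ (inj₂ (y , xy , y0)) with neighbours-of-v₀ P y0
    ...   | inj₁ y∈1 with diam x (v₁ P)
    ...     | inj₁ refl = inj₂ (inj₁ (e₀₁ P , e₁₂ P))
    ...     | inj₂ (inj₁ x1) = [ (λ c → inj₂ (inj₂ (inj₁ c))) , inj₁ ]′ (neighbours-of-v₀ (rot P) x1)
    ...     | inj₂ (inj₂ (z , xz , z1)) = ⊥-elim
      ([ (λ z∈2 → no-common-neighbour (rot P) y∈1 z∈2 xy xz)
       , (λ z∈0 → no-common-neighbour P z∈0 y∈1 xz xy) ]′ (neighbours-of-v₀ (rot P) z1))
    cover P x | inj₂ (inj₂ (y , xy , y0)) | inj₂ y∈4 with diam x (v₄ P)
    ...     | inj₁ refl = inj₂ (inj₂ (inj₂ (inj₂ (e₃₄ P , e₄₀ P))))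
    ...     | inj₂ (inj₁ x4) = [ inj₁ , (λ c → inj₂ (inj₂ (inj₂ (inj₁ c)))) ]′
      (neighbours-of-v₀ (rot (rot (rot (rot P)))) x4)
    ...     | inj₂ (inj₂ (z , xz , z4)) = ⊥-elim
      ([ (λ z∈0 → no-common-neighbour (rot (rot (rot (rot P)))) y∈4 z∈0 xy xz)
       , (λ z∈3 → no-common-neighbour (rot (rot (rot P))) z∈3 y∈4 xz xy) ]′
       (neighbours-of-v₀ (rot (rot (rot (rot P)))) z4))

    -- A common neighbour z instead of an edge would give the walk v₀, y, z, x between two
    -- out-neighbours of v₄; an edge between x and y lies in a pentagon, which fixes its direction.
    complete : ∀ P {x y} → Class P x → Class (rot P) y → x ⟶ y
    complete P {x} {y} (4x , x1) (0y , y2) with diam x y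
    ... | inj₁ refl = ⊥-elim (triangle-free (inj₁ (e₄₀ P)) (inj₁ 0y) (inj₂ 4x))
    ... | inj₂ (inj₁ xy) = e₄₀ (orient y2 (inj₁ (e₂₃ P)) (inj₁ (e₃₄ P)) (inj₁ 4x) xy)
    ... | inj₂ (inj₂ (z , xz , zy)) = ⊥-elim (fork 4x (e₄₀ P) (inj₁ 0y) (Adj-sym zy) (Adj-sym xz))

    class-extremes : ∀ P → Extremes (Class P) (off (v₄ P))
    class-extremes P = extremes-of {v = v₀ P} (λ x → (v₄ P ⟶? x) ×-dec (x ⟶? v₁ P)) (off (v₄ P)) (e₄₀ P , e₀₁ P)

    width gap : Pentagon → ℤ
    width P = spread (class-extremes P)
    gap P = off (top (class-extremes P)) (bot (class-extremes (rot P)))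

    first : Pentagon → Fin N
    first P = bot (class-extremes P)

    off-bot-top : ∀ P → off (first P) (top (class-extremes P)) ≡ width P
    off-bot-top P = off-diff (v₄ P) (first P) (top E) (bot≤ E (top∈ E))
      where E = class-extremes P

    width< : ∀ P → width P + + 1 ≤ s
    width< P = go (off (v₄ P) (bot E)) (off (v₄ P) (top E)) (proj₁ (proj₁ (bot∈ E))) (proj₂ (proj₁ (top∈ E)))
      where
      E = class-extremes P
      go = farkas Γ 2 (λ n a s d e → a :+ # 1 ≼ d ⇒ e ≼ a :+ s ⇒ ⊩ e :- d :+ # 1 ≼ s) (1 ∷ 1 ∷ 1 ∷ [])

    gap-bounds : ∀ P → a + + 1 ≤ gap P × gap P ≤ a + s
    gap-bounds P = complete P (top∈ (class-extremes P)) (bot∈ (class-extremes (rot P)))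

    first-step : ∀ P → off (first P) (first (rot P)) ≡ width P + gap P
    first-step P = trans (off-sum (first P) _ _ (lt (off-bot-top P))) (cong (_+ gap P) (off-bot-top P))
      where
      small = farkas Γ 2 (λ n a s l g →
          l :+ # 1 ≼ s ⇒ g ≼ a :+ s ⇒ ⊩ l :+ g :+ # 1 ≼ n) (1 ∷ 1 ∷ 1 ∷ 2 ∷ 1 ∷ 1 ∷ [])

      lt : ∀ {d} → d ≡ width P → d + gap P + + 1 ≤ n
      lt refl = small (width P) (gap P) (width< P) (proj₂ (gap-bounds P))

    -- By `complete` the first vertex of a class is joined to the last vertex of the next one, so
    -- both widths and the gap between them fit into a single edge.
    span-bound : ∀ P → width P + gap P + width (rot P) ≤ a + s
    span-bound P = subst (_≤ a + s) total
      (proj₂ (complete P (bot∈ (class-extremes P)) (top∈ (class-extremes (rot P)))))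
      where
      l = width P
      g = gap P
      l′ = width (rot P)
      small = farkas Γ 3 (λ n a s l g l′ →
          l :+ # 1 ≼ s ⇒ g ≼ a :+ s ⇒ l′ :+ # 1 ≼ s ⇒ ⊩ l :+ g :+ l′ :+ # 1 ≼ n)
          (1 ∷ 1 ∷ 1 ∷ 1 ∷ 1 ∷ 1 ∷ 1 ∷ [])

      lt : ∀ {d e} → d ≡ l + g → e ≡ l′ → d + e + + 1 ≤ n
      lt refl refl = small l g l′ (width< P) (proj₂ (gap-bounds P)) (width< (rot P))

      total : off (first P) (top (class-extremes (rot P))) ≡ l + g + l′
      total = trans (off-sum (first P) (first (rot P)) _ (lt (first-step P) (off-bot-top (rot P))))
                    (cong₂ _+_ (first-step P) (off-bot-top (rot P)))

    class-bounded : ∀ P → Bounded (Class P) (width P + + 1)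
    class-bounded P = bounded-spread (class-extremes P) (λ _ _ → off-inj)

    -- The five classes lie in arcs; going around through their left ends, the widths and the gaps
    -- between the classes add up to a multiple of n.
    module Blowup (n≉5a : n ≤ + 5 * a + + 2 * s + + 2 ⊎ + 5 * a + + 3 * s + + 1 ≤ n)
                  (2n≉5a : + 2 * n ≤ + 5 * a + + 2 * s + + 2 ⊎ + 5 * a + + 3 * s + + 1 ≤ + 2 * n)
                  (P : Pentagon) where
      P₁ = rot P
      P₂ = rot P₁
      P₃ = rot P₂
      P₄ = rot P₃

      circumference : ℤ
      circumference = width P + gap P + (width P₁ + gap P₁) + (width P₂ + gap P₂) + (width P₃ + gap P₃) + (width P₄ + gap P₄)

      around : ∃ λ w → circumference ≡ w * n
      around = - q P - q P₁ - q P₂ - q P₃ - q P₄ ,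
        go (pos (first P)) (pos (first P₁)) (pos (first P₂)) (pos (first P₃)) (pos (first P₄))
          (width P + gap P) (width P₁ + gap P₁) (width P₂ + gap P₂) (width P₃ + gap P₃) (width P₄ + gap P₄)
          (q P) (q P₁) (q P₂) (q P₃) (q P₄) (step P) (step P₁) (step P₂) (step P₃) (step P₄)
        where
        q : Pentagon → ℤ
        q R = quo (first R) (first (rot R))

        step : ∀ R → pos (first (rot R)) ≡ pos (first R) + (width R + gap R) + q R * n
        step R = trans (off-eq (first R) (first (rot R))) (cong (λ t → pos (first R) + t + q R * n) (first-step R))

        go = farkas₂ Γ 15 (λ n a s p₀ p₁ p₂ p₃ p₄ d₀ d₁ d₂ d₃ d₄ q₀ q₁ q₂ q₃ q₄ →
            p₁ ≈ p₀ :+ d₀ :+ q₀ :* n ⇒ p₂ ≈ p₁ :+ d₁ :+ q₁ :* n ⇒ p₃ ≈ p₂ :+ d₂ :+ q₂ :* n ⇒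
            p₄ ≈ p₃ :+ d₃ :+ q₃ :* n ⇒ p₀ ≈ p₄ :+ d₄ :+ q₄ :* n ⇒
            ⊩ d₀ :+ d₁ :+ d₂ :+ d₃ :+ d₄ ≈ (⊝ q₀ :- q₁ :- q₂ :- q₃ :- q₄) :* n)
            (1 ∷ 0 ∷ 1 ∷ 0 ∷ 1 ∷ 0 ∷ 1 ∷ 0 ∷ 1 ∷ 0 ∷ 1 ∷ []) (1 ∷ 1 ∷ 0 ∷ 1 ∷ 0 ∷ 1 ∷ 0 ∷ 1 ∷ 0 ∷ 1 ∷ [])

      infixl 5 _+-≤_
      _+-≤_ : ∀ {a b c d} → a ≤ b → c ≤ d → a + c ≤ b + d
      _+-≤_ = +-mono-≤

      -- Each of the five steps lies between 1 and a + s, and 5 (a + s) < 3 n because n > 2 a + 2 s.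
      one-or-two : ∀ w → circumference ≡ w * n → w ≡ + 1 ⊎ w ≡ + 2
      one-or-two w e = [ (λ w≤1 → inj₁ (≤-antisym w≤1 w>0)) , (λ w≥2 → inj₂ (≤-antisym (lower-w w w<3) w≥2)) ]′ (≤⊎≥ w (+ 1))
        where
        lo = farkas Γ 2 (λ n a s l g →
            # 0 ≼ l ⇒ a :+ # 1 ≼ g ⇒ ⊩ # 1 ≼ l :+ g) (1 ∷ 1 ∷ 1 ∷ 2 ∷ 1 ∷ [])

        hi = farkas Γ 3 (λ n a s l g l′ →
            # 0 ≼ l′ ⇒ l :+ g :+ l′ ≼ a :+ s ⇒ ⊩ l :+ g ≼ a :+ s) (1 ∷ 1 ∷ 1 ∷ [])

        lower : ∀ R → + 1 ≤ width R + gap R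
        lower R = lo (width R) (gap R) (spread≥0 (class-extremes R)) (proj₁ (gap-bounds R))

        upper : ∀ R → width R + gap R ≤ a + s
        upper R = hi (width R) (gap R) (width (rot R)) (spread≥0 (class-extremes (rot R))) (span-bound R)

        positive = farkas Γ 2 (λ n a s d w →
            # 5 ≼ d ⇒ d ≈ w :* n ⇒ ⊩ # 0 :* n :+ # 1 ≼ w :* n) (1 ∷ 1 ∷ 0 ∷ 1 ∷ [])

        small = farkas Γ 2 (λ n a s d w →
            d ≼ a :+ s :+ (a :+ s) :+ (a :+ s) :+ (a :+ s) :+ (a :+ s) ⇒ d ≈ w :* n ⇒
            ⊩ w :* n :+ # 1 ≼ # 3 :* n) (1 ∷ 0 ∷ 1 ∷ 1 ∷ 3 ∷ 1 ∷ 3 ∷ [])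

        w>0 : + 0 + + 1 ≤ w
        w>0 = *-cancel-gap (+ 0) w n (n≥1 (first P))
          (positive circumference w (lower P +-≤ lower P₁ +-≤ lower P₂ +-≤ lower P₃ +-≤ lower P₄) e)

        w<3 : w + + 1 ≤ + 3
        w<3 = *-cancel-gap w (+ 3) n (n≥1 (first P))
          (small circumference w (upper P +-≤ upper P₁ +-≤ upper P₂ +-≤ upper P₃ +-≤ upper P₄) e)

        lower-w = farkas Γ 1 (λ n a s w → w :+ # 1 ≼ # 3 ⇒ ⊩ w ≼ # 2) (1 ∷ 1 ∷ [])

      bound : + N ≤ + 2 * s + + 7
      bound = bounded-all (bounded-≤ total
        (bounded-⊎ (λ _ → id) (class-bounded P)
        (bounded-⊎ (λ _ → id) (class-bounded P₁)
        (bounded-⊎ (λ _ → id) (class-bounded P₂)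
        (bounded-⊎ (λ _ → id) (class-bounded P₃) (class-bounded P₄)))))) (cover P)
        where
        -- Gaps of at least a + 1 leave W - 5 a - 5 for the sum of the widths: at most 2 s + 2
        -- vertices.
        few = farkas Γ 11 (λ n a s W l₀ l₁ l₂ l₃ l₄ g₀ g₁ g₂ g₃ g₄ →
            W ≼ # 5 :* a :+ # 2 :* s :+ # 2 ⇒ a :+ # 1 ≼ g₀ ⇒ a :+ # 1 ≼ g₁ ⇒ a :+ # 1 ≼ g₂ ⇒
            a :+ # 1 ≼ g₃ ⇒ a :+ # 1 ≼ g₄ ⇒
            l₀ :+ g₀ :+ (l₁ :+ g₁) :+ (l₂ :+ g₂) :+ (l₃ :+ g₃) :+ (l₄ :+ g₄) ≈ W ⇒
            ⊩ l₀ :+ # 1 :+ (l₁ :+ # 1 :+ (l₂ :+ # 1 :+ (l₃ :+ # 1 :+ (l₄ :+ # 1)))) ≼ # 2 :* s :+ # 7)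
            (1 ∷ 1 ∷ 0 ∷ 1 ∷ 1 ∷ 1 ∷ 1 ∷ 1 ∷ 1 ∷ [])

        -- The five spans count each width twice and each gap once, so the widths sum to at most 5
        -- (a + s) - W: at most 2 s + 4 vertices.
        many = farkas Γ 11 (λ n a s W l₀ l₁ l₂ l₃ l₄ g₀ g₁ g₂ g₃ g₄ →
            # 5 :* a :+ # 3 :* s :+ # 1 ≼ W ⇒ l₀ :+ g₀ :+ l₁ ≼ a :+ s ⇒ l₁ :+ g₁ :+ l₂ ≼ a :+ s ⇒
            l₂ :+ g₂ :+ l₃ ≼ a :+ s ⇒ l₃ :+ g₃ :+ l₄ ≼ a :+ s ⇒ l₄ :+ g₄ :+ l₀ ≼ a :+ s ⇒
            l₀ :+ g₀ :+ (l₁ :+ g₁) :+ (l₂ :+ g₂) :+ (l₃ :+ g₃) :+ (l₄ :+ g₄) ≈ W ⇒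
            ⊩ l₀ :+ # 1 :+ (l₁ :+ # 1 :+ (l₂ :+ # 1 :+ (l₃ :+ # 1 :+ (l₄ :+ # 1)))) ≼ # 2 :* s :+ # 7)
            (1 ∷ 0 ∷ 1 ∷ 1 ∷ 1 ∷ 1 ∷ 1 ∷ 1 ∷ 1 ∷ [])

        finish : ∀ W → W ≤ + 5 * a + + 2 * s + + 2 ⊎ + 5 * a + + 3 * s + + 1 ≤ W →
          circumference ≡ W →
          width P + + 1 + (width P₁ + + 1 + (width P₂ + + 1 + (width P₃ + + 1 + (width P₄ + + 1)))) ≤ + 2 * s + + 7
        finish W (inj₁ h) = few W (width P) (width P₁) (width P₂) (width P₃) (width P₄)
          (gap P) (gap P₁) (gap P₂) (gap P₃) (gap P₄) h
          (proj₁ (gap-bounds P)) (proj₁ (gap-bounds P₁)) (proj₁ (gap-bounds P₂))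
          (proj₁ (gap-bounds P₃)) (proj₁ (gap-bounds P₄))
        finish W (inj₂ h) = many W (width P) (width P₁) (width P₂) (width P₃) (width P₄)
          (gap P) (gap P₁) (gap P₂) (gap P₃) (gap P₄) h
          (span-bound P) (span-bound P₁) (span-bound P₂) (span-bound P₃) (span-bound P₄)

        total : width P + + 1 + (width P₁ + + 1 + (width P₂ + + 1 + (width P₃ + + 1 + (width P₄ + + 1)))) ≤ + 2 * s + + 7
        total = [ (λ w≡1 → finish n n≉5a (trans e (trans (cong (_* n) w≡1) (*-identityˡ n))))
                , (λ w≡2 → finish (+ 2 * n) 2n≉5a (trans e (cong (_* n) w≡2))) ]′ (one-or-two w e)
          where
          w = proj₁ around
          e = proj₂ around

  -- No closed 5-walk: complete bipartite graphs

  module Bipartite {N : ℕ} {n : ℤ} (C : Circle N n) (a s : ℤ)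
    (s≥1 : + 1 ≤ s) (a≥2s : + 2 * s ≤ a)
    (arcs : + 2 * a + + 3 * s ≤ n ⊎ n ≡ + 2 * a + + 2 * s + + 1)
    (diam : Circulant.DiamTwo C a s)
    (no-5-cycle : ∀ {x y z u v} → Circulant.Adj C a s x y → Circulant.Adj C a s y z →
                  Circulant.Adj C a s z u → Circulant.Adj C a s u v → Circulant.Adj C a s v x → ⊥)
    (v : Fin N) where

    open Circle C
    open CircleProperties C
    open Circulant C a s

    Adj? : ∀ x y → Dec (Adj x y)
    Adj? x y = (x ⟶? y) ⊎-dec (y ⟶? x)

    Far : Fin N → Set
    Far x = ¬ Adj v x

    -- Were x and b joined only through a third vertex, this path, a path of two edges from v to x
    -- and the edge from v to b would form a closed 5-walk.
    far-adj : ∀ {x b} → Far x → Adj v b → Adj b x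
    far-adj {x} {b} x∉ b∈ with diam x b
    ... | inj₁ refl             = contradiction b∈ x∉
    ... | inj₂ (inj₁ xb)        = Adj-sym xb
    ... | inj₂ (inj₂ (z , xz , zb)) with diam v x
    ...   | inj₁ refl                  = Adj-sym b∈
    ...   | inj₂ (inj₁ vx)             = contradiction vx x∉
    ...   | inj₂ (inj₂ (y , vy , yx))  = ⊥-elim (no-5-cycle vy yx xz zb (Adj-sym b∈))

    near-or-far : ∀ x → Far x ⊎ Adj v x
    near-or-far x with Adj? v x
    ... | yes e = inj₂ e
    ... | no  p = inj₁ p

    off-injˡ : ∀ {u x y} → off x u ≡ off y u → x ≡ y
    off-injˡ {u} {x} {y} e = pos-inj (quo x u - quo y u)
      (link (pos u) (pos x) (pos y) (off x u) (off y u) (quo x u) (quo y u) n (off-eq x u) (off-eq y u) e)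
      where
      link = farkas₂ ∅ 8 (λ pu px py d e w w′ n →
          pu ≈ px :+ d :+ w :* n ⇒ pu ≈ py :+ e :+ w′ :* n ⇒ d ≈ e ⇒ ⊩ py ≈ px :+ (w :- w′) :* n)
          (1 ∷ 1 ∷ 0 ∷ 0 ∷ 1 ∷ 1 ∷ []) (1 ∷ 0 ∷ 1 ∷ 1 ∷ 0 ∷ 0 ∷ 1 ∷ [])

    isolated : (∀ x → Far x) → + N ≤ + 1
    isolated far = bounded-all {P = λ _ → ⊤}
      (bounded-interval (λ _ → + 0) (+ 0) (+≤+ z≤n) (λ _ _ → ≤-refl , ≤-refl) (λ {x} {y} _ _ _ → trans (sym (alone x)) (alone y)))
      (λ _ → tt)
      where
      alone : ∀ x → v ≡ x
      alone x with diam v x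
      ... | inj₁ e                   = e
      ... | inj₂ (inj₁ vx)           = contradiction vx (far x)
      ... | inj₂ (inj₂ (z , vz , _)) = contradiction vz (far z)

    module TwoArcs (n≥2a+3s : + 2 * a + + 3 * s ≤ n) where
      Γ : Context
      Γ = context (n ∷ a ∷ s ∷ []) (λ n a s → (# 1 ≼ s) ∷ (# 2 :* s ≼ a) ∷ (# 2 :* a :+ # 3 :* s ≼ n) ∷ [])
        λ _ → s≥1 , a≥2s , n≥2a+3s , tt


      -- A vertex x comes after both m and M or before both: m ⟶ x ⟶ M would make the chord l longer
      -- than 2 a, and M ⟶ x ⟶ m would give n < 2 a + 3 s. On either side, the offset involving the
      -- farther of m and M has only s - l possible values.
      far-bounded : ∀ m M → off m M + + 1 ≤ s → (∀ {x} → Far x → Adj m x × Adj M x) →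
                    Bounded Far ((s - off m M) + (s - off m M))
      far-bounded m M l<s adj = bounded-⊎ split
          (bounded-interval (off m) (a + + 1 + l) (nonneg l l<s) (λ x p → after x p) (λ _ _ → off-inj))
          (bounded-interval (λ x → off x M) (a + + 1 + l) (nonneg l l<s) (λ x p → before x p) (λ _ _ → off-injˡ))
        where
        l = off m M

        After Before : Fin N → Set
        After x = m ⟶ x × M ⟶ x
        Before x = x ⟶ m × x ⟶ M

        nonneg = farkas Γ 1 (λ n a s l → l :+ # 1 ≼ s ⇒ ⊩ # 0 ≼ s :- l) (1 ∷ 1 ∷ [])

        small = farkas Γ 2 (λ n a s l d →
            l :+ # 1 ≼ s ⇒ d ≼ a :+ s ⇒ ⊩ l :+ d :+ # 1 ≼ n) (1 ∷ 1 ∷ 1 ∷ 3 ∷ 1 ∷ 1 ∷ [])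

        small′ = farkas Γ 2 (λ n a s l d →
            l :+ # 1 ≼ s ⇒ d ≼ a :+ s ⇒ ⊩ d :+ l :+ # 1 ≼ n) (1 ∷ 1 ∷ 1 ∷ 3 ∷ 1 ∷ 1 ∷ [])

        lo = farkas Γ 3 (λ n a s l d e →
            a :+ # 1 ≼ d ⇒ e ≈ l :+ d ⇒ ⊩ a :+ # 1 :+ l ≼ e) (1 ∷ 0 ∷ 1 ∷ 1 ∷ [])

        lo′ = farkas Γ 3 (λ n a s l d e →
            a :+ # 1 ≼ d ⇒ e ≈ d :+ l ⇒ ⊩ a :+ # 1 :+ l ≼ e) (1 ∷ 0 ∷ 1 ∷ 1 ∷ [])

        hi = farkas Γ 2 (λ n a s l e →
            e ≼ a :+ s ⇒ ⊩ e :+ # 1 ≼ a :+ # 1 :+ l :+ (s :- l)) (1 ∷ 1 ∷ [])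

        after : ∀ x → After x → a + + 1 + l ≤ off m x × off m x + + 1 ≤ a + + 1 + l + (s - l)
        after x (mx , Mx) =
          lo l (off M x) (off m x) (proj₁ Mx) (off-sum m M x (small l (off M x) l<s (proj₂ Mx))) ,
          hi l (off m x) (proj₂ mx)

        before : ∀ x → Before x → a + + 1 + l ≤ off x M × off x M + + 1 ≤ a + + 1 + l + (s - l)
        before x (xm , xM) =
          lo′ l (off x m) (off x M) (proj₁ xm) (off-sum x m M (small′ l (off x m) l<s (proj₂ xm))) ,
          hi l (off x M) (proj₂ xM)

        two = farkas Γ 2 (λ n a s d e →
            d ≼ a :+ s ⇒ e ≼ a :+ s ⇒ ⊩ d :+ e :+ # 1 ≼ n) (1 ∷ 1 ∷ 1 ∷ 1 ∷ 0 ∷ 1 ∷ [])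

        long = farkas Γ 3 (λ n a s l d e →
            l :+ # 1 ≼ s ⇒ a :+ # 1 ≼ d ⇒ a :+ # 1 ≼ e ⇒ l ≈ d :+ e ⇒ ⊩⊥)
            (0 ∷ 1 ∷ 1 ∷ 1 ∷ 1 ∷ 3 ∷ 2 ∷ [])

        back₀ = farkas Γ 4 (λ n a s l l′ d e →
            # 0 ≼ l ⇒ a :+ # 1 ≼ d ⇒ a :+ # 1 ≼ e ⇒ l′ ≈ d :+ e ⇒ l :+ l′ ≈ # 0 ⇒ ⊩⊥)
            (1 ∷ 0 ∷ 0 ∷ 1 ∷ 1 ∷ 1 ∷ 1 ∷ 4 ∷ 2 ∷ [])

        back₁ = farkas Γ 4 (λ n a s l l′ d e →
            l :+ # 1 ≼ s ⇒ d ≼ a :+ s ⇒ e ≼ a :+ s ⇒ l′ ≈ d :+ e ⇒ l :+ l′ ≈ # 0 :+ n ⇒ ⊩⊥)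
            (0 ∷ 1 ∷ 1 ∷ 0 ∷ 1 ∷ 1 ∷ 1 ∷ 0 ∷ 0 ∷ 1 ∷ [])

        split : ∀ x → Far x → After x ⊎ Before x
        split x p with adj p
        ... | inj₁ mx , inj₁ Mx = inj₁ (mx , Mx)
        ... | inj₂ xm , inj₂ xM = inj₂ (xm , xM)
        ... | inj₁ mx , inj₂ xM = ⊥-elim (long l (off m x) (off x M) l<s (proj₁ mx) (proj₁ xM)
          (off-sum m x M (two (off m x) (off x M) (proj₂ mx) (proj₂ xM))))
        ... | inj₂ xm , inj₁ Mx with off-add m M m
        ...   | inj₁ e = ⊥-elim (back₀ l (off M m) (off M x) (off x m) (off≥0 m M) (proj₁ Mx) (proj₁ xm)
          (off-sum M x m (two (off M x) (off x m) (proj₂ Mx) (proj₂ xm))) (trans e (off-refl m)))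
        ...   | inj₂ e = ⊥-elim (back₁ l (off M m) (off M x) (off x m) l<s (proj₂ Mx) (proj₂ xm)
          (off-sum M x m (two (off M x) (off x m) (proj₂ Mx) (proj₂ xm))) (trans e (cong (_+ n) (off-refl m))))

      chord : ∀ {P} (E : Extremes P (off v)) → off (bot E) (top E) ≡ spread E
      chord E = off-diff v (bot E) (top E) (bot≤ E (top∈ E))

      far-spread : ∀ {P} (E : Extremes P (off v)) → (∀ {x} → P x → Adj v x) → spread E + + 1 ≤ s →
                   Bounded Far ((s - spread E) + (s - spread E))
      far-spread E adj lt = subst (λ l → Bounded Far ((s - l) + (s - l))) (chord E)
        (far-bounded (bot E) (top E) (subst (λ l → l + + 1 ≤ s) (sym (chord E)) lt)
          (λ p → far-adj p (adj (bot∈ E)) , far-adj p (adj (top∈ E))))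

      out-spread : (E : Extremes (v ⟶_) (off v)) → spread E + + 1 ≤ s
      out-spread E = go (off v (bot E)) (off v (top E)) (proj₁ (bot∈ E)) (proj₂ (top∈ E))
        where
        go = farkas Γ 2 (λ n a s d e →
            a :+ # 1 ≼ d ⇒ e ≼ a :+ s ⇒ ⊩ e :- d :+ # 1 ≼ s) (1 ∷ 1 ∷ 1 ∷ [])

      in-off : ∀ {x} → x ⟶ v → off v x + off x v ≡ n
      in-off {x} e = off-flip λ v≡x → loop (off x v) (proj₁ e) (trans (cong (off x) v≡x) (off-refl x))
        where
        loop = farkas Γ 1 (λ n a s d → a :+ # 1 ≼ d ⇒ d ≈ # 0 ⇒ ⊩⊥) (1 ∷ 0 ∷ 1 ∷ 2 ∷ 1 ∷ [])

      in-spread : (E : Extremes (_⟶ v) (off v)) → spread E + + 1 ≤ s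
      in-spread E = go (off v (bot E)) (off v (top E)) (off (bot E) v) (off (top E) v)
        (in-off (bot∈ E)) (in-off (top∈ E)) (proj₂ (bot∈ E)) (proj₁ (top∈ E))
        where
        go = farkas Γ 4 (λ n a s d e d′ e′ →
            d :+ d′ ≈ n ⇒ e :+ e′ ≈ n ⇒ d′ ≼ a :+ s ⇒ a :+ # 1 ≼ e′ ⇒ ⊩ e :- d :+ # 1 ≼ s)
            (1 ∷ 1 ∷ 1 ∷ 1 ∷ 0 ∷ 0 ∷ 1 ∷ [])

      count : ∀ {L L₁ L₂} → Bounded Far L → Bounded (v ⟶_) L₁ → Bounded (_⟶ v) L₂ → + N ≤ L + (L₁ + L₂)
      count A B₁ B₂ = bounded-all {P = λ _ → ⊤}
        (bounded-⊎ (λ x _ → near-or-far x) A (bounded-⊎ (λ _ → id) B₁ B₂)) (λ _ → tt)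

      few = farkas Γ 0 (λ n a s → ⊩ # 1 ≼ # 2 :* s :+ # 7) (1 ∷ 2 ∷ [])

      out-only = farkas Γ 1 (λ n a s l →
          # 0 ≼ l ⇒ ⊩ s :- l :+ (s :- l) :+ (l :+ # 1 :+ # 0) ≼ # 2 :* s :+ # 7) (1 ∷ 1 ∷ [])

      in-only = farkas Γ 1 (λ n a s l →
          # 0 ≼ l ⇒ ⊩ s :- l :+ (s :- l) :+ (# 0 :+ (l :+ # 1)) ≼ # 2 :* s :+ # 7) (1 ∷ 1 ∷ [])

      in-wider = farkas Γ 2 (λ n a s l m →
          l ≼ m ⇒ ⊩ s :- m :+ (s :- m) :+ (l :+ # 1 :+ (m :+ # 1)) ≼ # 2 :* s :+ # 7) (1 ∷ 1 ∷ [])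

      out-wider = farkas Γ 2 (λ n a s l m →
          m ≼ l ⇒ ⊩ s :- l :+ (s :- l) :+ (l :+ # 1 :+ (m :+ # 1)) ≼ # 2 :* s :+ # 7) (1 ∷ 1 ∷ [])

      -- The wider of the two neighbour arcs controls `Far`: with spreads l ≤ m the total is 2 (s -
      -- m) + (l + 1) + (m + 1) ≤ 2 s + 2.
      both : Extremes (v ⟶_) (off v) → Extremes (_⟶ v) (off v) → + N ≤ + 2 * s + + 7
      both E F = [ (λ E≤F → ≤-trans (count (far-spread F inj₂ (in-spread F)) E-bounded F-bounded)
                                     (in-wider (spread E) (spread F) E≤F))
                 , (λ F≤E → ≤-trans (count (far-spread E inj₁ (out-spread E)) E-bounded F-bounded)
                                     (out-wider (spread E) (spread F) F≤E)) ]′ (≤-total (spread E) (spread F))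
        where
        E-bounded = bounded-spread E (λ _ _ → off-inj)
        F-bounded = bounded-spread F (λ _ _ → off-inj)

      conclude : (∀ x → ¬ v ⟶ x) ⊎ Extremes (v ⟶_) (off v) → (∀ x → ¬ x ⟶ v) ⊎ Extremes (_⟶ v) (off v) →
                 + N ≤ + 2 * s + + 7
      conclude (inj₁ no-out) (inj₁ no-in) = ≤-trans (isolated λ x → [ no-out x , no-in x ]′) few
      conclude (inj₂ E) (inj₁ no-in) = ≤-trans
        (count (far-spread E inj₁ (out-spread E)) (bounded-spread E (λ _ _ → off-inj)) (bounded-∅ ≤-refl no-in))
        (out-only (spread E) (spread≥0 E))
      conclude (inj₁ no-out) (inj₂ E) = ≤-trans
        (count (far-spread E inj₂ (in-spread E)) (bounded-∅ ≤-refl no-out) (bounded-spread E (λ _ _ → off-inj)))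
        (in-only (spread E) (spread≥0 E))
      conclude (inj₂ E) (inj₂ F) = both E F

      bound : + N ≤ + 2 * s + + 7
      bound = conclude (extremes (v ⟶?_) (off v)) (extremes (_⟶? v) (off v))

    module OneArc (n≡ : n ≡ + 2 * a + + 2 * s + + 1) where
      Γ′ : Context
      Γ′ = context (n ∷ a ∷ s ∷ []) (λ n a s → (# 1 ≼ s) ∷ (# 2 :* s ≼ a) ∷ (n ≈ # 2 :* a :+ # 2 :* s :+ # 1) ∷ [])
        λ _ → s≥1 , a≥2s , n≡ , tt


      -- For n = 2 a + 2 s + 1 a backward edge has an offset between a + s + 1 and a + 2 s, so the
      -- two arcs of possible neighbours merge into one interval.
      adj-off : ∀ {x y} → Adj x y → a + + 1 ≤ off x y × off x y ≤ a + + 2 * s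
      adj-off {x} {y} (inj₁ e) = proj₁ e , grow (off x y) (proj₂ e)
        where
        grow = farkas Γ′ 1 (λ n a s d → d ≼ a :+ s ⇒ ⊩ d ≼ a :+ # 2 :* s) (1 ∷ 1 ∷ 1 ∷ [])

      adj-off {x} {y} (inj₂ e) = lo (off x y) (off y x) flip (proj₂ e) , hi (off x y) (off y x) flip (proj₁ e)
        where
        loop = farkas Γ′ 1 (λ n a s d → a :+ # 1 ≼ d ⇒ d ≈ # 0 ⇒ ⊩⊥) (1 ∷ 0 ∷ 1 ∷ 2 ∷ 1 ∷ [])

        flip : off x y + off y x ≡ n
        flip = off-flip λ x≡y → loop (off y x) (proj₁ e) (trans (cong (off y) x≡y) (off-refl y))

        lo = farkas Γ′ 2 (λ n a s d e →
            d :+ e ≈ n ⇒ e ≼ a :+ s ⇒ ⊩ a :+ # 1 ≼ d) (1 ∷ 1 ∷ 0 ∷ 1 ∷ 1 ∷ 0 ∷ 0 ∷ 1 ∷ [])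

        hi = farkas Γ′ 2 (λ n a s d e →
            d :+ e ≈ n ⇒ a :+ # 1 ≼ e ⇒ ⊩ d ≼ a :+ # 2 :* s) (1 ∷ 1 ∷ 1 ∷ 0 ∷ 0 ∷ 0 ∷ 1 ∷ [])

      far-bounded : (E : Extremes (Adj v) (off v)) → Bounded Far (+ 2 * s - spread E)
      far-bounded E = bounded-interval (off m) (a + + 1 + l)
          (nonneg (off v m) (off v M) (proj₁ (adj-off (bot∈ E))) (proj₂ (adj-off (top∈ E))))
          (λ x p → lo l (off M x) (off m x) (proj₁ (adj-off (far-adj p (top∈ E)))) (via-M p) ,
                   hi l (off m x) (proj₂ (adj-off (far-adj p (bot∈ E)))))
          (λ _ _ → off-inj)
        where
        m = bot E
        M = top E
        l = spread E

        chord : off m M ≡ l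
        chord = off-diff v m M (bot≤ E (top∈ E))

        nonneg = farkas Γ′ 2 (λ n a s d e →
            a :+ # 1 ≼ d ⇒ e ≼ a :+ # 2 :* s ⇒ ⊩ # 0 ≼ # 2 :* s :- (e :- d)) (1 ∷ 1 ∷ 1 ∷ [])

        small = farkas Γ′ 4 (λ n a s d e c f →
            a :+ # 1 ≼ d ⇒ e ≼ a :+ # 2 :* s ⇒ c ≈ e :- d ⇒ f ≼ a :+ # 2 :* s ⇒ ⊩ c :+ f :+ # 1 ≼ n)
            (1 ∷ 1 ∷ 1 ∷ 0 ∷ 1 ∷ 1 ∷ 0 ∷ 1 ∷ 0 ∷ 1 ∷ [])

        lo = farkas Γ′ 3 (λ n a s l f g →
            a :+ # 1 ≼ f ⇒ g ≈ l :+ f ⇒ ⊩ a :+ # 1 :+ l ≼ g) (1 ∷ 0 ∷ 1 ∷ 1 ∷ [])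

        hi = farkas Γ′ 2 (λ n a s l g →
            g ≼ a :+ # 2 :* s ⇒ ⊩ g :+ # 1 ≼ a :+ # 1 :+ l :+ (# 2 :* s :- l)) (1 ∷ 1 ∷ [])

        via-M : ∀ {x} → Far x → off m x ≡ l + off M x
        via-M {x} p = trans
          (off-sum m M x (small (off v m) (off v M) (off m M) (off M x)
            (proj₁ (adj-off (bot∈ E))) (proj₂ (adj-off (top∈ E))) chord (proj₂ (adj-off (far-adj p (top∈ E))))))
          (cong (_+ off M x) chord)

      few = farkas Γ′ 0 (λ n a s → ⊩ # 1 ≼ # 2 :* s :+ # 7) (1 ∷ 2 ∷ [])

      total = farkas Γ′ 1 (λ n a s l → ⊩ # 2 :* s :- l :+ (l :+ # 1) ≼ # 2 :* s :+ # 7) (1 ∷ [])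

      conclude : (∀ x → Far x) ⊎ Extremes (Adj v) (off v) → + N ≤ + 2 * s + + 7
      conclude (inj₁ none) = ≤-trans (isolated none) few
      conclude (inj₂ E)    = ≤-trans
        (bounded-all {P = λ _ → ⊤} (bounded-⊎ (λ x _ → near-or-far x) (far-bounded E) (bounded-spread E (λ _ _ → off-inj))) (λ _ → tt))
        (total (spread E))

      bound : + N ≤ + 2 * s + + 7
      bound = conclude (extremes (Adj? v) (off v))

    bound : + N ≤ + 2 * s + + 7
    bound = [ TwoArcs.bound , OneArc.bound ]′ arcs

  -- Three classes on the threefold cover of the circle

  module ThreeTypes {N : ℕ} {n : ℤ} (C : Circle N n) (a s : ℤ) (s≥1 : + 1 ≤ s)
    (diam : Circulant.DiamTwo C a s)
    -- The pair (σ, τ) is a point of the cover, on which (n, 3) counts as zero: an edge adds its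
    -- length to σ and 1 to τ, up to a multiple t of (n, 3).
    (τ σ : Fin N → ℤ) (τ≥0 : ∀ x → + 0 ≤ τ x) (τ≤2 : ∀ x → τ x ≤ + 2)
    (σ-inj : ∀ {x y} → σ x ≡ σ y → x ≡ y)
    (edge : ∀ {x y} → Circulant._⟶_ C a s x y →
            ∃ λ t → τ x + + 1 - τ y ≡ + 3 * t × σ x + Circle.off C x y - σ y ≡ t * n) where

    open Circle C
    open Circulant C a s

    Γ : Context
    Γ = context (n ∷ a ∷ s ∷ []) (λ n a s → (# 1 ≼ s) ∷ [])
      λ _ → s≥1 , tt

    below-one = farkas Γ 1 (λ n a s k → # 3 :* k ≈ # 1 ⇒ k ≼ # 0 ⇒ ⊩⊥) (3 ∷ 0 ∷ 1 ∷ [])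

    above-zero = farkas Γ 1 (λ n a s k → # 3 :* k ≈ # 1 ⇒ # 0 :+ # 1 ≼ k ⇒ ⊩⊥) (3 ∷ 1 ∷ [])

    3k≢1 : ∀ k → + 3 * k ≡ + 1 → ⊥
    3k≢1 k e = [ below-one k e , above-zero k e ]′ (≤⊎≥ k (+ 0))

    same-type-edge = farkas₂ Γ 3 (λ n a s τ τ′ t →
        τ :+ # 1 :- τ′ ≈ # 3 :* t ⇒ τ ≈ τ′ ⇒ ⊩ # 3 :* t ≈ # 1)
        (1 ∷ 1 ∷ 0 ∷ 0 ∷ 1 ∷ []) (1 ∷ 0 ∷ 1 ∷ 1 ∷ [])

    same-type-path = farkas₂ Γ 5 (λ n a s τ τ′ τ″ t t′ →
        τ :+ # 1 :- τ′ ≈ # 3 :* t ⇒ τ′ :+ # 1 :- τ″ ≈ # 3 :* t′ ⇒ τ ≈ τ″ ⇒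
        ⊩ # 3 :* (# 1 :- t :- t′) ≈ # 1) (1 ∷ 0 ∷ 1 ∷ 1 ∷ 0 ∷ 1 ∷ []) (1 ∷ 1 ∷ 0 ∷ 0 ∷ 1 ∷ 0 ∷ 1 ∷ [])

    same-type-fork = farkas₂ Γ 5 (λ n a s τ τ′ τ″ t t′ →
        τ :+ # 1 :- τ″ ≈ # 3 :* t ⇒ τ′ :+ # 1 :- τ″ ≈ # 3 :* t′ ⇒ τ ≈ τ′ ⇒ ⊩ t ≈ t′)
        (3 ∷ 1 ∷ 0 ∷ 1 ∷ 0 ∷ 0 ∷ 1 ∷ []) (3 ∷ 0 ∷ 1 ∷ 0 ∷ 1 ∷ 1 ∷ [])

    same-type-fork′ = farkas₂ Γ 5 (λ n a s τ τ′ τ″ t t′ →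
        τ″ :+ # 1 :- τ ≈ # 3 :* t ⇒ τ″ :+ # 1 :- τ′ ≈ # 3 :* t′ ⇒ τ ≈ τ′ ⇒ ⊩ t ≈ t′)
        (3 ∷ 0 ∷ 1 ∷ 1 ∷ 0 ∷ 0 ∷ 1 ∷ []) (3 ∷ 1 ∷ 0 ∷ 0 ∷ 1 ∷ 1 ∷ [])

    fork-short = farkas Γ 7 (λ n a s c c′ c″ d d′ w w′ →
        c :+ d :- c″ ≈ w ⇒ c′ :+ d′ :- c″ ≈ w′ ⇒ w ≈ w′ ⇒ d ≼ a :+ s ⇒ a :+ # 1 ≼ d′ ⇒
        ⊩ c′ :- c :+ # 1 ≼ s) (1 ∷ 1 ∷ 1 ∷ 0 ∷ 1 ∷ 1 ∷ 0 ∷ 0 ∷ 1 ∷ [])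

    fork-short′ = farkas Γ 7 (λ n a s c c′ c″ d d′ w w′ →
        c″ :+ d :- c ≈ w ⇒ c″ :+ d′ :- c′ ≈ w′ ⇒ w ≈ w′ ⇒ a :+ # 1 ≼ d ⇒ d′ ≼ a :+ s ⇒
        ⊩ c′ :- c :+ # 1 ≼ s) (1 ∷ 1 ∷ 1 ∷ 1 ∷ 0 ∷ 0 ∷ 1 ∷ 1 ∷ [])

    same-place = farkas Γ 2 (λ n a s c c′ → c ≈ c′ ⇒ ⊩ c′ :- c :+ # 1 ≼ s) (1 ∷ 0 ∷ 1 ∷ 1 ∷ [])

    -- An edge changes the type by one and a directed path of two edges by two modulo 3. What
    -- remains is a common out-neighbour or in-neighbour, and two edge lengths differ by less than
    -- s.
    same-type : ∀ x y → τ x ≡ τ y → σ y - σ x + + 1 ≤ s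
    same-type x y τ≡ = by-distance (diam x y)
      where
      by-distance : x ≡ y ⊎ Adj x y ⊎ (∃ λ z → Adj x z × Adj z y) → σ y - σ x + + 1 ≤ s
      by-distance (inj₁ x≡y) = same-place (σ x) (σ y) (cong σ x≡y)
      by-distance (inj₂ (inj₁ (inj₁ e))) with edge e
      ... | t , types , _ = ⊥-elim (3k≢1 t (same-type-edge (τ x) (τ y) t types τ≡))
      by-distance (inj₂ (inj₁ (inj₂ e))) with edge e
      ... | t , types , _ = ⊥-elim (3k≢1 t (same-type-edge (τ y) (τ x) t types (sym τ≡)))
      by-distance (inj₂ (inj₂ (z , inj₁ e , inj₁ f))) with edge e | edge f
      ... | t , types , _ | t′ , types′ , _ =
        ⊥-elim (3k≢1 _ (same-type-path (τ x) (τ z) (τ y) t t′ types types′ τ≡))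
      by-distance (inj₂ (inj₂ (z , inj₂ e , inj₂ f))) with edge f | edge e
      ... | t , types , _ | t′ , types′ , _ =
        ⊥-elim (3k≢1 _ (same-type-path (τ y) (τ z) (τ x) t t′ types types′ (sym τ≡)))
      by-distance (inj₂ (inj₂ (z , inj₁ e , inj₂ f))) with edge e | edge f
      ... | t , types , lift | t′ , types′ , lift′ =
        fork-short (σ x) (σ y) (σ z) (off x z) (off y z) (t * n) (t′ * n) lift lift′
          (cong (_* n) (same-type-fork (τ x) (τ y) (τ z) t t′ types types′ τ≡)) (proj₂ e) (proj₁ f)
      by-distance (inj₂ (inj₂ (z , inj₂ e , inj₁ f))) with edge e | edge f
      ... | t , types , lift | t′ , types′ , lift′ =
        fork-short′ (σ x) (σ y) (σ z) (off z x) (off z y) (t * n) (t′ * n) lift lift′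
          (cong (_* n) (same-type-fork′ (τ x) (τ y) (τ z) t t′ types types′ τ≡)) (proj₁ e) (proj₂ f)

    -- The possible advances from a class to the next: one forward edge, or two backward edges, as -
    -- 2 and 1 agree modulo 3 at the price of one turn n.
    Gap : ℤ → Set
    Gap g = (a + + 1 ≤ g × g ≤ a + s) ⊎ (n - + 2 * a - + 2 * s ≤ g × g ≤ n - + 2 * a - + 2)

    next-self = farkas₂ Γ 3 (λ n a s τ τ′ u →
        τ :+ # 1 :- τ′ ≈ # 3 :* u ⇒ τ ≈ τ′ ⇒ ⊩ # 3 :* u ≈ # 1)
        (1 ∷ 1 ∷ 0 ∷ 0 ∷ 1 ∷ []) (1 ∷ 0 ∷ 1 ∷ 1 ∷ [])

    next-edge = farkas₂ Γ 4 (λ n a s τ τ′ u t →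
        τ :+ # 1 :- τ′ ≈ # 3 :* u ⇒ τ :+ # 1 :- τ′ ≈ # 3 :* t ⇒ ⊩ t ≈ u)
        (3 ∷ 0 ∷ 1 ∷ 1 ∷ []) (3 ∷ 1 ∷ 0 ∷ 0 ∷ 1 ∷ [])

    next-back = farkas₂ Γ 4 (λ n a s τ τ′ u t →
        τ :+ # 1 :- τ′ ≈ # 3 :* u ⇒ τ′ :+ # 1 :- τ ≈ # 3 :* t ⇒ ⊩ # 3 :* (# 1 :- u :- t) ≈ # 1)
        (1 ∷ 1 ∷ 0 ∷ 1 ∷ []) (1 ∷ 0 ∷ 1 ∷ 0 ∷ 1 ∷ [])

    next-path = farkas₂ Γ 6 (λ n a s τ τ′ τ″ u t t′ →
        τ :+ # 1 :- τ′ ≈ # 3 :* u ⇒ τ :+ # 1 :- τ″ ≈ # 3 :* t ⇒ τ″ :+ # 1 :- τ′ ≈ # 3 :* t′ ⇒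
        ⊩ # 3 :* (t :+ t′ :- u) ≈ # 1) (1 ∷ 0 ∷ 1 ∷ 0 ∷ 1 ∷ 1 ∷ []) (1 ∷ 1 ∷ 0 ∷ 1 ∷ 0 ∷ 0 ∷ 1 ∷ [])

    next-fork = farkas₂ Γ 6 (λ n a s τ τ′ τ″ u t t′ →
        τ :+ # 1 :- τ′ ≈ # 3 :* u ⇒ τ :+ # 1 :- τ″ ≈ # 3 :* t ⇒ τ′ :+ # 1 :- τ″ ≈ # 3 :* t′ ⇒
        ⊩ # 3 :* (u :- t :+ t′) ≈ # 1) (1 ∷ 0 ∷ 1 ∷ 1 ∷ 0 ∷ 0 ∷ 1 ∷ []) (1 ∷ 1 ∷ 0 ∷ 0 ∷ 1 ∷ 1 ∷ [])

    next-fork′ = farkas₂ Γ 6 (λ n a s τ τ′ τ″ u t t′ →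
        τ :+ # 1 :- τ′ ≈ # 3 :* u ⇒ τ″ :+ # 1 :- τ ≈ # 3 :* t ⇒ τ″ :+ # 1 :- τ′ ≈ # 3 :* t′ ⇒
        ⊩ # 3 :* (u :- t′ :+ t) ≈ # 1) (1 ∷ 1 ∷ 0 ∷ 0 ∷ 1 ∷ 0 ∷ 1 ∷ []) (1 ∷ 0 ∷ 1 ∷ 1 ∷ 0 ∷ 1 ∷ [])

    next-two = farkas₂ Γ 6 (λ n a s τ τ′ τ″ u t t′ →
        τ :+ # 1 :- τ′ ≈ # 3 :* u ⇒ τ″ :+ # 1 :- τ ≈ # 3 :* t ⇒ τ′ :+ # 1 :- τ″ ≈ # 3 :* t′ ⇒
        ⊩ t :+ t′ ≈ # 1 :- u) (3 ∷ 0 ∷ 1 ∷ 0 ∷ 1 ∷ 0 ∷ 1 ∷ []) (3 ∷ 1 ∷ 0 ∷ 1 ∷ 0 ∷ 1 ∷ [])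

    direct = farkas₂ Γ 5 (λ n a s c c′ d w w′ →
        c :+ d :- c′ ≈ w ⇒ w ≈ w′ ⇒ ⊩ d ≈ c′ :- c :+ w′) (1 ∷ 1 ∷ 0 ∷ 1 ∷ []) (1 ∷ 0 ∷ 1 ∷ 0 ∷ 1 ∷ [])

    around-lo = farkas Γ 8 (λ n a s c c′ c″ d d′ t t′ u →
        c″ :+ d :- c ≈ t :* n ⇒ c′ :+ d′ :- c″ ≈ t′ :* n ⇒ (t :+ t′) :* n ≈ (# 1 :- u) :* n ⇒
        d ≼ a :+ s ⇒ d′ ≼ a :+ s ⇒ ⊩ n :- # 2 :* a :- # 2 :* s ≼ c′ :- c :+ u :* n)
        (1 ∷ 1 ∷ 1 ∷ 0 ∷ 1 ∷ 0 ∷ 1 ∷ 0 ∷ 1 ∷ [])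

    around-hi = farkas Γ 8 (λ n a s c c′ c″ d d′ t t′ u →
        c″ :+ d :- c ≈ t :* n ⇒ c′ :+ d′ :- c″ ≈ t′ :* n ⇒ (t :+ t′) :* n ≈ (# 1 :- u) :* n ⇒
        a :+ # 1 ≼ d ⇒ a :+ # 1 ≼ d′ ⇒ ⊩ c′ :- c :+ u :* n ≼ n :- # 2 :* a :- # 2)
        (1 ∷ 1 ∷ 1 ∷ 1 ∷ 0 ∷ 1 ∷ 0 ∷ 1 ∷ [])

    next-type : ∀ x y u → τ x + + 1 - τ y ≡ + 3 * u → Gap (σ y - σ x + u * n)
    next-type x y u τ≡ = by-distance (diam x y)
      where
      by-distance : x ≡ y ⊎ Adj x y ⊎ (∃ λ z → Adj x z × Adj z y) → Gap (σ y - σ x + u * n)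
      by-distance (inj₁ x≡y) = ⊥-elim (3k≢1 u (next-self (τ x) (τ y) u τ≡ (cong τ x≡y)))
      by-distance (inj₂ (inj₁ (inj₁ e))) with edge e
      ... | t , types , lift = inj₁ (subst (λ g → a + + 1 ≤ g × g ≤ a + s)
        (direct (σ x) (σ y) (off x y) (t * n) (u * n) lift (cong (_* n) (next-edge (τ x) (τ y) u t τ≡ types))) e)
      by-distance (inj₂ (inj₁ (inj₂ e))) with edge e
      ... | t , types , _ = ⊥-elim (3k≢1 _ (next-back (τ x) (τ y) u t τ≡ types))
      by-distance (inj₂ (inj₂ (z , inj₁ e , inj₁ f))) with edge e | edge f
      ... | t , types , _ | t′ , types′ , _ =
        ⊥-elim (3k≢1 _ (next-path (τ x) (τ y) (τ z) u t t′ τ≡ types types′))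
      by-distance (inj₂ (inj₂ (z , inj₁ e , inj₂ f))) with edge e | edge f
      ... | t , types , _ | t′ , types′ , _ =
        ⊥-elim (3k≢1 _ (next-fork (τ x) (τ y) (τ z) u t t′ τ≡ types types′))
      by-distance (inj₂ (inj₂ (z , inj₂ e , inj₁ f))) with edge e | edge f
      ... | t , types , _ | t′ , types′ , _ =
        ⊥-elim (3k≢1 _ (next-fork′ (τ x) (τ y) (τ z) u t t′ τ≡ types types′))
      by-distance (inj₂ (inj₂ (z , inj₂ e , inj₂ f))) with edge e | edge f
      ... | t , types , lift | t′ , types′ , lift′ = inj₂
        ( around-lo (σ x) (σ y) (σ z) (off z x) (off y z) t t′ u lift lift′ turns≡ (proj₂ e) (proj₂ f)
        , around-hi (σ x) (σ y) (σ z) (off z x) (off y z) t t′ u lift lift′ turns≡ (proj₁ e) (proj₁ f) )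
        where
        turns≡ = cong (_* n) (next-two (τ x) (τ y) (τ z) u t t′ τ≡ types types′)

    Class : ℤ → Fin N → Set
    Class j x = τ x ≡ j

    class-cover : ∀ x → Class (+ 0) x ⊎ Class (+ 1) x ⊎ Class (+ 2) x
    class-cover x = go (τ x) (τ≥0 x) (τ≤2 x)
      where
      go : ∀ t → + 0 ≤ t → t ≤ + 2 → t ≡ + 0 ⊎ t ≡ + 1 ⊎ t ≡ + 2
      go (+ 0) _ _ = inj₁ refl
      go (+ 1) _ _ = inj₂ (inj₁ refl)
      go (+ 2) _ _ = inj₂ (inj₂ refl)
      go (+ suc (suc (suc _))) _ (+≤+ (s≤s (s≤s ())))

    class-spread : ∀ {j} (E : Extremes (Class j) σ) → spread E + + 1 ≤ s
    class-spread E = same-type (bot E) (top E) (trans (bot∈ E) (sym (top∈ E)))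

    spread-bounded : ∀ {j} (E : Extremes (Class j) σ) → Bounded (Class j) (spread E + + 1)
    spread-bounded E = bounded-spread E (λ _ _ → σ-inj)

    class-bounded : ∀ {j} (E : Extremes (Class j) σ) → Bounded (Class j) s
    class-bounded E = bounded-≤ (class-spread E) (spread-bounded E)

    count : ∀ {L₀ L₁ L₂} → Bounded (Class (+ 0)) L₀ → Bounded (Class (+ 1)) L₁ → Bounded (Class (+ 2)) L₂ →
            + N ≤ L₀ + (L₁ + L₂)
    count B₀ B₁ B₂ = bounded-all (bounded-⊎ (λ _ → id) B₀ (bounded-⊎ (λ _ → id) B₁ B₂)) class-cover

    class-gap : ∀ {i j} u → i + + 1 - j ≡ + 3 * u → ∀ {x y} → Class i x → Class j y → Gap (σ y - σ x + u * n)
    class-gap u e {x} {y} refl refl = next-type x y u e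

    module _ (E₀ : Extremes (Class (+ 0)) σ) (E₁ : Extremes (Class (+ 1)) σ) (E₂ : Extremes (Class (+ 2)) σ) where

      gap₀ : ∀ {x y} → Class (+ 0) x → Class (+ 1) y → Gap (σ y - σ x + + 0 * n)
      gap₀ = class-gap (+ 0) refl

      gap₁ : ∀ {x y} → Class (+ 1) x → Class (+ 2) y → Gap (σ y - σ x + + 0 * n)
      gap₁ = class-gap (+ 0) refl

      gap₂ : ∀ {x y} → Class (+ 2) x → Class (+ 0) y → Gap (σ y - σ x + + 1 * n)
      gap₂ = class-gap (+ 1) refl

      -- Three intervals, each reaching at most a + s beyond the beginning of the previous one.
      bound-hi : n ≡ + 3 * a + s + + 1 → + N ≤ + 2 * s + + 7
      bound-hi n≡ = ≤-trans (count (spread-bounded E₀) (spread-bounded E₁) (spread-bounded E₂))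
        (total (σ (bot E₀)) (σ (top E₀)) (σ (bot E₁)) (σ (top E₁)) (σ (bot E₂)) (σ (top E₂)) n≡
          (upper n≡ (gap₀ (bot∈ E₀) (top∈ E₁))) (upper n≡ (gap₁ (bot∈ E₁) (top∈ E₂)))
          (upper n≡ (gap₂ (bot∈ E₂) (top∈ E₀))))
        where
        less = farkas Γ 1 (λ n a s g →
            n ≈ # 3 :* a :+ s :+ # 1 ⇒ g ≼ n :- # 2 :* a :- # 2 ⇒ ⊩ g ≼ a :+ s) (1 ∷ 1 ∷ 1 ∷ [])

        upper : n ≡ + 3 * a + s + + 1 → ∀ {g} → Gap g → g ≤ a + s
        upper n≡ (inj₁ (_ , hi)) = hi
        upper n≡ {g} (inj₂ (_ , hi)) = less g n≡ hi

        total = farkas Γ 6 (λ n a s m₀ M₀ m₁ M₁ m₂ M₂ →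
            n ≈ # 3 :* a :+ s :+ # 1 ⇒ M₁ :- m₀ :+ # 0 :* n ≼ a :+ s ⇒
            M₂ :- m₁ :+ # 0 :* n ≼ a :+ s ⇒ M₀ :- m₂ :+ # 1 :* n ≼ a :+ s ⇒
            ⊩ M₀ :- m₀ :+ # 1 :+ (M₁ :- m₁ :+ # 1 :+ (M₂ :- m₂ :+ # 1)) ≼ # 2 :* s :+ # 7)
            (1 ∷ 1 ∷ 1 ∷ 1 ∷ 0 ∷ 1 ∷ [])

      -- Three disjoint intervals, each beginning at least a + 1 after the end of the previous one.
      bound-lo : n ≡ + 3 * a + + 2 * s + + 1 → + N ≤ + 2 * s + + 7
      bound-lo n≡ = ≤-trans (count (spread-bounded E₀) (spread-bounded E₁) (spread-bounded E₂))
        (total (σ (bot E₀)) (σ (top E₀)) (σ (bot E₁)) (σ (top E₁)) (σ (bot E₂)) (σ (top E₂)) n≡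
          (lower n≡ (gap₀ (top∈ E₀) (bot∈ E₁))) (lower n≡ (gap₁ (top∈ E₁) (bot∈ E₂)))
          (lower n≡ (gap₂ (top∈ E₂) (bot∈ E₀))))
        where
        more = farkas Γ 1 (λ n a s g →
            n ≈ # 3 :* a :+ # 2 :* s :+ # 1 ⇒ n :- # 2 :* a :- # 2 :* s ≼ g ⇒ ⊩ a :+ # 1 ≼ g)
            (1 ∷ 1 ∷ 0 ∷ 1 ∷ [])

        lower : n ≡ + 3 * a + + 2 * s + + 1 → ∀ {g} → Gap g → a + + 1 ≤ g
        lower n≡ (inj₁ (lo , _)) = lo
        lower n≡ {g} (inj₂ (lo , _)) = more g n≡ lo

        total = farkas Γ 6 (λ n a s m₀ M₀ m₁ M₁ m₂ M₂ →
            n ≈ # 3 :* a :+ # 2 :* s :+ # 1 ⇒ a :+ # 1 ≼ m₁ :- M₀ :+ # 0 :* n ⇒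
            a :+ # 1 ≼ m₂ :- M₁ :+ # 0 :* n ⇒ a :+ # 1 ≼ m₀ :- M₂ :+ # 1 :* n ⇒
            ⊩ M₀ :- m₀ :+ # 1 :+ (M₁ :- m₁ :+ # 1 :+ (M₂ :- m₂ :+ # 1)) ≼ # 2 :* s :+ # 7)
            (1 ∷ 1 ∷ 1 ∷ 1 ∷ 1 ∷ [])

      module _ (n≡ : n ≡ + 3 * a + + 1) where
        Γ′ : Context
        Γ′ = context (n ∷ a ∷ s ∷ []) (λ n a s → (# 1 ≼ s) ∷ (n ≈ # 3 :* a :+ # 1) ∷ [])
          λ _ → s≥1 , n≡ , tt


        -- The gap a does not occur, so after a shift by a the two classes are disjoint.
        pair-bounded : ∀ {i j} u → i + + 1 - j ≡ + 3 * u → (E : Extremes (Class i) σ) (F : Extremes (Class j) σ) →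
                       σ (bot E) ≤ σ (bot F) + u * n - a → Bounded (λ x → Class i x ⊎ Class j x) (s + + 1)
        pair-bounded {i} {j} u e E F le = bounded-window key (σ (bot E)) (room s≥1) range key-inj
          where
          room : + 1 ≤ s → + 0 ≤ s + + 1
          room h = ≤-trans (≤-trans (+≤+ z≤n) h) (i≤i+j s (+ 1))

          key : ∀ x → Class i x ⊎ Class j x → ℤ
          key x (inj₁ _) = σ x
          key x (inj₂ _) = σ x + u * n - a

          hi-E = farkas Γ′ 3 (λ n a s x m M →
              x ≼ M ⇒ M :- m :+ # 1 ≼ s ⇒ ⊩ x :+ # 1 ≼ m :+ (s :+ # 1)) (1 ∷ 1 ∷ 1 ∷ [])

          lo-F = farkas Γ′ 4 (λ n a s x m m′ w →
              m ≼ m′ :+ w :- a ⇒ m′ ≼ x ⇒ ⊩ m ≼ x :+ w :- a) (1 ∷ 1 ∷ 1 ∷ [])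

          hi-F₁ = farkas Γ′ 3 (λ n a s x m w →
              x :- m :+ w ≼ a :+ s ⇒ ⊩ x :+ w :- a :+ # 1 ≼ m :+ (s :+ # 1)) (1 ∷ 1 ∷ [])

          hi-F₂ = farkas Γ′ 3 (λ n a s x m w →
              x :- m :+ w ≼ n :- # 2 :* a :- # 2 ⇒ ⊩ x :+ w :- a :+ # 1 ≼ m :+ (s :+ # 1))
              (1 ∷ 1 ∷ 1 ∷ 1 ∷ [])

          hi-F : ∀ x → Gap (σ x - σ (bot E) + u * n) → σ x + u * n - a + + 1 ≤ σ (bot E) + (s + + 1)
          hi-F x (inj₁ (_ , hi)) = hi-F₁ (σ x) (σ (bot E)) (u * n) hi
          hi-F x (inj₂ (_ , hi)) = hi-F₂ (σ x) (σ (bot E)) (u * n) hi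

          range : ∀ x p → σ (bot E) ≤ key x p × key x p + + 1 ≤ σ (bot E) + (s + + 1)
          range x (inj₁ p) = bot≤ E p , hi-E (σ x) (σ (bot E)) (σ (top E)) (≤top E p) (class-spread E)
          range x (inj₂ p) = lo-F (σ x) (σ (bot E)) (σ (bot F)) (u * n) le (bot≤ F p) ,
                             hi-F x (class-gap u e (bot∈ E) p)

          apart₁ = farkas Γ′ 3 (λ n a s x y w →
              x ≈ y :+ w :- a ⇒ a :+ # 1 ≼ y :- x :+ w ⇒ ⊩⊥) (1 ∷ 0 ∷ 1 ∷ [])

          apart₂ = farkas Γ′ 3 (λ n a s x y w →
              x ≈ y :+ w :- a ⇒ y :- x :+ w ≼ n :- # 2 :* a :- # 2 ⇒ ⊩⊥) (1 ∷ 1 ∷ 0 ∷ 0 ∷ 1 ∷ [])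

          apart : ∀ x y → σ x ≡ σ y + u * n - a → Gap (σ y - σ x + u * n) → ⊥
          apart x y e (inj₁ (lo , _)) = apart₁ (σ x) (σ y) (u * n) e lo
          apart x y e (inj₂ (_ , hi)) = apart₂ (σ x) (σ y) (u * n) e hi

          unshift = farkas₂ Γ′ 3 (λ n a s x y w →
              x :+ w :- a ≈ y :+ w :- a ⇒ ⊩ x ≈ y) (1 ∷ 1 ∷ []) (1 ∷ 0 ∷ 1 ∷ [])

          key-inj : ∀ {x y} p q → key x p ≡ key y q → x ≡ y
          key-inj (inj₁ _) (inj₁ _) k = σ-inj k
          key-inj {x} {y} (inj₁ p) (inj₂ q) k = ⊥-elim (apart x y k (class-gap u e p q))
          key-inj {x} {y} (inj₂ p) (inj₁ q) k = ⊥-elim (apart y x (sym k) (class-gap u e q p))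
          key-inj {x} {y} (inj₂ _) (inj₂ _) k = σ-inj (unshift (σ x) (σ y) (u * n) k)

        total = farkas Γ′ 0 (λ n a s → ⊩ s :+ # 1 :+ s ≼ # 2 :* s :+ # 7) (1 ∷ [])

        cyclic = farkas Γ′ 3 (λ n a s m₀ m₁ m₂ →
            m₁ :+ # 0 :* n :- a :+ # 1 ≼ m₀ ⇒ m₂ :+ # 0 :* n :- a :+ # 1 ≼ m₁ ⇒
            m₀ :+ # 1 :* n :- a :+ # 1 ≼ m₂ ⇒ ⊩⊥) (1 ∷ 1 ∷ 1 ∷ 0 ∷ 0 ∷ 1 ∷ [])

        finish : ∀ {i j k} → (∀ x → (Class i x ⊎ Class j x) ⊎ Class k x) →
                 Bounded (λ x → Class i x ⊎ Class j x) (s + + 1) → Bounded (Class k) s → + N ≤ + 2 * s + + 7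
        finish split B B′ = ≤-trans (bounded-all (bounded-⊎ (λ _ → id) B B′) split) total

        -- If no consecutive pair of classes met the condition of `pair-bounded`, adding the three
        -- failures would give n ≤ 3 a - 3. The count is (s + 1) + s.
        bound-disjoint : + N ≤ + 2 * s + + 7
        bound-disjoint = choose (≤⊎≥ (σ (bot E₀)) (σ (bot E₁) + + 0 * n - a))
            (≤⊎≥ (σ (bot E₁)) (σ (bot E₂) + + 0 * n - a)) (≤⊎≥ (σ (bot E₂)) (σ (bot E₀) + + 1 * n - a))
          where
          split₀₁ : ∀ x → (Class (+ 0) x ⊎ Class (+ 1) x) ⊎ Class (+ 2) x
          split₀₁ x = [ inj₁ ∘ inj₁ , [ inj₁ ∘ inj₂ , inj₂ ]′ ]′ (class-cover x)

          split₁₂ : ∀ x → (Class (+ 1) x ⊎ Class (+ 2) x) ⊎ Class (+ 0) x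
          split₁₂ x = [ inj₂ , inj₁ ]′ (class-cover x)

          split₂₀ : ∀ x → (Class (+ 2) x ⊎ Class (+ 0) x) ⊎ Class (+ 1) x
          split₂₀ x = [ inj₁ ∘ inj₂ , [ inj₂ , inj₁ ∘ inj₁ ]′ ]′ (class-cover x)

          choose : σ (bot E₀) ≤ σ (bot E₁) + + 0 * n - a ⊎ σ (bot E₁) + + 0 * n - a + + 1 ≤ σ (bot E₀) →
                   σ (bot E₁) ≤ σ (bot E₂) + + 0 * n - a ⊎ σ (bot E₂) + + 0 * n - a + + 1 ≤ σ (bot E₁) →
                   σ (bot E₂) ≤ σ (bot E₀) + + 1 * n - a ⊎ σ (bot E₀) + + 1 * n - a + + 1 ≤ σ (bot E₂) →
                   + N ≤ + 2 * s + + 7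
          choose (inj₁ h) _ _ = finish split₀₁ (pair-bounded (+ 0) refl E₀ E₁ h) (class-bounded E₂)
          choose _ (inj₁ h) _ = finish split₁₂ (pair-bounded (+ 0) refl E₁ E₂ h) (class-bounded E₀)
          choose _ _ (inj₁ h) = finish split₂₀ (pair-bounded (+ 1) refl E₂ E₀ h) (class-bounded E₁)
          choose (inj₂ h₀) (inj₂ h₁) (inj₂ h₂) =
            ⊥-elim (cyclic (σ (bot E₀)) (σ (bot E₁)) (σ (bot E₂)) h₀ h₁ h₂)

    Γ″ : Context
    Γ″ = context (n ∷ a ∷ s ∷ []) (λ n a s → (# 1 ≼ s) ∷ [])
      λ _ → s≥1 , tt

    two-classes₀ = farkas Γ″ 0 (λ n a s → ⊩ # 0 :+ (s :+ s) ≼ # 2 :* s :+ # 7) (1 ∷ [])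

    two-classes₁ = farkas Γ″ 0 (λ n a s → ⊩ s :+ (# 0 :+ s) ≼ # 2 :* s :+ # 7) (1 ∷ [])

    two-classes₂ = farkas Γ″ 0 (λ n a s → ⊩ s :+ (s :+ # 0) ≼ # 2 :* s :+ # 7) (1 ∷ [])

    s≥0 = farkas Γ″ 0 (λ n a s → ⊩ # 0 ≼ s) (1 ∷ 1 ∷ [])

    bound : n ≡ + 3 * a + + 1 ⊎ n ≡ + 3 * a + s + + 1 ⊎ n ≡ + 3 * a + + 2 * s + + 1 → + N ≤ + 2 * s + + 7
    bound n≡ = conclude (ext (+ 0)) (ext (+ 1)) (ext (+ 2))
      where
      ext : ∀ j → (∀ x → ¬ Class j x) ⊎ Extremes (Class j) σ
      ext j = extremes (λ x → τ x ≟ j) σ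

      any-class : ∀ {j} → (∀ x → ¬ Class j x) ⊎ Extremes (Class j) σ → Bounded (Class j) s
      any-class (inj₁ none) = bounded-∅ s≥0 none
      any-class (inj₂ E)    = class-bounded E

      conclude : (∀ x → ¬ Class (+ 0) x) ⊎ Extremes (Class (+ 0)) σ →
                 (∀ x → ¬ Class (+ 1) x) ⊎ Extremes (Class (+ 1)) σ →
                 (∀ x → ¬ Class (+ 2) x) ⊎ Extremes (Class (+ 2)) σ → + N ≤ + 2 * s + + 7
      conclude (inj₁ none) e₁ e₂ = ≤-trans (count (bounded-∅ ≤-refl none) (any-class e₁) (any-class e₂)) two-classes₀
      conclude e₀ (inj₁ none) e₂ = ≤-trans (count (any-class e₀) (bounded-∅ ≤-refl none) (any-class e₂)) two-classes₁
      conclude e₀ e₁ (inj₁ none) = ≤-trans (count (any-class e₀) (any-class e₁) (bounded-∅ ≤-refl none)) two-classes₂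
      conclude (inj₂ E₀) (inj₂ E₁) (inj₂ E₂) =
        [ bound-disjoint E₀ E₁ E₂ , [ bound-hi E₀ E₁ E₂ , bound-lo E₀ E₁ E₂ ]′ ]′ n≡

  -- Closed walks of length at most five and the types they define

  module Tripartite {N : ℕ} {n : ℤ} (C : Circle N n) (a s : ℤ)
    (s≥1 : + 1 ≤ s) (a≥2s : + 2 * s ≤ a) (n≥2a+3s : + 2 * a + + 3 * s ≤ n)
    (n>3a : + 3 * a + + 1 ≤ n) (n≤3a+2s : n ≤ + 3 * a + + 2 * s + + 1)
    (diam : Circulant.DiamTwo C a s)
    (no-50 : ∀ {x} → ¬ Circulant.Walk C a s x x 5 0)
    (v : Fin N) where

    open Circle C
    open CircleProperties C
    open Circulant C a s

    Γ‴ : Context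
    Γ‴ = context (n ∷ a ∷ s ∷ []) (λ n a s → (# 1 ≼ s) ∷ (# 2 :* s ≼ a) ∷ (# 2 :* a :+ # 3 :* s ≼ n) ∷ (# 3 :* a :+ # 1 ≼ n) ∷ (n ≼ # 3 :* a :+ # 2 :* s :+ # 1) ∷ [])
      λ _ → s≥1 , a≥2s , n≥2a+3s , n>3a , n≤3a+2s , tt

    -- What the length of a closed walk with p forward and q backward edges allows for its winding
    -- number t: either p - q = 3 t for the only possible t, or there is none.
    data Fits (p q : ℕ) : Set where
      forced : ∀ t → (t - + 1) * n + + 1 ≤ + p * (a + + 1) - + q * (a + s) →
               + p * (a + s) - + q * (a + + 1) + + 1 ≤ (t + + 1) * n → + p - + q ≡ + 3 * t → Fits p q
      none   : ∀ u → u * n + + 1 ≤ + p * (a + + 1) - + q * (a + s) →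
               + p * (a + s) - + q * (a + + 1) + + 1 ≤ (u + + 1) * n → Fits p q

    -- Reversing a closed walk exchanges p and q and negates its length, so the inequalities are
    -- only checked for p ≥ q.
    swap : ∀ {p q} → Fits p q → Fits q p
    swap {p} {q} (forced t lo hi e) = forced (- t) (lo′ (+ p) (+ q) t hi) (hi′ (+ p) (+ q) t lo) (neg (+ p) (+ q) t e)
      where
      lo′ = farkas Γ‴ 3 (λ n a s p q t →
          p :* (a :+ s) :- q :* (a :+ # 1) :+ # 1 ≼ (t :+ # 1) :* n ⇒
          ⊩ (⊝ t :- # 1) :* n :+ # 1 ≼ q :* (a :+ # 1) :- p :* (a :+ s)) (1 ∷ 1 ∷ [])

      hi′ = farkas Γ‴ 3 (λ n a s p q t →
          (t :- # 1) :* n :+ # 1 ≼ p :* (a :+ # 1) :- q :* (a :+ s) ⇒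
          ⊩ q :* (a :+ s) :- p :* (a :+ # 1) :+ # 1 ≼ (⊝ t :+ # 1) :* n) (1 ∷ 1 ∷ [])

      neg = farkas₂ Γ‴ 3 (λ n a s p q t →
          p :- q ≈ # 3 :* t ⇒ ⊩ q :- p ≈ # 3 :* ⊝ t) (1 ∷ 0 ∷ 1 ∷ []) (1 ∷ 1 ∷ [])

    swap {p} {q} (none u lo hi) = none (- u - + 1) (lo′ (+ p) (+ q) u hi) (hi′ (+ p) (+ q) u lo)
      where
      lo′ = farkas Γ‴ 3 (λ n a s p q u →
          p :* (a :+ s) :- q :* (a :+ # 1) :+ # 1 ≼ (u :+ # 1) :* n ⇒
          ⊩ (⊝ u :- # 1) :* n :+ # 1 ≼ q :* (a :+ # 1) :- p :* (a :+ s)) (1 ∷ 1 ∷ [])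

      hi′ = farkas Γ‴ 3 (λ n a s p q u →
          u :* n :+ # 1 ≼ p :* (a :+ # 1) :- q :* (a :+ s) ⇒
          ⊩ q :* (a :+ s) :- p :* (a :+ # 1) :+ # 1 ≼ (⊝ u :- # 1 :+ # 1) :* n) (1 ∷ 1 ∷ [])

    lo00 = farkas Γ‴ 0 (λ n a s →
        ⊩ (# 0 :- # 1) :* n :+ # 1 ≼ # 0 :* (a :+ # 1) :- # 0 :* (a :+ s)) (1 ∷ 7 ∷ 2 ∷ 1 ∷ [])

    hi00 = farkas Γ‴ 0 (λ n a s →
        ⊩ # 0 :* (a :+ s) :- # 0 :* (a :+ # 1) :+ # 1 ≼ (# 0 :+ # 1) :* n) (1 ∷ 7 ∷ 2 ∷ 1 ∷ [])

    lo11 = farkas Γ‴ 0 (λ n a s →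
        ⊩ (# 0 :- # 1) :* n :+ # 1 ≼ # 1 :* (a :+ # 1) :- # 1 :* (a :+ s)) (1 ∷ 6 ∷ 2 ∷ 1 ∷ [])

    hi11 = farkas Γ‴ 0 (λ n a s →
        ⊩ # 1 :* (a :+ s) :- # 1 :* (a :+ # 1) :+ # 1 ≼ (# 0 :+ # 1) :* n) (1 ∷ 6 ∷ 2 ∷ 1 ∷ [])

    lo22 = farkas Γ‴ 0 (λ n a s →
        ⊩ (# 0 :- # 1) :* n :+ # 1 ≼ # 2 :* (a :+ # 1) :- # 2 :* (a :+ s)) (1 ∷ 5 ∷ 2 ∷ 1 ∷ [])

    hi22 = farkas Γ‴ 0 (λ n a s →
        ⊩ # 2 :* (a :+ s) :- # 2 :* (a :+ # 1) :+ # 1 ≼ (# 0 :+ # 1) :* n) (1 ∷ 5 ∷ 2 ∷ 1 ∷ [])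

    lo30 = farkas Γ‴ 0 (λ n a s →
        ⊩ (# 1 :- # 1) :* n :+ # 1 ≼ # 3 :* (a :+ # 1) :- # 0 :* (a :+ s)) (1 ∷ 6 ∷ 3 ∷ [])

    hi30 = farkas Γ‴ 0 (λ n a s →
        ⊩ # 3 :* (a :+ s) :- # 0 :* (a :+ # 1) :+ # 1 ≼ (# 1 :+ # 1) :* n) (1 ∷ 5 ∷ 1 ∷ 2 ∷ [])

    lo41 = farkas Γ‴ 0 (λ n a s →
        ⊩ (# 1 :- # 1) :* n :+ # 1 ≼ # 4 :* (a :+ # 1) :- # 1 :* (a :+ s)) (1 ∷ 5 ∷ 3 ∷ [])

    hi41 = farkas Γ‴ 0 (λ n a s →
        ⊩ # 4 :* (a :+ s) :- # 1 :* (a :+ # 1) :+ # 1 ≼ (# 1 :+ # 1) :* n) (1 ∷ 4 ∷ 1 ∷ 2 ∷ [])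

    lo10 = farkas Γ‴ 0 (λ n a s →
        ⊩ # 0 :* n :+ # 1 ≼ # 1 :* (a :+ # 1) :- # 0 :* (a :+ s)) (1 ∷ 2 ∷ 1 ∷ [])

    hi10 = farkas Γ‴ 0 (λ n a s →
        ⊩ # 1 :* (a :+ s) :- # 0 :* (a :+ # 1) :+ # 1 ≼ (# 0 :+ # 1) :* n) (1 ∷ 4 ∷ 1 ∷ 1 ∷ [])

    lo20 = farkas Γ‴ 0 (λ n a s →
        ⊩ # 0 :* n :+ # 1 ≼ # 2 :* (a :+ # 1) :- # 0 :* (a :+ s)) (1 ∷ 4 ∷ 2 ∷ [])

    hi20 = farkas Γ‴ 0 (λ n a s →
        ⊩ # 2 :* (a :+ s) :- # 0 :* (a :+ # 1) :+ # 1 ≼ (# 0 :+ # 1) :* n) (1 ∷ 1 ∷ 0 ∷ 1 ∷ [])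

    lo21 = farkas Γ‴ 0 (λ n a s →
        ⊩ # 0 :* n :+ # 1 ≼ # 2 :* (a :+ # 1) :- # 1 :* (a :+ s)) (1 ∷ 1 ∷ 1 ∷ [])

    hi21 = farkas Γ‴ 0 (λ n a s →
        ⊩ # 2 :* (a :+ s) :- # 1 :* (a :+ # 1) :+ # 1 ≼ (# 0 :+ # 1) :* n) (1 ∷ 3 ∷ 1 ∷ 1 ∷ [])

    lo31 = farkas Γ‴ 0 (λ n a s →
        ⊩ # 0 :* n :+ # 1 ≼ # 3 :* (a :+ # 1) :- # 1 :* (a :+ s)) (1 ∷ 3 ∷ 2 ∷ [])

    -- The maximal length 2 a + 3 s - 1 of such a walk is what the hypothesis n ≥ 2 a + 3 s is made
    -- for.
    hi31 = farkas Γ‴ 0 (λ n a s →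
        ⊩ # 3 :* (a :+ s) :- # 1 :* (a :+ # 1) :+ # 1 ≼ (# 0 :+ # 1) :* n) (1 ∷ 0 ∷ 0 ∷ 1 ∷ [])

    lo32 = farkas Γ‴ 0 (λ n a s →
        ⊩ # 0 :* n :+ # 1 ≼ # 3 :* (a :+ # 1) :- # 2 :* (a :+ s)) (1 ∷ 0 ∷ 1 ∷ [])

    hi32 = farkas Γ‴ 0 (λ n a s →
        ⊩ # 3 :* (a :+ s) :- # 2 :* (a :+ # 1) :+ # 1 ≼ (# 0 :+ # 1) :* n) (1 ∷ 2 ∷ 1 ∷ 1 ∷ [])

    -- Four forward edges exceed one turn: here n ≤ 3 a + 2 s + 1 enters, together with 2 s ≤ a.
    lo40 = farkas Γ‴ 0 (λ n a s →
        ⊩ # 1 :* n :+ # 1 ≼ # 4 :* (a :+ # 1) :- # 0 :* (a :+ s)) (1 ∷ 0 ∷ 1 ∷ 0 ∷ 0 ∷ 1 ∷ [])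

    hi40 = farkas Γ‴ 0 (λ n a s →
        ⊩ # 4 :* (a :+ s) :- # 0 :* (a :+ # 1) :+ # 1 ≼ (# 1 :+ # 1) :* n) (1 ∷ 2 ∷ 0 ∷ 2 ∷ [])

    table : ∀ p q → p ℕ.+ q ℕ.≤ 5 → ((p ≡ 5 × q ≡ 0) ⊎ (p ≡ 0 × q ≡ 5)) ⊎ Fits p q
    table 0 0 _ = inj₂ (forced (+ 0) lo00 hi00 refl)
    table 0 1 _ = inj₂ (swap (none (+ 0) lo10 hi10))
    table 0 2 _ = inj₂ (swap (none (+ 0) lo20 hi20))
    table 0 3 _ = inj₂ (swap (forced (+ 1) lo30 hi30 refl))
    table 0 4 _ = inj₂ (swap (none (+ 1) lo40 hi40))
    table 0 5 _ = inj₁ (inj₂ (refl , refl))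
    table 0 (suc (suc (suc (suc (suc (suc q)))))) (s≤s (s≤s (s≤s (s≤s (s≤s ())))))
    table 1 0 _ = inj₂ (none (+ 0) lo10 hi10)
    table 1 1 _ = inj₂ (forced (+ 0) lo11 hi11 refl)
    table 1 2 _ = inj₂ (swap (none (+ 0) lo21 hi21))
    table 1 3 _ = inj₂ (swap (none (+ 0) lo31 hi31))
    table 1 4 _ = inj₂ (swap (forced (+ 1) lo41 hi41 refl))
    table 1 (suc (suc (suc (suc (suc q))))) (s≤s (s≤s (s≤s (s≤s (s≤s ())))))
    table 2 0 _ = inj₂ (none (+ 0) lo20 hi20)
    table 2 1 _ = inj₂ (none (+ 0) lo21 hi21)
    table 2 2 _ = inj₂ (forced (+ 0) lo22 hi22 refl)
    table 2 3 _ = inj₂ (swap (none (+ 0) lo32 hi32))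
    table 2 (suc (suc (suc (suc q)))) (s≤s (s≤s (s≤s (s≤s (s≤s ())))))
    table 3 0 _ = inj₂ (forced (+ 1) lo30 hi30 refl)
    table 3 1 _ = inj₂ (none (+ 0) lo31 hi31)
    table 3 2 _ = inj₂ (none (+ 0) lo32 hi32)
    table 3 (suc (suc (suc q))) (s≤s (s≤s (s≤s (s≤s (s≤s ())))))
    table 4 0 _ = inj₂ (none (+ 1) lo40 hi40)
    table 4 1 _ = inj₂ (forced (+ 1) lo41 hi41 refl)
    table 4 (suc (suc q)) (s≤s (s≤s (s≤s (s≤s (s≤s ())))))
    table 5 0 _ = inj₁ (inj₁ (refl , refl))
    table 5 (suc q) (s≤s (s≤s (s≤s (s≤s (s≤s ())))))
    table (suc (suc (suc (suc (suc (suc p)))))) q (s≤s (s≤s (s≤s (s≤s (s≤s ())))))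

    winding : ∀ {x p q} (W : Walk x x p q) → p ℕ.+ q ℕ.≤ 5 → ∃ λ t → + p - + q ≡ + 3 * t × sum W ≡ t * n
    winding {x} {p} {q} W len with table p q len
    ... | inj₁ (inj₁ (refl , refl)) = ⊥-elim (no-50 W)
    ... | inj₁ (inj₂ (refl , refl)) = ⊥-elim (no-50 (reverse W))
    ... | inj₂ (none u lo hi)       = ⊥-elim (no-closed u lo hi W)
    ... | inj₂ (forced t lo hi e)   = t , e , trans (closed-sum W) (cong (_* n) (mult-unique (- turns W) n t (n≥1 x)
      (≤-trans lo (≤-trans (sum-lo W) (≤-reflexive (closed-sum W))))
      (≤-trans (+-monoˡ-≤ (+ 1) (≤-trans (≤-reflexive (sym (closed-sum W))) (sum-hi W))) hi)))

    -- A walk of length at most two from v to x, as an element (σ, τ) of the threefold cover of the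
    -- circle: σ lifts the position of x and τ is the type of x.
    record Place (x : Fin N) : Set where
      constructor place
      field
        {p q}  : ℕ
        walk   : Walk v x p q
        short  : p ℕ.+ q ℕ.≤ 2
        u      : ℤ
        τ≥0    : + 0 ≤ + p - + q + + 3 * u
        τ≤2    : + p - + q + + 3 * u ≤ + 2

      τ σ : ℤ
      τ = + p - + q + + 3 * u
      σ = sum walk + u * n

    places : ∀ x → Place x
    places x with diam v x
    ... | inj₁ refl = place stop z≤n (+ 0) (+≤+ z≤n) (+≤+ z≤n)
    ... | inj₂ (inj₁ (inj₁ e)) = place (fwd e stop) (s≤s z≤n) (+ 0) (+≤+ z≤n) (+≤+ (s≤s z≤n))
    ... | inj₂ (inj₁ (inj₂ e)) = place (bwd e stop) (s≤s z≤n) (+ 1) (+≤+ z≤n) (+≤+ (s≤s (s≤s z≤n)))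
    ... | inj₂ (inj₂ (_ , inj₁ e , inj₁ f)) = place (fwd e (fwd f stop)) (s≤s (s≤s z≤n)) (+ 0) (+≤+ z≤n) (+≤+ (s≤s (s≤s z≤n)))
    ... | inj₂ (inj₂ (_ , inj₁ e , inj₂ f)) = place (fwd e (bwd f stop)) (s≤s (s≤s z≤n)) (+ 0) (+≤+ z≤n) (+≤+ z≤n)
    ... | inj₂ (inj₂ (_ , inj₂ e , inj₁ f)) = place (bwd e (fwd f stop)) (s≤s (s≤s z≤n)) (+ 0) (+≤+ z≤n) (+≤+ z≤n)
    ... | inj₂ (inj₂ (_ , inj₂ e , inj₂ f)) = place (bwd e (bwd f stop)) (s≤s (s≤s z≤n)) (+ 1) (+≤+ z≤n) (+≤+ (s≤s z≤n))

    τ σ : Fin N → ℤ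
    τ x = Place.τ (places x)
    σ x = Place.σ (places x)

    σ-inj : ∀ {x y} → σ x ≡ σ y → x ≡ y
    σ-inj {x} {y} e = pos-inj (turns (walk Y) - turns (walk X) - u Y + u X)
      (link (pos v) (pos x) (pos y) (sum (walk X)) (sum (walk Y)) (turns (walk X)) (turns (walk Y)) (u X) (u Y)
        (sum-eq (walk X)) (sum-eq (walk Y)) e)
      where
      open Place
      X = places x
      Y = places y
      link = farkas₂ Γ‴ 9 (λ n a s pv px py c d w w′ u u′ →
          px ≈ pv :+ c :+ w :* n ⇒ py ≈ pv :+ d :+ w′ :* n ⇒ c :+ u :* n ≈ d :+ u′ :* n ⇒
          ⊩ py ≈ px :+ (w′ :- w :- u′ :+ u) :* n)
          (1 ∷ 0 ∷ 1 ∷ 1 ∷ 0 ∷ 0 ∷ 1 ∷ []) (1 ∷ 1 ∷ 0 ∷ 0 ∷ 1 ∷ 1 ∷ [])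

    -- The edge and the two chosen walks from v form a closed walk of length at most five, to which
    -- `winding` applies; the shifts `u` of the two places correct its winding number.
    edge : ∀ {x y} → x ⟶ y → ∃ λ t → τ x + + 1 - τ y ≡ + 3 * t × σ x + off x y - σ y ≡ t * n
    edge {x} {y} e = proj₁ closed + u X - u Y ,
        types (+ p X) (+ q X) (+ p Y) (+ q Y) (u X) (u Y) (proj₁ closed) (proj₁ (proj₂ closed)) ,
        lifts (sum (walk X)) (sum (walk Y)) (off x y) (u X) (u Y) (proj₁ closed) (sum W) total (proj₂ (proj₂ closed))
      where
      open Place
      X = places x
      Y = places y

      W : Walk v v (p X ℕ.+ suc (q Y)) (q X ℕ.+ p Y)
      W = walk X ++ fwd e (reverse (walk Y))

      shuffle : ∀ a b c d → a ℕ.+ suc d ℕ.+ (b ℕ.+ c) ≡ suc ((a ℕ.+ b) ℕ.+ (c ℕ.+ d))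
      shuffle = ℕ-solve-∀

      closed : ∃ λ t → + (p X ℕ.+ suc (q Y)) - + (q X ℕ.+ p Y) ≡ + 3 * t × sum W ≡ t * n
      closed = winding W (ℕ.≤-trans (ℕ.≤-reflexive (shuffle (p X) (q X) (p Y) (q Y)))
        (s≤s (ℕ.+-mono-≤ (short X) (short Y))))

      total : sum W ≡ sum (walk X) + (off x y + - sum (walk Y))
      total = trans (sum-++ (walk X) _) (cong (λ t → sum (walk X) + (off x y + t)) (sum-reverse (walk Y)))

      types = farkas₂ Γ‴ 7 (λ n a s p q p′ q′ u u′ t →
          p :+ (# 1 :+ q′) :- (q :+ p′) ≈ # 3 :* t ⇒
          ⊩ p :- q :+ # 3 :* u :+ # 1 :- (p′ :- q′ :+ # 3 :* u′) ≈ # 3 :* (t :+ u :- u′))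
          (1 ∷ 1 ∷ []) (1 ∷ 0 ∷ 1 ∷ [])

      lifts = farkas₂ Γ‴ 7 (λ n a s c c′ d u u′ t w →
          w ≈ c :+ (d :+ ⊝ c′) ⇒ w ≈ t :* n ⇒
          ⊩ c :+ u :* n :+ d :- (c′ :+ u′ :* n) ≈ (t :+ u :- u′) :* n)
          (1 ∷ 1 ∷ 0 ∷ 0 ∷ 1 ∷ []) (1 ∷ 0 ∷ 1 ∷ 1 ∷ [])

    bound : n ≡ + 3 * a + + 1 ⊎ n ≡ + 3 * a + s + + 1 ⊎ n ≡ + 3 * a + + 2 * s + + 1 → + N ≤ + 2 * s + + 7
    bound = ThreeTypes.bound C a s s≥1 diam τ σ (λ x → Place.τ≥0 (places x)) (λ x → Place.τ≤2 (places x)) σ-inj edge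

  -- Block 0: all vertices lie close together

  module ShortArc {N : ℕ} {n : ℤ} (C : Circle N n) (s : ℤ) (s≥1 : + 1 ≤ s) (n>6s : + 6 * s + + 1 ≤ n)
    (diam : Circulant.DiamTwo C (+ 0) s) (v : Fin N) where

    open Circle C
    open CircleProperties C
    open Circulant C (+ 0) s

    Γ : Context
    Γ = context (n ∷ s ∷ []) (λ n s → (# 1 ≼ s) ∷ (# 6 :* s :+ # 1 ≼ n) ∷ [])
      λ _ → s≥1 , n>6s , tt

    record Near (x y : Fin N) : Set where
      constructor near
      field
        {d}  : ℤ
        w    : ℤ
        eq   : pos y ≡ pos x + d + w * n
        lo   : - (+ 2 * s) ≤ d
        hi   : d ≤ + 2 * s

    open Near

    distance-two : ∀ x y → Near x y
    distance-two x y = by-distance (diam x y)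
      where
      equal = farkas₂ Γ 2 (λ n s p q →
          p ≈ q ⇒ ⊩ p ≈ q :+ # 0 :+ # 0 :* n) (1 ∷ 1 ∷ []) (1 ∷ 0 ∷ 1 ∷ [])

      lo₀ = farkas Γ 0 (λ n s → ⊩ ⊝ (# 2 :* s) ≼ # 0) (1 ∷ 2 ∷ [])

      hi₀ = farkas Γ 0 (λ n s → ⊩ # 0 ≼ # 2 :* s) (1 ∷ 2 ∷ [])

      lo₁ = farkas Γ 1 (λ n s d → # 0 :+ # 1 ≼ d ⇒ ⊩ ⊝ (# 2 :* s) ≼ d) (1 ∷ 1 ∷ 2 ∷ [])

      hi₁ = farkas Γ 1 (λ n s d → d ≼ # 0 :+ s ⇒ ⊩ d ≼ # 2 :* s) (1 ∷ 1 ∷ 1 ∷ [])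

      lo₁′ = farkas Γ 1 (λ n s d → d ≼ # 0 :+ s ⇒ ⊩ ⊝ (# 2 :* s) ≼ ⊝ d) (1 ∷ 1 ∷ 1 ∷ [])

      hi₁′ = farkas Γ 1 (λ n s d → # 0 :+ # 1 ≼ d ⇒ ⊩ ⊝ d ≼ # 2 :* s) (1 ∷ 1 ∷ 2 ∷ [])

      turn = farkas₂ Γ 4 (λ n s p q d w →
          p ≈ q :+ d :+ w :* n ⇒ ⊩ q ≈ p :+ ⊝ d :+ ⊝ w :* n) (1 ∷ 0 ∷ 1 ∷ []) (1 ∷ 1 ∷ [])

      lo₂ = farkas Γ 2 (λ n s d e → ⊝ s ≼ d ⇒ ⊝ s ≼ e ⇒ ⊩ ⊝ (# 2 :* s) ≼ d :+ e) (1 ∷ 1 ∷ 1 ∷ [])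

      hi₂ = farkas Γ 2 (λ n s d e → d ≼ s ⇒ e ≼ s ⇒ ⊩ d :+ e ≼ # 2 :* s) (1 ∷ 1 ∷ 1 ∷ [])

      join = farkas₂ Γ 7 (λ n s p q r d e w u →
          q ≈ p :+ d :+ w :* n ⇒ r ≈ q :+ e :+ u :* n ⇒ ⊩ r ≈ p :+ (d :+ e) :+ (w :+ u) :* n)
          (1 ∷ 1 ∷ 0 ∷ 1 ∷ []) (1 ∷ 0 ∷ 1 ∷ 0 ∷ 1 ∷ [])

      record Step (x y : Fin N) : Set where
        constructor step
        field
          d w : ℤ
          eq  : pos y ≡ pos x + d + w * n
          lo  : - s ≤ d
          hi  : d ≤ s

      step-lo = farkas Γ 1 (λ n s d → # 0 :+ # 1 ≼ d ⇒ ⊩ ⊝ s ≼ d) (1 ∷ 1 ∷ 1 ∷ [])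

      step-hi = farkas Γ 1 (λ n s d → d ≼ # 0 :+ s ⇒ ⊩ d ≼ s) (1 ∷ 1 ∷ [])

      step-lo′ = farkas Γ 1 (λ n s d → d ≼ # 0 :+ s ⇒ ⊩ ⊝ s ≼ ⊝ d) (1 ∷ 1 ∷ [])

      step-hi′ = farkas Γ 1 (λ n s d → # 0 :+ # 1 ≼ d ⇒ ⊩ ⊝ d ≼ s) (1 ∷ 1 ∷ 1 ∷ [])

      one-step : ∀ {x y} → Adj x y → Step x y
      one-step {x} {y} (inj₁ (lo , hi)) = step (off x y) (quo x y) (off-eq x y) (step-lo (off x y) lo) (step-hi (off x y) hi)
      one-step {x} {y} (inj₂ (lo , hi)) = step (- off y x) (- quo y x)
        (turn (pos x) (pos y) (off y x) (quo y x) (off-eq y x)) (step-lo′ (off y x) hi) (step-hi′ (off y x) lo)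

      by-distance : x ≡ y ⊎ Adj x y ⊎ (∃ λ z → Adj x z × Adj z y) → Near x y
      by-distance (inj₁ x≡y) = near (+ 0) (equal (pos y) (pos x) (cong pos (sym x≡y))) lo₀ hi₀
      by-distance (inj₂ (inj₁ (inj₁ (lo , hi)))) =
        near (quo x y) (off-eq x y) (lo₁ (off x y) lo) (hi₁ (off x y) hi)
      by-distance (inj₂ (inj₁ (inj₂ (lo , hi)))) =
        near (- quo y x) (turn (pos x) (pos y) (off y x) (quo y x) (off-eq y x)) (lo₁′ (off y x) hi) (hi₁′ (off y x) lo)
      by-distance (inj₂ (inj₂ (z , xz , zy))) = near (Step.w S + Step.w T)
        (join (pos x) (pos z) (pos y) (Step.d S) (Step.d T) (Step.w S) (Step.w T) (Step.eq S) (Step.eq T))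
        (lo₂ (Step.d S) (Step.d T) (Step.lo S) (Step.lo T)) (hi₂ (Step.d S) (Step.d T) (Step.hi S) (Step.hi T))
        where
        S = one-step xz
        T = one-step zy

    lift : Fin N → ℤ
    lift x = d (distance-two v x)

    lift-inj : ∀ {x y} → lift x ≡ lift y → x ≡ y
    lift-inj {x} {y} e = pos-inj (w Y - w X)
      (link (pos v) (pos x) (pos y) (d X) (d Y) (w X) (w Y) (eq X) (eq Y) e)
      where
      X = distance-two v x
      Y = distance-two v y
      link = farkas₂ Γ 7 (λ n s pv px py c d w w′ →
          px ≈ pv :+ c :+ w :* n ⇒ py ≈ pv :+ d :+ w′ :* n ⇒ c ≈ d ⇒ ⊩ py ≈ px :+ (w′ :- w) :* n)
          (1 ∷ 0 ∷ 1 ∷ 1 ∷ 0 ∷ 0 ∷ 1 ∷ []) (1 ∷ 1 ∷ 0 ∷ 0 ∷ 1 ∷ 1 ∷ [])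

    -- The displacements from v to x, from x to y and from v to y are each at most 2 s in absolute
    -- value and are compatible modulo n; because of n > 6 s they are compatible in ℤ.
    lift-diff : ∀ x y → lift y - lift x ≤ + 2 * s
    lift-diff x y = finish (d X) (d Y) (d D) (w X) (w Y) (w D) (pos v) (pos x) (pos y) (eq X) (eq Y) (eq D) (hi D)
      (cong (_* n) (mult-unique (w D - w Y + w X) n (+ 0) (n≥1 v)
        (low (d X) (d Y) (d D) (w X) (w Y) (w D) (pos v) (pos x) (pos y) (eq X) (eq Y) (eq D) (hi X) (lo Y) (hi D))
        (high (d X) (d Y) (d D) (w X) (w Y) (w D) (pos v) (pos x) (pos y) (eq X) (eq Y) (eq D) (lo X) (hi Y) (lo D))))
      where
      X = distance-two v x
      Y = distance-two v y
      D = distance-two x y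
      low = farkas Γ 9 (λ n s c d e w w′ u pv px py →
          px ≈ pv :+ c :+ w :* n ⇒ py ≈ pv :+ d :+ w′ :* n ⇒ py ≈ px :+ e :+ u :* n ⇒ c ≼ # 2 :* s ⇒
          ⊝ (# 2 :* s) ≼ d ⇒ e ≼ # 2 :* s ⇒ ⊩ (# 0 :- # 1) :* n :+ # 1 ≼ (u :- w′ :+ w) :* n)
          (1 ∷ 1 ∷ 1 ∷ 1 ∷ 1 ∷ 0 ∷ 0 ∷ 1 ∷ 1 ∷ 0 ∷ 0 ∷ 1 ∷ [])

      high = farkas Γ 9 (λ n s c d e w w′ u pv px py →
          px ≈ pv :+ c :+ w :* n ⇒ py ≈ pv :+ d :+ w′ :* n ⇒ py ≈ px :+ e :+ u :* n ⇒
          ⊝ (# 2 :* s) ≼ c ⇒ d ≼ # 2 :* s ⇒ ⊝ (# 2 :* s) ≼ e ⇒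
          ⊩ (u :- w′ :+ w) :* n :+ # 1 ≼ (# 0 :+ # 1) :* n)
          (1 ∷ 1 ∷ 1 ∷ 1 ∷ 0 ∷ 1 ∷ 1 ∷ 0 ∷ 0 ∷ 1 ∷ 0 ∷ 1 ∷ [])

      finish = farkas Γ 9 (λ n s c d e w w′ u pv px py →
          px ≈ pv :+ c :+ w :* n ⇒ py ≈ pv :+ d :+ w′ :* n ⇒ py ≈ px :+ e :+ u :* n ⇒ e ≼ # 2 :* s ⇒
          (u :- w′ :+ w) :* n ≈ # 0 :* n ⇒ ⊩ d :- c ≼ # 2 :* s)
          (1 ∷ 1 ∷ 0 ∷ 1 ∷ 1 ∷ 0 ∷ 0 ∷ 1 ∷ 1 ∷ [])

    bound : + N ≤ + 2 * s + + 7
    bound = ≤-trans (bounded-all (bounded-spread E (λ _ _ → lift-inj)) (λ _ → tt))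
      (total (spread E) (lift-diff (bot E) (top E)))
      where
      E : Extremes (λ _ → ⊤) lift
      E = extremes-of {v = v} (λ _ → yes tt) lift tt

      total = farkas Γ 1 (λ n s l → l ≼ # 2 :* s ⇒ ⊩ l :+ # 1 ≼ # 2 :* s :+ # 7) (1 ∷ 1 ∷ [])

  -- The exceptional block 4 for k = 6

  -- The block 4 s + 1, …, 5 s for n = 12 s + 1.  The vertices v₀, v₃, v₁, v₄, v₂ of a directed
  -- pentagon follow each other around the circle, and the remaining vertices cluster around them.
  module Clusters {N : ℕ} {n : ℤ} (C : Circle N n) (s : ℤ) (s≥1 : + 1 ≤ s) (n≡ : n ≡ + 12 * s + + 1)
    (diam : Circulant.DiamTwo C (+ 4 * s) s) (P : Circulant.Pentagon C (+ 4 * s) s) where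

    open Circle C
    open CircleProperties C
    open Circulant C (+ 4 * s) s
    open Pentagon

    Γ′ : Context
    Γ′ = context (n ∷ s ∷ []) (λ n s → (# 1 ≼ s) ∷ (n ≈ # 12 :* s :+ # 1) ∷ [])
      λ _ → s≥1 , n≡ , tt

    -- Offsets from s to 2 s do not occur: edges and directed paths of two edges measure more than 2
    -- s in either sense, and two edges of opposite directions give an offset below s or above n -
    -- s.
    Allowed : ℤ → Set
    Allowed d = d + + 1 ≤ s ⊎ + 2 * s + + 1 ≤ d

    flip-edge = farkas Γ′ 2 (λ n s d e →
        d :+ e ≈ n ⇒ e ≼ # 4 :* s :+ s ⇒ ⊩ # 2 :* s :+ # 1 ≼ d) (1 ∷ 1 ∷ 0 ∷ 1 ∷ 5 ∷ 0 ∷ 1 ∷ [])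

    small = farkas Γ′ 1 (λ n s d → d ≈ # 0 ⇒ ⊩ d :+ # 1 ≼ s) (1 ∷ 1 ∷ 0 ∷ 1 ∷ [])

    edge-lo = farkas Γ′ 1 (λ n s d → # 4 :* s :+ # 1 ≼ d ⇒ ⊩ # 2 :* s :+ # 1 ≼ d) (1 ∷ 1 ∷ 2 ∷ [])

    path< = farkas Γ′ 2 (λ n s d e →
        d ≼ # 4 :* s :+ s ⇒ e ≼ # 4 :* s :+ s ⇒ ⊩ d :+ e :+ # 1 ≼ n) (1 ∷ 1 ∷ 1 ∷ 2 ∷ 0 ∷ 1 ∷ [])

    path-lo = farkas Γ′ 3 (λ n s d e f →
        # 4 :* s :+ # 1 ≼ d ⇒ # 4 :* s :+ # 1 ≼ e ⇒ f ≈ d :+ e ⇒ ⊩ # 2 :* s :+ # 1 ≼ f)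
        (1 ∷ 0 ∷ 1 ∷ 1 ∷ 1 ∷ 6 ∷ [])

    back-lo = farkas Γ′ 4 (λ n s d e f g →
        d ≼ # 4 :* s :+ s ⇒ e ≼ # 4 :* s :+ s ⇒ f ≈ d :+ e ⇒ g :+ f ≈ n ⇒ ⊩ # 2 :* s :+ # 1 ≼ g)
        (1 ∷ 0 ∷ 1 ∷ 1 ∷ 0 ∷ 1 ∷ 1 ∷ 0 ∷ 0 ∷ 1 ∷ [])

    back-hi = farkas Γ′ 4 (λ n s d e f g →
        # 4 :* s :+ # 1 ≼ d ⇒ # 4 :* s :+ # 1 ≼ e ⇒ f ≈ d :+ e ⇒ g :+ f ≈ n ⇒ ⊩ g :+ # 1 ≼ # 4 :* s)
        (1 ∷ 1 ∷ 0 ∷ 0 ∷ 1 ∷ 1 ∷ 1 ∷ 0 ∷ 1 ∷ [])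

    nonzero = farkas Γ′ 3 (λ n s d e f →
        # 4 :* s :+ # 1 ≼ d ⇒ # 4 :* s :+ # 1 ≼ e ⇒ f ≈ d :+ e ⇒ f ≈ # 0 ⇒ ⊩⊥)
        (1 ∷ 0 ∷ 0 ∷ 1 ∷ 1 ∷ 1 ∷ 8 ∷ [])

    loop = farkas Γ′ 1 (λ n s d → # 4 :* s :+ # 1 ≼ d ⇒ d ≈ # 0 ⇒ ⊩⊥) (1 ∷ 0 ∷ 1 ∷ 4 ∷ [])

    fork-near = farkas Γ′ 3 (λ n s d e f →
        d ≼ # 4 :* s :+ s ⇒ # 4 :* s :+ # 1 ≼ e ⇒ f :+ e ≈ d ⇒ ⊩ f :+ # 1 ≼ s)
        (1 ∷ 1 ∷ 0 ∷ 1 ∷ 1 ∷ [])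

    fork-far = farkas Γ′ 3 (λ n s d e f →
        # 4 :* s :+ # 1 ≼ d ⇒ e ≼ # 4 :* s :+ s ⇒ f :+ e ≈ d :+ n ⇒ ⊩ # 2 :* s :+ # 1 ≼ f)
        (1 ∷ 0 ∷ 1 ∷ 1 ∷ 1 ∷ 9 ∷ 0 ∷ 1 ∷ [])

    off-zero : ∀ {x y} → x ≡ y → off y x ≡ + 0
    off-zero {x} {y} e = trans (cong (off y) e) (off-refl y)

    two-steps : ∀ {x y z} → x ⟶ y → y ⟶ z → off x z ≡ off x y + off y z
    two-steps {x} {y} {z} e f = off-sum x y z (path< (off x y) (off y z) (proj₂ e) (proj₂ f))

    two-steps-back : ∀ {x y z} → x ⟶ y → y ⟶ z → off z x + off x z ≡ n
    two-steps-back {x} {y} {z} e f = off-flip λ z≡x →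
      nonzero (off x y) (off y z) (off x z) (proj₁ e) (proj₁ f) (two-steps e f) (off-zero z≡x)

    forked : ∀ d e f → + 4 * s + + 1 ≤ d × d ≤ + 4 * s + s → + 4 * s + + 1 ≤ e × e ≤ + 4 * s + s →
             f + e ≡ d ⊎ f + e ≡ d + n → Allowed f
    forked d e f (_ , d≤) (e≥ , _) (inj₁ h) = inj₁ (fork-near d e f d≤ e≥ h)
    forked d e f (d≥ , _) (_ , e≤) (inj₂ h) = inj₂ (fork-far d e f d≥ e≤ h)

    allowed : ∀ x y → Allowed (off x y)
    allowed x y = by-distance (diam x y)
      where
      by-distance : x ≡ y ⊎ Adj x y ⊎ (∃ λ z → Adj x z × Adj z y) → Allowed (off x y)
      by-distance (inj₁ x≡y) = inj₁ (small (off x y) (off-zero (sym x≡y)))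
      by-distance (inj₂ (inj₁ (inj₁ e))) = inj₂ (edge-lo (off x y) (proj₁ e))
      by-distance (inj₂ (inj₁ (inj₂ e))) = inj₂ (flip-edge (off x y) (off y x)
        (off-flip λ x≡y → loop (off y x) (proj₁ e) (off-zero x≡y)) (proj₂ e))
      by-distance (inj₂ (inj₂ (z , inj₁ e , inj₁ f))) =
        inj₂ (path-lo (off x z) (off z y) (off x y) (proj₁ e) (proj₁ f) (two-steps e f))
      by-distance (inj₂ (inj₂ (z , inj₂ e , inj₂ f))) =
        inj₂ (back-lo (off y z) (off z x) (off y x) (off x y) (proj₂ f) (proj₂ e) (two-steps f e) (two-steps-back f e))
      by-distance (inj₂ (inj₂ (z , inj₁ e , inj₂ f))) =
        forked (off x z) (off y z) (off x y) e f (off-add x y z)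
      by-distance (inj₂ (inj₂ (z , inj₂ e , inj₁ f))) =
        forked (off z y) (off z x) (off x y) f e
          (subst (λ t → t ≡ off z y ⊎ t ≡ off z y + n) (+-comm (off z x) (off x y)) (off-add z x y))

    next prev : Pentagon → Pentagon
    next Q = rot (rot (rot Q))
    prev Q = rot (rot Q)

    centre : Pentagon → Fin N
    centre Q = v₀ Q

    gap : Pentagon → ℤ
    gap Q = off (centre Q) (centre (next Q))

    gap-lo : ∀ Q → + 2 * s + + 1 ≤ gap Q
    gap-lo Q = back-lo (off (v₃ Q) (v₄ Q)) (off (v₄ Q) (v₀ Q)) (off (v₃ Q) (v₀ Q)) (gap Q)
      (proj₂ (e₃₄ Q)) (proj₂ (e₄₀ Q)) (two-steps (e₃₄ Q) (e₄₀ Q)) (two-steps-back (e₃₄ Q) (e₄₀ Q))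

    gap-hi : ∀ Q → gap Q + + 1 ≤ + 4 * s
    gap-hi Q = back-hi (off (v₃ Q) (v₄ Q)) (off (v₄ Q) (v₀ Q)) (off (v₃ Q) (v₀ Q)) (gap Q)
      (proj₁ (e₃₄ Q)) (proj₁ (e₄₀ Q)) (two-steps (e₃₄ Q) (e₄₀ Q)) (two-steps-back (e₃₄ Q) (e₄₀ Q))

    P₁ = next P
    P₂ = next P₁
    P₃ = next P₂
    P₄ = next P₃

    -- Five gaps between 2 s + 1 and 4 s - 1 add up to a positive multiple of n that is less than 2
    -- n = 24 s + 2.
    circumference : gap P + gap P₁ + gap P₂ + gap P₃ + gap P₄ ≡ n
    circumference = trans closes (trans (cong (_* n) (mult-unique w n (+ 1) (n≥1 (centre P))
        (low w (gap P) (gap P₁) (gap P₂) (gap P₃) (gap P₄) closes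
          (gap-lo P) (gap-lo P₁) (gap-lo P₂) (gap-lo P₃) (gap-lo P₄))
        (high w (gap P) (gap P₁) (gap P₂) (gap P₃) (gap P₄) closes
          (gap-hi P) (gap-hi P₁) (gap-hi P₂) (gap-hi P₃) (gap-hi P₄)))) (*-identityˡ n))
      where
      q : Pentagon → ℤ
      q Q = quo (centre Q) (centre (next Q))

      w : ℤ
      w = - q P - q P₁ - q P₂ - q P₃ - q P₄

      step : ∀ Q → pos (centre (next Q)) ≡ pos (centre Q) + gap Q + q Q * n
      step Q = off-eq (centre Q) (centre (next Q))

      go = farkas₂ Γ′ 15 (λ n s p₀ p₁ p₂ p₃ p₄ d₀ d₁ d₂ d₃ d₄ q₀ q₁ q₂ q₃ q₄ →
          p₁ ≈ p₀ :+ d₀ :+ q₀ :* n ⇒ p₂ ≈ p₁ :+ d₁ :+ q₁ :* n ⇒ p₃ ≈ p₂ :+ d₂ :+ q₂ :* n ⇒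
          p₄ ≈ p₃ :+ d₃ :+ q₃ :* n ⇒ p₀ ≈ p₄ :+ d₄ :+ q₄ :* n ⇒
          ⊩ d₀ :+ d₁ :+ d₂ :+ d₃ :+ d₄ ≈ (⊝ q₀ :- q₁ :- q₂ :- q₃ :- q₄) :* n)
          (1 ∷ 0 ∷ 1 ∷ 0 ∷ 1 ∷ 0 ∷ 1 ∷ 0 ∷ 1 ∷ 0 ∷ 1 ∷ []) (1 ∷ 1 ∷ 0 ∷ 1 ∷ 0 ∷ 1 ∷ 0 ∷ 1 ∷ 0 ∷ 1 ∷ [])

      closes : gap P + gap P₁ + gap P₂ + gap P₃ + gap P₄ ≡ w * n
      closes = go (pos (centre P)) (pos (centre P₁)) (pos (centre P₂)) (pos (centre P₃)) (pos (centre P₄))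
        (gap P) (gap P₁) (gap P₂) (gap P₃) (gap P₄) (q P) (q P₁) (q P₂) (q P₃) (q P₄)
        (step P) (step P₁) (step P₂) (step P₃) (step P₄)

      low = farkas Γ′ 6 (λ n s w d₀ d₁ d₂ d₃ d₄ →
          d₀ :+ d₁ :+ d₂ :+ d₃ :+ d₄ ≈ w :* n ⇒ # 2 :* s :+ # 1 ≼ d₀ ⇒ # 2 :* s :+ # 1 ≼ d₁ ⇒
          # 2 :* s :+ # 1 ≼ d₂ ⇒ # 2 :* s :+ # 1 ≼ d₃ ⇒ # 2 :* s :+ # 1 ≼ d₄ ⇒
          ⊩ (# 1 :- # 1) :* n :+ # 1 ≼ w :* n) (1 ∷ 1 ∷ 1 ∷ 1 ∷ 1 ∷ 1 ∷ 1 ∷ 0 ∷ 10 ∷ [])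

      high = farkas Γ′ 6 (λ n s w d₀ d₁ d₂ d₃ d₄ →
          d₀ :+ d₁ :+ d₂ :+ d₃ :+ d₄ ≈ w :* n ⇒ d₀ :+ # 1 ≼ # 4 :* s ⇒ d₁ :+ # 1 ≼ # 4 :* s ⇒
          d₂ :+ # 1 ≼ # 4 :* s ⇒ d₃ :+ # 1 ≼ # 4 :* s ⇒ d₄ :+ # 1 ≼ # 4 :* s ⇒
          ⊩ w :* n :+ # 1 ≼ (# 1 :+ # 1) :* n) (1 ∷ 1 ∷ 1 ∷ 1 ∷ 1 ∷ 1 ∷ 0 ∷ 1 ∷ 4 ∷ 0 ∷ 2 ∷ [])

    Cluster : Pentagon → Fin N → Set
    Cluster Q x = off (centre Q) x + + 1 ≤ s ⊎ off x (centre Q) + + 1 ≤ s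

    Cluster? : ∀ Q x → Dec (Cluster Q x)
    Cluster? Q x = (off (centre Q) x + + 1 ≤? s) ⊎-dec (off x (centre Q) + + 1 ≤? s)

    -- The offsets from one centre to x and from x to the next add up to a gap below 4 s, so they
    -- cannot both exceed 2 s; by `allowed` one of them is below s.
    between : ∀ Q x → off (centre Q) x + + 1 ≤ gap Q → Cluster Q x ⊎ Cluster (next Q) x
    between Q x lt = go (allowed (centre Q) x) (allowed x (centre (next Q))) (off-add (centre Q) x (centre (next Q)))
      where
      absurd₁ = farkas Γ′ 3 (λ n s d e g →
          # 2 :* s :+ # 1 ≼ d ⇒ # 2 :* s :+ # 1 ≼ e ⇒ g :+ # 1 ≼ # 4 :* s ⇒ d :+ e ≈ g ⇒ ⊩⊥)
          (1 ∷ 0 ∷ 1 ∷ 1 ∷ 1 ∷ [])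

      absurd₂ = farkas Γ′ 3 (λ n s d e g →
          d :+ # 1 ≼ g ⇒ e :+ # 1 ≼ n ⇒ d :+ e ≈ g :+ n ⇒ ⊩⊥) (0 ∷ 1 ∷ 1 ∷ 1 ∷ [])

      go : Allowed (off (centre Q) x) → Allowed (off x (centre (next Q))) →
           off (centre Q) x + off x (centre (next Q)) ≡ gap Q ⊎ off (centre Q) x + off x (centre (next Q)) ≡ gap Q + n →
           Cluster Q x ⊎ Cluster (next Q) x
      go (inj₁ h) _ _ = inj₁ (inj₁ h)
      go _ (inj₁ h) _ = inj₂ (inj₂ h)
      go (inj₂ h) (inj₂ h′) (inj₁ e) =
        ⊥-elim (absurd₁ (off (centre Q) x) (off x (centre (next Q))) (gap Q) h h′ (gap-hi Q) e)
      go (inj₂ _) (inj₂ _) (inj₂ e) =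
        ⊥-elim (absurd₂ (off (centre Q) x) (off x (centre (next Q))) (gap Q) lt (off<n x (centre (next Q))) e)

    cover : ∀ x → Cluster P x ⊎ Cluster P₁ x ⊎ Cluster P₂ x ⊎ Cluster P₃ x ⊎ Cluster P₄ x
    cover x = go (locate P) (locate P₁) (locate P₂) (locate P₃) (locate P₄)
      where
      o : Pentagon → ℤ
      o Q = off (centre Q) x

      locate : ∀ Q → gap Q ≤ o Q ⊎ o Q + + 1 ≤ gap Q
      locate Q = ≤⊎≥ (gap Q) (o Q)

      pass : ∀ Q → gap Q ≤ o Q → o (next Q) ≡ o Q - gap Q
      pass Q le = off-diff (centre Q) (centre (next Q)) x le

      absurd = farkas Γ′ 10 (λ n s o₀ o₁ o₂ o₃ o₄ g₀ g₁ g₂ g₃ g₄ →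
          # 2 :* s :+ # 1 ≼ g₀ ⇒ # 2 :* s :+ # 1 ≼ g₁ ⇒ # 2 :* s :+ # 1 ≼ g₂ ⇒
          # 2 :* s :+ # 1 ≼ g₃ ⇒ # 2 :* s :+ # 1 ≼ g₄ ⇒ o₁ ≈ o₀ :- g₀ ⇒ o₂ ≈ o₁ :- g₁ ⇒
          o₃ ≈ o₂ :- g₂ ⇒ o₄ ≈ o₃ :- g₃ ⇒ o₀ ≈ o₄ :- g₄ ⇒ ⊩⊥)
          (1 ∷ 0 ∷ 1 ∷ 0 ∷ 1 ∷ 0 ∷ 1 ∷ 0 ∷ 1 ∷ 0 ∷ 1 ∷ 1 ∷ 1 ∷ 1 ∷ 1 ∷ 10 ∷ [])

      go : gap P ≤ o P ⊎ o P + + 1 ≤ gap P → gap P₁ ≤ o P₁ ⊎ o P₁ + + 1 ≤ gap P₁ →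
           gap P₂ ≤ o P₂ ⊎ o P₂ + + 1 ≤ gap P₂ → gap P₃ ≤ o P₃ ⊎ o P₃ + + 1 ≤ gap P₃ →
           gap P₄ ≤ o P₄ ⊎ o P₄ + + 1 ≤ gap P₄ →
           Cluster P x ⊎ Cluster P₁ x ⊎ Cluster P₂ x ⊎ Cluster P₃ x ⊎ Cluster P₄ x
      go (inj₂ h) _ _ _ _ = [ inj₁ , inj₂ ∘ inj₁ ]′ (between P x h)
      go _ (inj₂ h) _ _ _ = inj₂ ([ inj₁ , inj₂ ∘ inj₁ ]′ (between P₁ x h))
      go _ _ (inj₂ h) _ _ = inj₂ (inj₂ ([ inj₁ , inj₂ ∘ inj₁ ]′ (between P₂ x h)))
      go _ _ _ (inj₂ h) _ = inj₂ (inj₂ (inj₂ (between P₃ x h)))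
      go _ _ _ _ (inj₂ h) = [ inj₂ ∘ inj₂ ∘ inj₂ ∘ inj₂ , inj₁ ]′ (between P₄ x h)
      go (inj₁ h₀) (inj₁ h₁) (inj₁ h₂) (inj₁ h₃) (inj₁ h₄) = ⊥-elim (absurd (o P) (o P₁) (o P₂) (o P₃) (o P₄)
        (gap P) (gap P₁) (gap P₂) (gap P₃) (gap P₄)
        (gap-lo P) (gap-lo P₁) (gap-lo P₂) (gap-lo P₃) (gap-lo P₄)
        (pass P h₀) (pass P₁ h₁) (pass P₂ h₂) (pass P₃ h₃) (pass P₄ h₄))

    -- Clusters are measured from the centre of the preceding one.
    key : Pentagon → Fin N → ℤ
    key Q = off (centre (prev Q))

    key-range : ∀ Q {x} → Cluster Q x → gap (prev Q) - s + + 1 ≤ key Q x × key Q x + + 1 ≤ gap (prev Q) + s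
    key-range Q {x} = go (off-add (centre (prev Q)) (centre Q) x) (off-add (centre (prev Q)) x (centre Q))
      where
      lo₁ = farkas Γ′ 3 (λ n s g d k →
          g :+ d ≈ k ⇒ # 0 ≼ d ⇒ ⊩ g :- s :+ # 1 ≼ k) (1 ∷ 1 ∷ 1 ∷ 0 ∷ 1 ∷ [])

      hi₁ = farkas Γ′ 3 (λ n s g d k →
          g :+ d ≈ k ⇒ d :+ # 1 ≼ s ⇒ ⊩ k :+ # 1 ≼ g :+ s) (1 ∷ 1 ∷ 0 ∷ 1 ∷ [])

      absurd₁ = farkas Γ′ 3 (λ n s g d k →
          g :+ d ≈ k :+ n ⇒ d :+ # 1 ≼ s ⇒ # 0 ≼ k ⇒ g :+ # 1 ≼ # 4 :* s ⇒ ⊩⊥)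
          (1 ∷ 1 ∷ 1 ∷ 0 ∷ 1 ∷ 7 ∷ 0 ∷ 1 ∷ [])

      lo₂ = farkas Γ′ 3 (λ n s g d k →
          k :+ d ≈ g ⇒ d :+ # 1 ≼ s ⇒ ⊩ g :- s :+ # 1 ≼ k) (1 ∷ 1 ∷ 0 ∷ 1 ∷ [])

      hi₂ = farkas Γ′ 3 (λ n s g d k →
          k :+ d ≈ g ⇒ # 0 ≼ d ⇒ ⊩ k :+ # 1 ≼ g :+ s) (1 ∷ 1 ∷ 1 ∷ 0 ∷ 1 ∷ [])

      absurd₂ = farkas Γ′ 3 (λ n s g d k →
          k :+ d ≈ g :+ n ⇒ d :+ # 1 ≼ s ⇒ k :+ # 1 ≼ n ⇒ # 2 :* s :+ # 1 ≼ g ⇒ ⊩⊥)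
          (1 ∷ 1 ∷ 1 ∷ 0 ∷ 1 ∷ 1 ∷ [])

      g = gap (prev Q)
      k = key Q x
      d = off (centre Q) x
      d′ = off x (centre Q)

      go : g + d ≡ k ⊎ g + d ≡ k + n → k + d′ ≡ g ⊎ k + d′ ≡ g + n → Cluster Q x →
           g - s + + 1 ≤ k × k + + 1 ≤ g + s
      go (inj₁ e) _ (inj₁ h) = lo₁ g d k e (off≥0 (centre Q) x) , hi₁ g d k e h
      go (inj₂ e) _ (inj₁ h) = ⊥-elim (absurd₁ g d k e h (off≥0 (centre (prev Q)) x) (gap-hi (prev Q)))
      go _ (inj₁ e) (inj₂ h) = lo₂ g d′ k e h , hi₂ g d′ k e (off≥0 x (centre Q))
      go _ (inj₂ e) (inj₂ h) = ⊥-elim (absurd₂ g d′ k e h (off<n (centre (prev Q)) x) (gap-lo (prev Q)))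

    -- The forbidden offsets are jumped over twice: the offset from the centre of Q to y is at least
    -- s + 2, hence at least 2 s + 1; this makes the offset from x to y at least s + 2, hence again
    -- at least 2 s + 1.
    separated : ∀ Q {x y} → Cluster Q x → Cluster (next Q) y →
                + 2 * s + + 1 ≤ key (next Q) y - (key Q x - gap (prev Q))
    separated Q {x} {y} x∈ y∈ = subst (+ 2 * s + + 1 ≤_) distance
        (again (off x y) (key (next Q) y) (key Q x) (gap (prev Q)) distance far x-hi (allowed x y))
      where
      x-lo = proj₁ (key-range Q x∈)
      x-hi = proj₂ (key-range Q x∈)
      y-lo = proj₁ (key-range (next Q) y∈)
      y-hi = proj₂ (key-range (next Q) y∈)

      far₁ = farkas Γ′ 2 (λ n s k g →
          g :- s :+ # 1 ≼ k ⇒ # 2 :* s :+ # 1 ≼ g ⇒ k :+ # 1 ≼ s ⇒ ⊩⊥) (1 ∷ 1 ∷ 1 ∷ [])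

      far : + 2 * s + + 1 ≤ key (next Q) y
      far = [ (λ h → ⊥-elim (far₁ (key (next Q) y) (gap Q) y-lo (gap-lo Q) h)) , id ]′ (allowed (centre Q) y)

      compose = farkas₂ Γ′ 10 (λ n s pc pc′ px py g k l q q′ q″ →
          pc′ ≈ pc :+ g :+ q :* n ⇒ px ≈ pc :+ k :+ q′ :* n ⇒ py ≈ pc′ :+ l :+ q″ :* n ⇒
          ⊩ py ≈ px :+ (l :- (k :- g)) :+ (q :+ q″ :- q′) :* n)
          (1 ∷ 1 ∷ 0 ∷ 0 ∷ 1 ∷ 1 ∷ []) (1 ∷ 0 ∷ 1 ∷ 1 ∷ 0 ∷ 0 ∷ 1 ∷ [])

      nonneg = farkas Γ′ 3 (λ n s l k g →
          # 2 :* s :+ # 1 ≼ l ⇒ k :+ # 1 ≼ g :+ s ⇒ ⊩ # 0 ≼ l :- (k :- g)) (1 ∷ 1 ∷ 1 ∷ 1 ∷ [])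

      below = farkas Γ′ 4 (λ n s l k g g′ →
          l :+ # 1 ≼ g′ :+ s ⇒ g′ :+ # 1 ≼ # 4 :* s ⇒ g :- s :+ # 1 ≼ k ⇒
          ⊩ l :- (k :- g) :+ # 1 ≼ n) (1 ∷ 1 ∷ 1 ∷ 1 ∷ 6 ∷ 0 ∷ 1 ∷ [])

      distance : off x y ≡ key (next Q) y - (key Q x - gap (prev Q))
      distance = off-unique _ (quo c′ c + quo c y - quo c′ x)
        (compose (pos c′) (pos c) (pos x) (pos y) (gap (prev Q)) (key Q x) (key (next Q) y)
          (quo c′ c) (quo c′ x) (quo c y) (off-eq c′ c) (off-eq c′ x) (off-eq c y))
        (nonneg (key (next Q) y) (key Q x) (gap (prev Q)) far x-hi)
        (below (key (next Q) y) (key Q x) (gap (prev Q)) (gap Q) y-hi (gap-hi Q) x-lo)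
        where
        c = centre Q
        c′ = centre (prev Q)

      close = farkas Γ′ 4 (λ n s d l k g →
          d ≈ l :- (k :- g) ⇒ # 2 :* s :+ # 1 ≼ l ⇒ k :+ # 1 ≼ g :+ s ⇒ d :+ # 1 ≼ s ⇒ ⊩⊥)
          (1 ∷ 1 ∷ 1 ∷ 0 ∷ 1 ∷ [])

      again : ∀ d l k g → d ≡ l - (k - g) → + 2 * s + + 1 ≤ l → k + + 1 ≤ g + s → Allowed d → + 2 * s + + 1 ≤ d
      again d l k g e h h′ (inj₁ h″) = ⊥-elim (close d l k g e h h′ h″)
      again d l k g e h h′ (inj₂ h″) = h″

    cluster-extremes : ∀ Q → Extremes (Cluster Q) (key Q)
    cluster-extremes Q = extremes-of {v = centre Q} (Cluster? Q) (key Q) (inj₁ (small (off (centre Q) (centre Q)) (off-refl (centre Q))))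

    lowest highest : Pentagon → ℤ
    lowest Q = key Q (bot (cluster-extremes Q))
    highest Q = key Q (top (cluster-extremes Q))

    cluster-bounded : ∀ Q → Bounded (Cluster Q) (highest Q - lowest Q + + 1)
    cluster-bounded Q = bounded-spread (cluster-extremes Q) (λ _ _ → off-inj)

    -- The equations hold by refl, since `prev` and `next` are powers of `rot` and its fifth power
    -- is the identity by η. They let the five instances be stated with the names P, P₁, ....
    spacing : ∀ O Q R → O ≡ prev Q → R ≡ next Q → + 2 * s + + 1 ≤ lowest R - (highest Q - gap O)
    spacing _ Q _ refl refl = separated Q (top∈ (cluster-extremes Q)) (bot∈ (cluster-extremes (next Q)))

    bound : + N ≤ + 2 * s + + 7
    bound = ≤-trans (bounded-all
        (bounded-⊎ (λ _ → id) (cluster-bounded P)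
        (bounded-⊎ (λ _ → id) (cluster-bounded P₁)
        (bounded-⊎ (λ _ → id) (cluster-bounded P₂)
        (bounded-⊎ (λ _ → id) (cluster-bounded P₃) (cluster-bounded P₄))))) cover)
      (total (lowest P) (lowest P₁) (lowest P₂) (lowest P₃) (lowest P₄)
             (highest P) (highest P₁) (highest P₂) (highest P₃) (highest P₄)
             (gap P) (gap P₁) (gap P₂) (gap P₃) (gap P₄) circumference
             (spacing P₄ P P₁ refl refl) (spacing P P₁ P₂ refl refl) (spacing P₁ P₂ P₃ refl refl)
             (spacing P₂ P₃ P₄ refl refl) (spacing P₃ P₄ P refl refl))
      where
      -- Five separations of 2 s + 1 out of n = 12 s + 1 leave 2 s - 4 for the widths: at most 2 s +
      -- 1 vertices.
      total = farkas Γ′ 15 (λ n s l₀ l₁ l₂ l₃ l₄ h₀ h₁ h₂ h₃ h₄ g₀ g₁ g₂ g₃ g₄ →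
          g₀ :+ g₁ :+ g₂ :+ g₃ :+ g₄ ≈ n ⇒ # 2 :* s :+ # 1 ≼ l₁ :- (h₀ :- g₄) ⇒
          # 2 :* s :+ # 1 ≼ l₂ :- (h₁ :- g₀) ⇒ # 2 :* s :+ # 1 ≼ l₃ :- (h₂ :- g₁) ⇒
          # 2 :* s :+ # 1 ≼ l₄ :- (h₃ :- g₂) ⇒ # 2 :* s :+ # 1 ≼ l₀ :- (h₄ :- g₃) ⇒
          ⊩ h₀ :- l₀ :+ # 1 :+ (h₁ :- l₁ :+ # 1 :+ (h₂ :- l₂ :+ # 1 :+ (h₃ :- l₃ :+ # 1 :+ (h₄ :- l₄ :+ # 1)))) ≼ # 2 :* s :+ # 7)
          (1 ∷ 1 ∷ 1 ∷ 1 ∷ 1 ∷ 1 ∷ 1 ∷ 0 ∷ 0 ∷ 1 ∷ [])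

  -- Choosing the analysis for a block

  -- Which analysis applies to the block a + 1, …, a + s is decided by the position of
  -- 3 b and 5 b relative to the multiples of 2 k, where a = b s and n = 2 s k + 1.

  module Block {N : ℕ} {n : ℤ} (C : Circle N n) (s k b a : ℤ) (s≥1 : + 1 ≤ s) (k≥4 : + 4 ≤ k) (b<k : b + + 1 ≤ k)
    (n≡ : n ≡ + 2 * s * k + + 1) (a≡ : a ≡ b * s) (diam : Circulant.DiamTwo C a s) (v : Fin N) where

    open Circle C
    open Circulant C a s

    -- For a certificate k s and b s are unknowns of their own, so comparisons of k and b have to be
    -- multiplied by s beforehand.
    scale : ∀ {x y} → x ≤ y → x * s ≤ y * s
    scale = *-monoʳ-≤-nonNeg s
      where instance _ = nonNegative (≤-trans (+≤+ z≤n) s≥1)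

    k≥4′ : + 4 * s ≤ k * s
    k≥4′ = scale k≥4

    b<k′ : (b + + 1) * s ≤ k * s
    b<k′ = scale b<k

    Γ : Context
    Γ = context (n ∷ s ∷ k ∷ b ∷ a ∷ []) (λ n s k b a → (# 1 ≼ s) ∷ (n ≈ # 2 :* s :* k :+ # 1) ∷ (a ≈ b :* s) ∷ (# 4 :* s ≼ k :* s) ∷ ((b :+ # 1) :* s ≼ k :* s) ∷ [])
      λ _ → s≥1 , n≡ , a≡ , k≥4′ , b<k′ , tt


    pentagon? : Dec Pentagon
    pentagon? = map′
      (λ { (_ , _ , _ , _ , _ , e , f , g , h , i) → pentagon e f g h i })
      (λ { (pentagon e f g h i) → _ , _ , _ , _ , _ , e , f , g , h , i })
      (any? λ x → any? λ y → any? λ z → any? λ u → any? λ w →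
        (x ⟶? y) ×-dec (y ⟶? z) ×-dec (z ⟶? u) ×-dec (u ⟶? w) ×-dec (w ⟶? x))

    closed-pentagon : ∀ {x} → Walk x x 5 0 → Pentagon
    closed-pentagon (fwd e (fwd f (fwd g (fwd h (fwd i stop))))) = pentagon e f g h i

    n>2a+2s = farkas Γ 0 (λ n s k b a →
        ⊩ # 2 :* a :+ # 2 :* s :+ # 1 ≼ n) (1 ∷ 0 ∷ 0 ∷ 1 ∷ 2 ∷ 0 ∷ 0 ∷ 2 ∷ [])

    module NoThirds (b≥2 : + 2 ≤ b) (n≉3a : n ≤ + 3 * a - s + + 3 ⊎ + 3 * a + + 4 * s ≤ n) where

      a≥ = farkas Γ 0 (λ n s k b a →
          # 2 :* s ≼ b :* s ⇒ ⊩ # 2 :* s ≼ a) (1 ∷ 1 ∷ 0 ∷ 0 ∷ 0 ∷ 0 ∷ 1 ∷ [])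

      module U = Unidirectional C a s s≥1 (a≥ (scale b≥2)) n>2a+2s n≉3a diam

      once-lo = farkas Γ 0 (λ n s k b a →
          # 2 :* k :* s ≼ (# 5 :* b :+ # 2) :* s ⇒ ⊩ n ≼ # 5 :* a :+ # 2 :* s :+ # 2)
          (1 ∷ 1 ∷ 0 ∷ 1 ∷ 0 ∷ 0 ∷ 5 ∷ [])

      once-hi = farkas Γ 0 (λ n s k b a →
          (# 5 :* b :+ # 2 :+ # 1) :* s ≼ # 2 :* k :* s ⇒ ⊩ # 5 :* a :+ # 3 :* s :+ # 1 ≼ n)
          (1 ∷ 1 ∷ 0 ∷ 0 ∷ 1 ∷ 5 ∷ [])

      twice-lo = farkas Γ 0 (λ n s k b a →
          # 4 :* k :* s ≼ (# 5 :* b :+ # 2) :* s ⇒ ⊩ # 2 :* n ≼ # 5 :* a :+ # 2 :* s :+ # 2)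
          (1 ∷ 1 ∷ 0 ∷ 2 ∷ 0 ∷ 0 ∷ 5 ∷ [])

      twice-hi = farkas Γ 0 (λ n s k b a →
          (# 5 :* b :+ # 2 :+ # 1) :* s ≼ # 4 :* k :* s ⇒ ⊩ # 5 :* a :+ # 3 :* s :+ # 1 ≼ # 2 :* n)
          (1 ∷ 1 ∷ 0 ∷ 0 ∷ 2 ∷ 5 ∷ [])

      -- As n - 5 a = (2 k - 5 b) s + 1, it matters only whether the integer 2 k - 5 b is at most 2
      -- or at least 3. For 2 n the same works with 4 k - 5 b and remainder 2, the origin of the
      -- last `+ 2`.
      n≉5a : n ≤ + 5 * a + + 2 * s + + 2 ⊎ + 5 * a + + 3 * s + + 1 ≤ n
      n≉5a = [ (λ h → inj₁ (once-lo (scale h))) , (λ h → inj₂ (once-hi (scale h))) ]′ (≤⊎≥ (+ 2 * k) (+ 5 * b + + 2))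

      2n≉5a : + 2 * n ≤ + 5 * a + + 2 * s + + 2 ⊎ + 5 * a + + 3 * s + + 1 ≤ + 2 * n
      2n≉5a = [ (λ h → inj₁ (twice-lo (scale h))) , (λ h → inj₂ (twice-hi (scale h))) ]′ (≤⊎≥ (+ 4 * k) (+ 5 * b + + 2))

      two-arcs = farkas Γ 0 (λ n s k b a →
          (b :+ # 1 :+ # 1) :* s ≼ k :* s ⇒ ⊩ # 2 :* a :+ # 3 :* s ≼ n) (1 ∷ 2 ∷ 1 ∷ 0 ∷ 1 ∷ 2 ∷ [])

      one-arc = farkas₂ Γ 0 (λ n s k b a →
          k :* s ≼ (b :+ # 1) :* s ⇒ ⊩ n ≈ # 2 :* a :+ # 2 :* s :+ # 1)
          (1 ∷ 2 ∷ 0 ∷ 1 ∷ 0 ∷ 0 ∷ 2 ∷ []) (1 ∷ 0 ∷ 0 ∷ 0 ∷ 1 ∷ 2 ∷ 0 ∷ 0 ∷ 2 ∷ [])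

      -- The forward and the backward arc touch for the last block, b = k - 1; for a smaller b they
      -- are more than s apart.
      arcs : + 2 * a + + 3 * s ≤ n ⊎ n ≡ + 2 * a + + 2 * s + + 1
      arcs = [ (λ h → inj₂ (one-arc (scale h))) , (λ h → inj₁ (two-arcs (scale h))) ]′ (≤⊎≥ k (b + + 1))

      no-5-cycle : ¬ Pentagon → ∀ {x y z u w} → Adj x y → Adj y z → Adj z u → Adj u w → Adj w x → ⊥
      no-5-cycle none (inj₁ e) f g h i = none (U.orient e f g h i)
      no-5-cycle none (inj₂ e) f g h i = none (U.orient e (Adj-sym i) (Adj-sym h) (Adj-sym g) (Adj-sym f))

      bound : Dec Pentagon → + N ≤ + 2 * s + + 7
      bound (yes P)   = U.Blowup.bound n≉5a 2n≉5a P
      bound (no none) = Bipartite.bound C a s s≥1 (a≥ (scale b≥2)) arcs diam (no-5-cycle none) v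

    module Thirds (b≥2 : + 2 ≤ b) where
      b≥2′ : + 2 * s ≤ b * s
      b≥2′ = scale b≥2

      Γ′ : Context
      Γ′ = context (n ∷ s ∷ k ∷ b ∷ a ∷ []) (λ n s k b a → (# 1 ≼ s) ∷ (n ≈ # 2 :* s :* k :+ # 1) ∷ (a ≈ b :* s) ∷ (# 4 :* s ≼ k :* s) ∷ ((b :+ # 1) :* s ≼ k :* s) ∷ (# 2 :* s ≼ b :* s) ∷ [])
        λ _ → s≥1 , n≡ , a≡ , k≥4′ , b<k′ , b≥2′ , tt


      a≥ = farkas Γ′ 0 (λ n s k b a → ⊩ # 2 :* s ≼ a) (1 ∷ 0 ∷ 0 ∷ 0 ∷ 0 ∷ 1 ∷ 0 ∷ 0 ∷ 1 ∷ [])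

      lo-50 = farkas Γ′ 0 (λ n s k b a →
          n ≼ # 3 :* a :+ # 2 :* s :+ # 1 ⇒
          ⊩ # 1 :* n :+ # 1 ≼ # 5 :* (a :+ # 1) :- # 0 :* (a :+ s))
          (3 ∷ 5 ∷ 6 ∷ 0 ∷ 2 ∷ 0 ∷ 0 ∷ 4 ∷ [])

      hi-50 = farkas Γ′ 0 (λ n s k b a →
          # 5 :* a :+ # 5 :* s :+ # 1 ≼ # 2 :* n ⇒
          ⊩ # 5 :* (a :+ s) :- # 0 :* (a :+ # 1) :+ # 1 ≼ (# 1 :+ # 1) :* n) (1 ∷ 1 ∷ [])

      no-50 : n ≤ + 3 * a + + 2 * s + + 1 → + 5 * a + + 5 * s + + 1 ≤ + 2 * n → ∀ {x} → ¬ Walk x x 5 0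
      no-50 h h′ = no-closed (+ 1) (lo-50 h) (hi-50 h′)

      tripartite : n ≡ + 3 * a + + 1 ⊎ n ≡ + 3 * a + s + + 1 ⊎ n ≡ + 3 * a + + 2 * s + + 1 →
                   + 2 * a + + 3 * s ≤ n → + 3 * a + + 1 ≤ n → n ≤ + 3 * a + + 2 * s + + 1 →
                   (∀ {x} → ¬ Walk x x 5 0) → + N ≤ + 2 * s + + 7
      tripartite e h₁ h₂ h₃ none = Tripartite.bound C a s s≥1 a≥ h₁ h₂ h₃ diam none v e

      n≡₂ = farkas₂ Γ′ 0 (λ n s k b a →
          # 2 :* k :* s ≈ (# 3 :* b :+ # 2) :* s ⇒ ⊩ n ≈ # 3 :* a :+ # 2 :* s :+ # 1)
          (1 ∷ 1 ∷ 0 ∷ 0 ∷ 1 ∷ 0 ∷ 0 ∷ 3 ∷ []) (1 ∷ 0 ∷ 1 ∷ 0 ∷ 0 ∷ 1 ∷ 3 ∷ [])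

      n≡₁ = farkas₂ Γ′ 0 (λ n s k b a →
          # 2 :* k :* s ≈ (# 3 :* b :+ # 1) :* s ⇒ ⊩ n ≈ # 3 :* a :+ s :+ # 1)
          (1 ∷ 1 ∷ 0 ∷ 0 ∷ 1 ∷ 0 ∷ 0 ∷ 3 ∷ []) (1 ∷ 0 ∷ 1 ∷ 0 ∷ 0 ∷ 1 ∷ 3 ∷ [])

      n≡₀ = farkas₂ Γ′ 0 (λ n s k b a →
          # 2 :* k :* s ≈ # 3 :* b :* s ⇒ ⊩ n ≈ # 3 :* a :+ # 1)
          (1 ∷ 1 ∷ 0 ∷ 0 ∷ 1 ∷ 0 ∷ 0 ∷ 3 ∷ []) (1 ∷ 0 ∷ 1 ∷ 0 ∷ 0 ∷ 1 ∷ 3 ∷ [])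

      far₂ = farkas Γ′ 0 (λ n s k b a →
          n ≈ # 3 :* a :+ # 2 :* s :+ # 1 ⇒ ⊩ # 2 :* a :+ # 3 :* s ≼ n)
          (3 ∷ 0 ∷ 2 ∷ 3 ∷ 0 ∷ 1 ∷ 0 ∷ 0 ∷ 2 ∷ [])

      above₂ = farkas Γ′ 0 (λ n s k b a →
          n ≈ # 3 :* a :+ # 2 :* s :+ # 1 ⇒ ⊩ # 3 :* a :+ # 1 ≼ n) (1 ∷ 0 ∷ 1 ∷ 2 ∷ [])

      five₂ = farkas Γ′ 0 (λ n s k b a →
          n ≈ # 3 :* a :+ # 2 :* s :+ # 1 ⇒ ⊩ # 5 :* a :+ # 5 :* s :+ # 1 ≼ # 2 :* n)
          (3 ∷ 0 ∷ 5 ∷ 3 ∷ 0 ∷ 1 ∷ 0 ∷ 0 ∷ 2 ∷ [])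

      bound₂ : + 2 * k ≡ + 3 * b + + 2 → + N ≤ + 2 * s + + 7
      bound₂ e = tripartite (inj₂ (inj₂ n≡′)) (far₂ n≡′) (above₂ n≡′) (≤-reflexive n≡′)
          (no-50 (≤-reflexive n≡′) (five₂ n≡′))
        where n≡′ = n≡₂ (cong (_* s) e)

      b≥3 = farkas Γ′ 0 (λ n s k b a →
          # 2 :* k ≈ # 3 :* b :+ # 1 ⇒ # 4 ≼ k ⇒ ⊩ # 3 ≼ b) (3 ∷ 2 ∷ 1 ∷ [])

      far₁ = farkas Γ′ 0 (λ n s k b a →
          n ≈ # 3 :* a :+ s :+ # 1 ⇒ ⊩ # 2 :* a :+ # 3 :* s ≼ n)
          (3 ∷ 0 ∷ 2 ∷ 1 ∷ 0 ∷ 1 ∷ 0 ∷ 0 ∷ 2 ∷ [])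

      above₁ = farkas Γ′ 0 (λ n s k b a →
          n ≈ # 3 :* a :+ s :+ # 1 ⇒ ⊩ # 3 :* a :+ # 1 ≼ n) (1 ∷ 0 ∷ 1 ∷ 1 ∷ [])

      below₁ = farkas Γ′ 0 (λ n s k b a →
          n ≈ # 3 :* a :+ s :+ # 1 ⇒ ⊩ n ≼ # 3 :* a :+ # 2 :* s :+ # 1) (1 ∷ 1 ∷ 0 ∷ 1 ∷ [])

      five₁ = farkas Γ′ 0 (λ n s k b a →
          n ≈ # 3 :* a :+ s :+ # 1 ⇒ # 3 :* s ≼ b :* s ⇒ ⊩ # 5 :* a :+ # 5 :* s :+ # 1 ≼ # 2 :* n)
          (1 ∷ 1 ∷ 0 ∷ 2 ∷ 0 ∷ 0 ∷ 0 ∷ 0 ∷ 1 ∷ [])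

      bound₁ : + 2 * k ≡ + 3 * b + + 1 → + N ≤ + 2 * s + + 7
      bound₁ e = tripartite (inj₂ (inj₁ n≡′)) (far₁ n≡′) (above₁ n≡′) (below₁ n≡′)
          (no-50 (below₁ n≡′) (five₁ n≡′ (scale (b≥3 e k≥4))))
        where n≡′ = n≡₁ (cong (_* s) e)

      far₀ = farkas Γ′ 0 (λ n s k b a →
          n ≈ # 3 :* a :+ # 1 ⇒ # 3 :* s ≼ b :* s ⇒ ⊩ # 2 :* a :+ # 3 :* s ≼ n)
          (1 ∷ 1 ∷ 0 ∷ 1 ∷ 0 ∷ 0 ∷ 0 ∷ 0 ∷ 1 ∷ [])

      below₀ = farkas Γ′ 0 (λ n s k b a →
          n ≈ # 3 :* a :+ # 1 ⇒ ⊩ n ≼ # 3 :* a :+ # 2 :* s :+ # 1) (1 ∷ 1 ∷ 0 ∷ 2 ∷ [])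

      five₀ = farkas Γ′ 0 (λ n s k b a →
          n ≈ # 3 :* a :+ # 1 ⇒ # 5 :* s ≼ b :* s ⇒ ⊩ # 5 :* a :+ # 5 :* s :+ # 1 ≼ # 2 :* n)
          (1 ∷ 1 ∷ 0 ∷ 2 ∷ 0 ∷ 0 ∷ 0 ∷ 0 ∷ 1 ∷ [])

      b≥3₀ = farkas Γ′ 0 (λ n s k b a → # 2 :* k ≈ # 3 :* b ⇒ # 4 ≼ k ⇒ ⊩ # 3 ≼ b) (3 ∷ 2 ∷ 1 ∷ [])

      k≤4 = farkas Γ′ 0 (λ n s k b a → # 2 :* k ≈ # 3 :* b ⇒ b ≼ # 3 ⇒ ⊩ k ≼ # 4) (2 ∷ 3 ∷ 1 ∷ [])

      k≥5 = farkas Γ′ 0 (λ n s k b a → # 2 :* k ≈ # 3 :* b ⇒ # 3 ≼ b ⇒ ⊩ # 5 ≼ k) (2 ∷ 3 ∷ 0 ∷ 1 ∷ [])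

      clash = farkas Γ′ 0 (λ n s k b a → # 5 ≼ k ⇒ k ≼ # 4 ⇒ ⊩⊥) (1 ∷ 1 ∷ [])

      b≥4 : + 2 * k ≡ + 3 * b → + 4 ≤ b
      b≥4 e = [ (λ b≤3 → ⊥-elim (clash (k≥5 e (b≥3₀ e k≥4)) (k≤4 e b≤3))) , id ]′ (≤⊎≥ b (+ 3))

      tripartite₀ : + 2 * k ≡ + 3 * b → (∀ {x} → ¬ Walk x x 5 0) → + N ≤ + 2 * s + + 7
      tripartite₀ e none = tripartite (inj₁ n≡′) (far₀ n≡′ (scale (b≥3₀ e k≥4))) (≤-reflexive (sym n≡′)) (below₀ n≡′) none
        where n≡′ = n≡₀ (cong (_* s) e)

      a≡₄ = farkas₂ Γ′ 0 (λ n s k b a →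
          b :* s ≈ # 4 :* s ⇒ ⊩ a ≈ # 4 :* s)
          (1 ∷ 1 ∷ 0 ∷ 0 ∷ 0 ∷ 0 ∷ 1 ∷ []) (1 ∷ 0 ∷ 1 ∷ 0 ∷ 0 ∷ 0 ∷ 0 ∷ 1 ∷ [])

      n≡₄ = farkas₂ Γ′ 0 (λ n s k b a →
          b :* s ≈ # 4 :* s ⇒ # 2 :* k :* s ≈ # 3 :* b :* s ⇒ ⊩ n ≈ # 12 :* s :+ # 1)
          (1 ∷ 1 ∷ 0 ∷ 3 ∷ 0 ∷ 0 ∷ 1 ∷ []) (1 ∷ 0 ∷ 1 ∷ 0 ∷ 3 ∷ 0 ∷ 0 ∷ 1 ∷ [])

      -- With a turned into a variable, the equation can be matched by refl, which carries the graph
      -- and its pentagon over to the special block.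
      clusters : ∀ a → a ≡ + 4 * s → n ≡ + 12 * s + + 1 → Circulant.DiamTwo C a s → Circulant.Pentagon C a s →
                 + N ≤ + 2 * s + + 7
      clusters _ refl e diam P = Clusters.bound C s s≥1 e diam P

      -- For n = 3 a + 1 five forward edges stay below 2 n once b ≥ 5. Since 3 b = 2 k ≥ 8 and b is
      -- even, the only other case is b = 4 with k = 6, where directed pentagons go to `Clusters`.
      bound₀ : + 2 * k ≡ + 3 * b → + N ≤ + 2 * s + + 7
      bound₀ e = [ (λ b≤4 → at-four (≤-antisym b≤4 (b≥4 e)) pentagon?)
                 , (λ b≥5 → tripartite₀ e (no-50 (below₀ n≡′) (five₀ n≡′ (scale b≥5)))) ]′ (≤⊎≥ b (+ 4))
        where
        n≡′ = n≡₀ (cong (_* s) e)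

        at-four : b ≡ + 4 → Dec Pentagon → + N ≤ + 2 * s + + 7
        at-four b≡4 (yes P)   = clusters a (a≡₄ (cong (_* s) b≡4)) (n≡₄ (cong (_* s) b≡4) (cong (_* s) e)) diam P
        at-four b≡4 (no none) = tripartite₀ e (none ∘ closed-pentagon)

    Γ″ : Context
    Γ″ = context (n ∷ s ∷ k ∷ b ∷ a ∷ []) (λ n s k b a → (# 1 ≼ s) ∷ (n ≈ # 2 :* s :* k :+ # 1) ∷ (a ≈ b :* s) ∷ (# 4 :* s ≼ k :* s) ∷ ((b :+ # 1) :* s ≼ k :* s) ∷ [])
      λ _ → s≥1 , n≡ , a≡ , k≥4′ , b<k′ , tt

    below-third = farkas Γ″ 0 (λ n s k b a →
        (# 2 :* k :+ # 1) :* s ≼ # 3 :* b :* s ⇒ ⊩ n ≼ # 3 :* a :- s :+ # 3)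
        (1 ∷ 1 ∷ 0 ∷ 1 ∷ 0 ∷ 0 ∷ 3 ∷ [])

    above-third = farkas Γ″ 0 (λ n s k b a →
        (# 3 :* b :+ # 3 :+ # 1) :* s ≼ # 2 :* k :* s ⇒ ⊩ # 3 :* a :+ # 4 :* s ≼ n)
        (1 ∷ 1 ∷ 0 ∷ 0 ∷ 1 ∷ 3 ∷ [])

    -- Here n - 3 a = (2 k - 3 b) s + 1. For 2 k - 3 b negative or at least 4 this avoids the
    -- lengths of (4, 1)-walks; the values 0, 1 and 2 are the three tripartite shapes, and 3 is the
    -- bad block.
    large : + 2 ≤ b → ¬ + 2 * k ≡ + 3 * b + + 3 → + N ≤ + 2 * s + + 7
    large b≥2 ≢3 = go (≤⊎≥ (+ 3 * b) (+ 2 * k)) (≤⊎≥ (+ 2 * k) (+ 3 * b + + 3))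
      where
      nonneg = farkas Γ″ 0 (λ n s k b a →
          # 3 :* b ≼ # 2 :* k ⇒ ⊩ # 0 ≼ # 2 :* k :- # 3 :* b) (1 ∷ 1 ∷ [])

      at-most = farkas Γ″ 0 (λ n s k b a →
          # 2 :* k ≼ # 3 :* b :+ # 3 ⇒ ⊩ # 2 :* k :- # 3 :* b ≼ # 3) (1 ∷ 1 ∷ [])

      restore = farkas₂ Γ″ 1 (λ n s k b a x →
          # 2 :* k :- # 3 :* b ≈ x ⇒ ⊩ # 2 :* k ≈ # 3 :* b :+ x) (1 ∷ 1 ∷ []) (1 ∷ 0 ∷ 1 ∷ [])

      open Thirds b≥2
      open NoThirds b≥2 using () renaming (bound to no-thirds)

      exact : ∀ x → + 2 * k - + 3 * b ≡ x → + 0 ≤ x → x ≤ + 3 → + N ≤ + 2 * s + + 7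
      exact (+ 0) e _ _ = bound₀ (trans (restore (+ 0) e) (+-identityʳ (+ 3 * b)))
      exact (+ 1) e _ _ = bound₁ (restore (+ 1) e)
      exact (+ 2) e _ _ = bound₂ (restore (+ 2) e)
      exact (+ 3) e _ _ = contradiction (restore (+ 3) e) ≢3
      exact (+ suc (suc (suc (suc _)))) _ _ (+≤+ (s≤s (s≤s (s≤s ()))))

      go : + 3 * b ≤ + 2 * k ⊎ + 2 * k + + 1 ≤ + 3 * b → + 2 * k ≤ + 3 * b + + 3 ⊎ + 3 * b + + 3 + + 1 ≤ + 2 * k →
           + N ≤ + 2 * s + + 7
      go (inj₂ h) _ = no-thirds (inj₁ (below-third (scale h))) pentagon?
      go (inj₁ _) (inj₂ h) = no-thirds (inj₂ (above-third (scale h))) pentagon?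
      go (inj₁ h) (inj₁ h′) = exact (+ 2 * k - + 3 * b) refl (nonneg h) (at-most h′)

    n>6s = farkas Γ″ 0 (λ n s k b a → ⊩ # 6 :* s :+ # 1 ≼ n) (1 ∷ 2 ∷ 0 ∷ 1 ∷ 0 ∷ 0 ∷ 2 ∷ [])

    short : ∀ a → a ≡ + 0 → Circulant.DiamTwo C a s → + N ≤ + 2 * s + + 7
    short _ refl diam = ShortArc.bound C s s≥1 n>6s diam v

    bound : b ≡ + 0 ⊎ (+ 2 ≤ b × ¬ + 2 * k ≡ + 3 * b + + 3) → + N ≤ + 2 * s + + 7
    bound (inj₁ b≡0)        = short a (trans a≡ (cong (_* s) b≡0)) diam
    bound (inj₂ (b≥2 , ≢3)) = large b≥2 ≢3

  -- From subsets of Fin n to points on a circle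

  <⇒+1≤ : ∀ {i j} → i ℕ.< j → + i + + 1 ≤ + j
  <⇒+1≤ {i} {j} i<j = subst (_≤ + j) (+-comm (+ 1) (+ i)) (+≤+ i<j)

  circle : ∀ {N} m (pos : Fin N → ℤ) → (∀ {x y} w → pos y ≡ pos x + w * + suc m → x ≡ y) → Circle N (+ suc m)
  circle m pos inj = record
    { pos     = pos
    ; off     = λ x y → + ((pos y - pos x) %ℕ suc m)
    ; quo     = λ x y → (pos y - pos x) /ℕ suc m
    ; off≥0   = λ _ _ → +≤+ z≤n
    ; off<n   = λ x y → <⇒+1≤ (n%ℕd<d (pos y - pos x) (suc m))
    ; off-eq  = λ x y → split (pos x) (pos y) (+ ((pos y - pos x) %ℕ suc m)) (((pos y - pos x) /ℕ suc m) * + suc m)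
                            (a≡a%ℕn+[a/ℕn]*n (pos y - pos x) (suc m))
    ; pos-inj = inj
    }
    where
    restore = farkas₂ ∅ 2 (λ p q → ⊩ q ≈ p :+ (q :- p)) (1 ∷ []) (1 ∷ [])

    split : ∀ p q d e → q - p ≡ d + e → q ≡ p + d + e
    split p q d e h = trans (restore p q) (trans (cong (λ t → p + t) h) (sym (+-assoc p d e)))

  -- Relabels the vertex set of a subgraph by Fin N, the form in which the geometric bounds are
  -- stated.
  record Enumeration {n : ℕ} (V : Subset n) : Set where
    field
      elem      : Fin Subset.∣ V ∣ → Fin n
      elem-inj  : ∀ {i j} → elem i ≡ elem j → i ≡ j
      elem∈     : ∀ i → elem i Subset.∈ V
      index     : ∀ {x} → x Subset.∈ V → ∃ λ i → elem i ≡ x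

  enumerate : ∀ {n} (V : Subset n) → Enumeration V
  enumerate Vec.[] = record
    { elem = λ () ; elem-inj = λ { {()} } ; elem∈ = λ () ; index = λ () }
  enumerate (outside Vec.∷ V) = record
    { elem     = Fin.suc ∘ elem
    ; elem-inj = elem-inj ∘ Fin.suc-injective
    ; elem∈    = Vec.there ∘ elem∈
    ; index    = λ { (Vec.there x∈V) → let i , e = index x∈V in i , cong Fin.suc e }
    }
    where open Enumeration (enumerate V)
  enumerate (inside Vec.∷ V) = record
    { elem     = λ { Fin.zero → Fin.zero ; (Fin.suc i) → Fin.suc (elem i) }
    ; elem-inj = λ { {Fin.zero} {Fin.zero} _ → refl
                   ; {Fin.suc _} {Fin.suc _} e → cong Fin.suc (elem-inj (Fin.suc-injective e)) }
    ; elem∈    = λ { Fin.zero → Vec.here ; (Fin.suc i) → Vec.there (elem∈ i) }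
    ; index    = λ { Vec.here → Fin.zero , refl
                   ; (Vec.there x∈V) → let i , e = index x∈V in Fin.suc i , cong Fin.suc e }
    }
    where open Enumeration (enumerate V)

  diffMod-eq : ∀ m (x y : Fin (suc m)) → ∃ λ w → + diffMod m x y ≡ + toℕ x - + toℕ y + w * + suc m
  diffMod-eq m x y = + 1 - + q , go (+ toℕ x) (+ toℕ y) (+ suc m) (+ r) (+ (suc m ℕ.∸ toℕ y)) (+ q)
      (cong +_ (ℕ.m∸n+n≡m (ℕ.<⇒≤ (Fin.toℕ<n y))))
      (trans (cong +_ (ℕ.m≡m%n+[m/n]*n t (suc m))) (cong (λ u → + r + u) (pos-* q (suc m))))
    where
    t = toℕ x ℕ.+ (suc m ℕ.∸ toℕ y)
    q = t ℕ./ suc m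
    r = diffMod m x y
    go = farkas₂ ∅ 6 (λ x y n r z q →
        z :+ y ≈ n ⇒ x :+ z ≈ r :+ q :* n ⇒ ⊩ r ≈ x :- y :+ (# 1 :- q) :* n)
        (1 ∷ 0 ∷ 1 ∷ 1 ∷ []) (1 ∷ 1 ∷ 0 ∷ 0 ∷ 1 ∷ [])

  diffMod< : ∀ m (x y : Fin (suc m)) → + diffMod m x y + + 1 ≤ + suc m
  diffMod< m x y = <⇒+1≤ (ℕ.m%n<n (toℕ x ℕ.+ (suc m ℕ.∸ toℕ y)) (suc m))

  toℕ-mod-inj : ∀ m {x y : Fin (suc m)} w → + toℕ y ≡ + toℕ x + w * + suc m → x ≡ y
  toℕ-mod-inj m {x} {y} w e = Fin.toℕ-injective (sym (+-injective (trans e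
      (trans (cong (λ u → + toℕ x + u * + suc m) w≡0) (+-identityʳ (+ toℕ x))))))
    where
    lo = farkas ∅ 4 (λ x y n w →
        y ≈ x :+ w :* n ⇒ x :+ # 1 ≼ n ⇒ # 0 ≼ y ⇒ ⊩ (# 0 :- # 1) :* n :+ # 1 ≼ w :* n)
        (1 ∷ 1 ∷ 1 ∷ 1 ∷ [])

    hi = farkas ∅ 4 (λ x y n w →
        y ≈ x :+ w :* n ⇒ y :+ # 1 ≼ n ⇒ # 0 ≼ x ⇒ ⊩ w :* n :+ # 1 ≼ (# 0 :+ # 1) :* n)
        (1 ∷ 1 ∷ 1 ∷ 0 ∷ 1 ∷ [])

    below : ∀ (z : Fin (suc m)) → + toℕ z + + 1 ≤ + suc m
    below z = <⇒+1≤ (Fin.toℕ<n z)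

    w≡0 : w ≡ + 0
    w≡0 = mult-unique w (+ suc m) (+ 0) (+≤+ (s≤s z≤n))
      (lo (+ toℕ x) (+ toℕ y) (+ suc m) w e (below x) (+≤+ z≤n))
      (hi (+ toℕ x) (+ toℕ y) (+ suc m) w e (below y) (+≤+ z≤n))

  -- Multiples of blocks by a unit modulo n

  module Colouring (k s : ℕ) (k≥4 : 4 ℕ.≤ k) (s≥1 : 1 ℕ.≤ s) where

    m : ℕ
    m = 2 ℕ.* s ℕ.* k

    n : ℤ
    n = + suc m

    n≡ : n ≡ + 2 * + s * + k + + 1
    n≡ = trans (+-comm (+ 1) (+ m)) (cong (_+ + 1) (trans (pos-* (2 ℕ.* s) k) (cong (_* + k) (pos-* 2 s))))

    -- Missing among the blocks are block 1, where a < 2 s, and the one with n = 3 (a + s) + 1.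
    GoodBlock : ℤ → Set
    GoodBlock b = b ≡ + 0 ⊎ (+ 2 ≤ b × ¬ + 2 * + k ≡ + 3 * b + + 3)

    -- The differences with P are contained in ± c times the block b, for a unit c modulo n.
    record Scaled (P : ℕ → Set) : Set where
      field
        b c ν t  : ℤ
        b≥0      : + 0 ≤ b
        b<k      : b + + 1 ≤ + k
        good     : GoodBlock b
        inverse  : ν * c ≡ + 1 + t * n
        in-block : ∀ d → P d → ∃₂ λ e w → (b * + s + + 1 ≤ e × e ≤ b * + s + + s) ×
                   (+ d ≡ c * e + w * n ⊎ + d ≡ - (c * e) + w * n)

    module Bound {P} (S : Scaled P) {N : ℕ} (f : Fin N → Fin (suc m)) (f-inj : ∀ {x y} → f x ≡ f y → x ≡ y)
      (A : Fin (suc m) → Fin (suc m) → Set) (A⇒P : ∀ {x y} → A x y → P (diffMod m x y) ⊎ P (diffMod m y x))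
      (diam : ∀ x y → x ≡ y ⊎ A (f x) (f y) ⊎ ∃ λ z → A (f x) (f z) × A (f z) (f y)) where
      open Scaled S

      -- Multiplication by ν cancels c modulo n, so a difference ± c e becomes ± e and the class
      -- becomes a plain block.
      p : Fin N → ℤ
      p x = ν * + toℕ (f x)

      unscale = farkas₂ ∅ 5 (λ ν x y w n →
          ν :* y ≈ ν :* x :+ w :* n ⇒ ⊩ ν :* y :- ν :* x ≈ w :* n) (1 ∷ 1 ∷ []) (1 ∷ 0 ∷ 1 ∷ [])

      recover : ∀ ν c t x y w n → ν * c ≡ + 1 + t * n → ν * y ≡ ν * x + w * n → y ≡ x + (c * w - t * (y - x)) * n
      recover ν c t x y w n h e = trans (start c t x y n) (trans (cong (λ u → x + (u * (y - x) - t * (y - x) * n)) (sym h))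
        (trans (middle ν c t x y n) (trans (cong (λ u → x + (c * u - t * (y - x) * n)) (unscale ν x y w n e)) (end c t x y w n))))
        where
        start = farkas₂ ∅ 5 (λ c t x y n →
            ⊩ y ≈ x :+ ((# 1 :+ t :* n) :* (y :- x) :- t :* (y :- x) :* n)) (1 ∷ []) (1 ∷ [])

        middle = farkas₂ ∅ 6 (λ ν c t x y n →
            ⊩ x :+ (ν :* c :* (y :- x) :- t :* (y :- x) :* n) ≈ x :+ (c :* (ν :* y :- ν :* x) :- t :* (y :- x) :* n))
            (1 ∷ []) (1 ∷ [])

        end = farkas₂ ∅ 6 (λ c t x y w n →
            ⊩ x :+ (c :* (w :* n) :- t :* (y :- x) :* n) ≈ x :+ (c :* w :- t :* (y :- x)) :* n)
            (1 ∷ []) (1 ∷ [])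

      C : Circle N n
      C = circle m p λ {x} {y} w e → f-inj (toℕ-mod-inj m (c * w - t * (+ toℕ (f y) - + toℕ (f x)))
        (recover ν c t (+ toℕ (f x)) (+ toℕ (f y)) w n inverse e))

      a : ℤ
      a = b * + s

      open Circle C using (off)
      open CircleProperties C using (off-unique)
      open Circulant C a (+ s)

      expand : ∀ ν d x y w n → d ≡ x - y + w * n → ν * x ≡ ν * y + ν * d + (- ν * w) * n
      expand ν d x y w n h = trans (start ν x y w n) (cong (λ u → ν * y + ν * u + (- ν * w) * n) (sym h))
        where
        start = farkas₂ ∅ 5 (λ ν x y w n →
            ⊩ ν :* x ≈ ν :* y :+ ν :* (x :- y :+ w :* n) :+ ⊝ ν :* w :* n) (1 ∷ []) (1 ∷ [])

      forward : ∀ ν c t e d x y w w′ n → ν * c ≡ + 1 + t * n → d ≡ c * e + w * n → d ≡ x - y + w′ * n →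
                ν * x ≡ ν * y + e + (t * e + ν * w - ν * w′) * n
      forward ν c t e d x y w w′ n h h′ h″ = trans (expand ν d x y w′ n h″)
        (trans (cong (λ u → ν * y + ν * u + (- ν * w′) * n) h′) (trans (middle ν c e y w w′ n)
        (trans (cong (λ u → ν * y + (u * e + ν * w * n) + (- ν * w′) * n) h) (end ν t e y w w′ n))))
        where
        middle = farkas₂ ∅ 7 (λ ν c e y w w′ n →
            ⊩ ν :* y :+ ν :* (c :* e :+ w :* n) :+ ⊝ ν :* w′ :* n ≈ ν :* y :+ (ν :* c :* e :+ ν :* w :* n) :+ ⊝ ν :* w′ :* n)
            (1 ∷ []) (1 ∷ [])

        end = farkas₂ ∅ 7 (λ ν t e y w w′ n →
            ⊩ ν :* y :+ ((# 1 :+ t :* n) :* e :+ ν :* w :* n) :+ ⊝ ν :* w′ :* n ≈ ν :* y :+ e :+ (t :* e :+ ν :* w :- ν :* w′) :* n)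
            (1 ∷ []) (1 ∷ [])

      flip-sign = farkas₂ ∅ 7 (λ d x y z w w′ n →
          d ≈ ⊝ z :+ w :* n ⇒ d ≈ x :- y :+ w′ :* n ⇒ ⊩ ⊝ d ≈ z :+ ⊝ w :* n)
          (1 ∷ 0 ∷ 0 ∷ 0 ∷ 1 ∷ []) (1 ∷ 0 ∷ 0 ∷ 1 ∷ [])

      flip-diff = farkas₂ ∅ 5 (λ d x y w′ n →
          d ≈ x :- y :+ w′ :* n ⇒ ⊩ ⊝ d ≈ y :- x :+ ⊝ w′ :* n) (1 ∷ 0 ∷ 1 ∷ []) (1 ∷ 1 ∷ [])

      e≥0 = farkas ∅ 2 (λ e β → # 0 ≼ β ⇒ β :+ # 1 ≼ e ⇒ ⊩ # 0 ≼ e) (1 ∷ 1 ∷ 1 ∷ [])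

      e<n = farkas ∅ 5 (λ e b s k n →
          n ≈ # 2 :* s :* k :+ # 1 ⇒ e ≼ b :* s :+ s ⇒ (b :+ # 1) :* s ≼ k :* s ⇒ # 0 ≼ k :* s ⇒
          ⊩ e :+ # 1 ≼ n) (1 ∷ 1 ∷ 1 ∷ 1 ∷ 0 ∷ 1 ∷ [])

      b*s≥0 : + 0 ≤ b * + s
      b*s≥0 = *-monoʳ-≤-nonNeg (+ s) b≥0

      edge : ∀ x y {e} w → a + + 1 ≤ e × e ≤ a + + s → p y ≡ p x + e + w * n → x ⟶ y
      edge x y {e} w range h = subst (λ d → a + + 1 ≤ d × d ≤ a + + s) (sym (off-unique e w h
        (e≥0 e a b*s≥0 (proj₁ range))
        (e<n e b (+ s) (+ k) n n≡ (proj₂ range) (*-monoʳ-≤-nonNeg (+ s) b<k) (subst (+ 0 ≤_) (pos-* k s) (+≤+ z≤n))))) range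

      -- `diffMod m x y` stands for x - y, so the difference c e is an edge from y to x; for - c e
      -- the roles of x and y are exchanged.
      from-P : ∀ {x y} → P (diffMod m (f x) (f y)) → Adj x y
      from-P {x} {y} Pd = by-sign (in-block _ Pd) (diffMod-eq m (f x) (f y))
        where
        X = + toℕ (f x)
        Y = + toℕ (f y)
        d = diffMod m (f x) (f y)
        by-sign : (∃₂ λ e w → (a + + 1 ≤ e × e ≤ a + + s) × (+ d ≡ c * e + w * n ⊎ + d ≡ - (c * e) + w * n)) →
                  (∃ λ w → + d ≡ X - Y + w * n) → Adj x y
        by-sign (e , w , range , inj₁ h) (w′ , h′) =
          inj₂ (edge y x (t * e + ν * w - ν * w′) range (forward ν c t e (+ d) X Y w w′ n inverse h h′))
        by-sign (e , w , range , inj₂ h) (w′ , h′) =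
          inj₁ (edge x y (t * e + ν * - w - ν * - w′) range (forward ν c t e (- + d) Y X (- w) (- w′) n inverse
            (flip-sign (+ d) X Y (c * e) w w′ n h h′) (flip-diff (+ d) X Y w′ n h′)))

      adj : ∀ {x y} → A (f x) (f y) → Adj x y
      adj e = [ from-P , Adj-sym ∘ from-P ]′ (A⇒P e)

      diam-two : DiamTwo
      diam-two x y = by-distance (diam x y)
        where
        by-distance : x ≡ y ⊎ A (f x) (f y) ⊎ (∃ λ z → A (f x) (f z) × A (f z) (f y)) →
                      x ≡ y ⊎ Adj x y ⊎ ∃ λ z → Adj x z × Adj z y
        by-distance (inj₁ e)                    = inj₁ e
        by-distance (inj₂ (inj₁ e))             = inj₂ (inj₁ (adj e))
        by-distance (inj₂ (inj₂ (z , e , e′)))  = inj₂ (inj₂ (z , adj e , adj e′))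

      bound-from : Fin N → + N ≤ + 2 * + s + + 7
      bound-from = λ v → Block.bound C (+ s) (+ k) b a (+≤+ s≥1) (+≤+ k≥4) b<k n≡ refl diam-two v good

    bound : ∀ {P} → Scaled P → ∀ {N} (f : Fin N → Fin (suc m)) → (∀ {x y} → f x ≡ f y → x ≡ y) →
            (A : Fin (suc m) → Fin (suc m) → Set) → (∀ {x y} → A x y → P (diffMod m x y) ⊎ P (diffMod m y x)) →
            (∀ x y → x ≡ y ⊎ A (f x) (f y) ⊎ ∃ λ z → A (f x) (f z) × A (f z) (f y)) →
            N ℕ.≤ 2 ℕ.* s ℕ.+ 7
    -- The geometric bound fixes a vertex, which the empty graph lacks.
    bound S {zero}  _ _ _ _ _ = z≤n
    bound S {suc N} f f-inj A A⇒P diam = drop‿+≤+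
      (subst (λ t → + suc N ≤ t + + 7) (sym (pos-* 2 s)) (Bound.bound-from S f f-inj A A⇒P diam Fin.zero))

  -- Distributing the differences 1, ..., s k over k classes

  module Schemes (k s : ℕ) (k≥4 : 4 ℕ.≤ k) (s≥1 : 1 ℕ.≤ s) where
    open Colouring k s k≥4 s≥1

    InClass : (ℕ → ℕ) → ℕ → ℕ → Set
    InClass class i d = (1 ℕ.≤ d × d ℕ.≤ s ℕ.* k) × class d ≡ i

    record Scheme : Set where
      field
        class  : ℕ → ℕ
        class< : ∀ d → 1 ℕ.≤ d → d ℕ.≤ s ℕ.* k → class d ℕ.< k
        scaled : ∀ i → i ℕ.< k → Scaled (InClass class i)

    S K : ℤ
    S = + s
    K = + k

    Range : ℤ → ℤ → Set
    Range b e = b * S + + 1 ≤ e × e ≤ b * S + S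

    d≤SK : ∀ {d} → d ℕ.≤ s ℕ.* k → + d ≤ S * K
    d≤SK {d} h = subst (+ d ≤_) (pos-* s k) (+≤+ h)

    scaled₁ : ∀ {P} b → + 0 ≤ b → b + + 1 ≤ K → GoodBlock b → (∀ d → P d → Range b (+ d)) → Scaled P
    scaled₁ b b≥0 b<k good range = record
      { b = b ; c = + 1 ; ν = + 1 ; t = + 0 ; b≥0 = b≥0 ; b<k = b<k ; good = good ; inverse = refl
      ; in-block = λ d Pd → + d , + 0 , range d Pd , inj₁ (trivial (+ d) n) }
      where
      trivial = farkas₂ ∅ 2 (λ d n → ⊩ d ≈ # 1 :* d :+ # 0 :* n) (1 ∷ []) (1 ∷ [])

    InBlock : ℤ → ℤ → ℕ → Set
    InBlock b c d = ∃₂ λ e w → Range b e × (+ d ≡ c * e + w * n ⊎ + d ≡ - (c * e) + w * n)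

    -- The inverse of 2 modulo n is (n + 1) / 2 = s k + 1.
    scaled₂ : ∀ {P} b → + 0 ≤ b → b + + 1 ≤ K → GoodBlock b → (∀ d → P d → InBlock b (+ 2) d) → Scaled P
    scaled₂ b b≥0 b<k good inb = record
      { b = b ; c = + 2 ; ν = S * K + + 1 ; t = + 1 ; b≥0 = b≥0 ; b<k = b<k ; good = good
      ; inverse = half S K n n≡ ; in-block = inb }
      where
      half = farkas₂ ∅ 3 (λ s k n →
          n ≈ # 2 :* s :* k :+ # 1 ⇒ ⊩ (s :* k :+ # 1) :* # 2 ≈ # 1 :+ # 1 :* n)
          (1 ∷ 0 ∷ 1 ∷ []) (1 ∷ 1 ∷ [])

    -- The inverse of 4 is the square of s k + 1, because (n + 1) (n + 1) = 1 + (n + 2) n.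
    scaled₄ : ∀ {P} b → + 0 ≤ b → b + + 1 ≤ K → GoodBlock b → (∀ d → P d → InBlock b (+ 4) d) → Scaled P
    scaled₄ b b≥0 b<k good inb = record
      { b = b ; c = + 4 ; ν = (S * K + + 1) * (S * K + + 1) ; t = n + + 2 ; b≥0 = b≥0 ; b<k = b<k ; good = good
      ; inverse = trans (quarter S K) (cong (λ t → + 1 + (t + + 2) * t) (sym n≡)) ; in-block = inb }
      where
      quarter = farkas₂ ∅ 2 (λ s k →
          ⊩ (s :* k :+ # 1) :* (s :* k :+ # 1) :* # 4 ≈ # 1 :+ (# 2 :* s :* k :+ # 1 :+ # 2) :* (# 2 :* s :* k :+ # 1))
          (1 ∷ []) (1 ∷ [])

    divide : ∀ d c .{{_ : ℕ.NonZero c}} → + d ≡ + (d ℕ.% c) + + (d ℕ./ c) * + c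
    divide d c = trans (cong +_ (ℕ.m≡m%n+[m/n]*n d c)) (cong (λ t → + (d ℕ.% c) + t) (pos-* (d ℕ./ c) c))

    pick : ∀ {A : Set} → Dec A → ℕ → ℕ → ℕ
    pick (yes _) x y = x
    pick (no _)  x y = y

    -- The blocks 2 J and 2 J + 1 with J = 0 or J = j are split into even and odd numbers; these are
    -- 2 times the block J and - 2 times the block k - 1 - J.
    module Layout (j : ℕ) (j<k : j ℕ.* 2 ℕ.+ 1 ℕ.< k)
      (even-good : GoodBlock (+ j)) (odd-good : ∀ J → J ≡ 0 ⊎ J ≡ j → GoodBlock (K - + 1 - + J))
      (thirds : ∀ i → + 2 * K ≡ + 3 * + i + + 3 → i ℕ./ 2 ≡ 0 ⊎ i ℕ./ 2 ≡ j) where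

      instance _ = ℕ.>-nonZero s≥1

      Split : ℕ → Set
      Split J = J ≡ 0 ⊎ J ≡ j

      split? : ∀ J → Dec (Split J)
      split? J = (J ℕ.≟ 0) ⊎-dec (J ℕ.≟ j)

      -- Blocks start at multiples of s plus 1, hence `d ∸ 1`. In a whole pair the bit is the parity
      -- of the block number, so that the class is the block; in a split pair it is the parity of d.
      block pair bit class : ℕ → ℕ
      block d = (d ℕ.∸ 1) ℕ./ s
      pair d = block d ℕ./ 2
      bit d = pick (split? (pair d)) (d ℕ.% 2) (block d ℕ.% 2)
      class d = bit d ℕ.+ pair d ℕ.* 2

      bit<2 : ∀ d → bit d ℕ.< 2
      bit<2 d with split? (pair d)
      ... | yes _ = ℕ.m%n<n d 2
      ... | no _  = ℕ.m%n<n (block d) 2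

      class/2 : ∀ d → class d ℕ./ 2 ≡ pair d
      class/2 d = trans (ℕ.+-distrib-/-∣ʳ (bit d) (divides-refl (pair d)))
        (cong₂ ℕ._+_ (ℕ.m<n⇒m/n≡0 (bit<2 d)) (ℕ.m*n/n≡m (pair d) 2))

      class%2 : ∀ d → class d ℕ.% 2 ≡ bit d
      class%2 d = trans (ℕ.[m+kn]%n≡m%n (bit d) (pair d) 2) (ℕ.m<n⇒m%n≡m (bit<2 d))

      bit-split : ∀ d → Split (pair d) → bit d ≡ d ℕ.% 2
      bit-split d sp with split? (pair d)
      ... | yes _  = refl
      ... | no ¬sp = contradiction sp ¬sp

      class-whole : ∀ d → ¬ Split (pair d) → class d ≡ block d
      class-whole d ¬sp with split? (pair d)
      ... | yes sp = contradiction sp ¬sp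
      ... | no _   = sym (ℕ.m≡m%n+[m/n]*n (block d) 2)

      pair< : ∀ J → Split J → J ℕ.* 2 ℕ.+ 1 ℕ.< k
      pair< _ (inj₁ refl) = ℕ.≤-trans (s≤s (s≤s z≤n)) k≥4
      pair< _ (inj₂ refl) = j<k

      d-1<ks : ∀ d → 1 ℕ.≤ d → d ℕ.≤ s ℕ.* k → d ℕ.∸ 1 ℕ.< k ℕ.* s
      d-1<ks (suc d) _ h = ℕ.≤-trans h (ℕ.≤-reflexive (ℕ.*-comm s k))

      class< : ∀ d → 1 ℕ.≤ d → d ℕ.≤ s ℕ.* k → class d ℕ.< k
      class< d d≥1 d≤ = go (split? (pair d))
        where
        go : Dec (Split (pair d)) → class d ℕ.< k
        go (yes sp) = ℕ.≤-<-trans (ℕ.≤-trans (ℕ.+-monoˡ-≤ (pair d ℕ.* 2) (ℕ.≤-pred (bit<2 d)))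
          (ℕ.≤-reflexive (ℕ.+-comm 1 (pair d ℕ.* 2)))) (pair< (pair d) sp)
        go (no ¬sp) = subst (ℕ._< k) (sym (class-whole d ¬sp)) (ℕ.m<n*o⇒m/o<n (d-1<ks d d≥1 d≤))

      block-range : ∀ d → 1 ℕ.≤ d → Range (+ block d) (+ d)
      block-range d@(suc d′) _ = lo (+ d′) (+ r) (+ block d * S) (divide d′ s) (+≤+ z≤n) ,
                                hi (+ d′) (+ r) (+ block d * S) S (divide d′ s) (<⇒+1≤ (ℕ.m%n<n d′ s))
        where
        r = d′ ℕ.% s
        lo = farkas ∅ 3 (λ d r b → d ≈ r :+ b ⇒ # 0 ≼ r ⇒ ⊩ b :+ # 1 ≼ # 1 :+ d) (1 ∷ 1 ∷ 0 ∷ 1 ∷ [])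

        hi = farkas ∅ 4 (λ d r b s → d ≈ r :+ b ⇒ r :+ # 1 ≼ s ⇒ ⊩ # 1 :+ d ≼ b :+ s) (1 ∷ 1 ∷ 1 ∷ [])

      pair-range : ∀ d → 1 ℕ.≤ d → + 2 * + pair d * S + + 1 ≤ + d × + d ≤ + 2 * + pair d * S + + 2 * S
      pair-range d d≥1 =
        lo (+ d) (+ block d) (+ r) (+ pair d) S (proj₁ (block-range d d≥1)) (product (divide (block d) 2)) rS≥0 ,
        hi (+ d) (+ block d) (+ r) (+ pair d) S (proj₂ (block-range d d≥1)) (product (divide (block d) 2)) rS≤S
        where
        r = block d ℕ.% 2

        product : ∀ {x y} → x ≡ y → x * S ≡ y * S
        product = cong (_* S)

        rS≥0 : + 0 ≤ + r * S
        rS≥0 = *-monoʳ-≤-nonNeg S (+≤+ (z≤n {r}))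

        rS≤S : + r * S ≤ + 1 * S
        rS≤S = *-monoʳ-≤-nonNeg S (+≤+ (ℕ.≤-pred (ℕ.m%n<n (block d) 2)))

        lo = farkas ∅ 5 (λ d q r J s →
            q :* s :+ # 1 ≼ d ⇒ q :* s ≈ (r :+ J :* # 2) :* s ⇒ # 0 ≼ r :* s ⇒
            ⊩ # 2 :* J :* s :+ # 1 ≼ d) (1 ∷ 1 ∷ 0 ∷ 1 ∷ 1 ∷ [])

        hi = farkas ∅ 5 (λ d q r J s →
            d ≼ q :* s :+ s ⇒ q :* s ≈ (r :+ J :* # 2) :* s ⇒ r :* s ≼ # 1 :* s ⇒
            ⊩ d ≼ # 2 :* J :* s :+ # 2 :* s) (1 ∷ 1 ∷ 1 ∷ 0 ∷ 1 ∷ [])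

      module Class (i : ℕ) (i<k : i ℕ.< k) where
        J = i ℕ./ 2

        same-pair : ∀ {d} → InClass class i d → pair d ≡ J
        same-pair {d} (_ , e) = trans (sym (class/2 d)) (cong (ℕ._/ 2) e)

        -- Block 1 belongs to the pair 0, and by `thirds` the bad block belongs to a split pair as
        -- well, so the blocks that remain whole are good.
        whole : ¬ Split J → Scaled (InClass class i)
        whole ¬sp = scaled₁ (+ i) (+≤+ z≤n) (<⇒+1≤ i<k)
            (inj₂ (+≤+ (ℕ.≮⇒≥ (λ i<2 → ¬sp (inj₁ (ℕ.m<n⇒m/n≡0 i<2)))) , λ e → ¬sp (thirds i e)))
            λ d d∈ → subst (λ q → Range (+ q) (+ d))
              (trans (sym (class-whole d (λ sp → ¬sp (subst Split (same-pair d∈) sp)))) (proj₂ d∈))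
              (block-range d (proj₁ (proj₁ d∈)))

        range : ∀ {d} → InClass class i d → + 2 * + J * S + + 1 ≤ + d × + d ≤ + 2 * + J * S + + 2 * S
        range {d} d∈ = subst (λ J → + 2 * + J * S + + 1 ≤ + d × + d ≤ + 2 * + J * S + + 2 * S) (same-pair d∈)
          (pair-range d (proj₁ (proj₁ d∈)))

        parity : Split J → ∀ {d} → InClass class i d → d ℕ.% 2 ≡ i ℕ.% 2
        parity sp {d} d∈ = trans (sym (bit-split d (subst Split (sym (same-pair d∈)) sp)))
          (trans (sym (class%2 d)) (cong (ℕ._% 2) (proj₂ d∈)))

        halve : ∀ d r → d ℕ.% 2 ≡ r → + d ≡ + r + + (d ℕ./ 2) * + 2
        halve d r e = trans (divide d 2) (cong (λ t → + t + + (d ℕ./ 2) * + 2) e)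

        J<k : Split J → + J + + 1 ≤ K
        J<k sp = <⇒+1≤ (ℕ.≤-<-trans (ℕ.≤-trans (ℕ.m≤m*n J 2) (ℕ.m≤m+n (J ℕ.* 2) 1)) (pair< J sp))

        even-good′ : Split J → GoodBlock (+ J)
        even-good′ (inj₁ J≡0) = inj₁ (cong +_ J≡0)
        even-good′ (inj₂ J≡j) = subst (GoodBlock ∘ +_) (sym J≡j) even-good

        even : Split J → i ℕ.% 2 ≡ 0 → Scaled (InClass class i)
        even sp i-even = scaled₂ (+ J) (+≤+ z≤n) (J<k sp) (even-good′ sp) λ d d∈ →
            + (d ℕ./ 2) , + 0 , in-range d d∈ , inj₁ (double (+ d) (+ (d ℕ./ 2)) n (halved d d∈))
          where
          halved : ∀ d → InClass class i d → + d ≡ + 0 + + (d ℕ./ 2) * + 2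
          halved d d∈ = halve d 0 (trans (parity sp d∈) i-even)

          double = farkas₂ ∅ 3 (λ d e n →
              d ≈ # 0 :+ e :* # 2 ⇒ ⊩ d ≈ # 2 :* e :+ # 0 :* n) (1 ∷ 1 ∷ []) (1 ∷ 0 ∷ 1 ∷ [])

          lo = farkas ∅ 4 (λ d e J s →
              d ≈ # 0 :+ e :* # 2 ⇒ # 2 :* J :* s :+ # 1 ≼ d ⇒ ⊩ J :* s :+ # 1 ≼ e) (2 ∷ 1 ∷ 1 ∷ [])

          hi = farkas ∅ 4 (λ d e J s →
              d ≈ # 0 :+ e :* # 2 ⇒ d ≼ # 2 :* J :* s :+ # 2 :* s ⇒ ⊩ e ≼ J :* s :+ s)
              (2 ∷ 1 ∷ 0 ∷ 1 ∷ [])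

          in-range : ∀ d → InClass class i d → Range (+ J) (+ (d ℕ./ 2))
          in-range d d∈ = lo (+ d) (+ (d ℕ./ 2)) (+ J) S (halved d d∈) (proj₁ (range d∈)) ,
                          hi (+ d) (+ (d ℕ./ 2)) (+ J) S (halved d d∈) (proj₂ (range d∈))

        -- By n = 2 s k + 1 the number 2 e + 1 equals - 2 (s k - e) + n, and J s ≤ e < J s + s puts
        -- s k - e into the block k - 1 - J.
        odd : Split J → i ℕ.% 2 ≡ 1 → Scaled (InClass class i)
        odd sp i-odd = scaled₂ b (nonneg (+ J) K (J<k sp)) (below (+ J) K (+≤+ z≤n)) (odd-good J sp) λ d d∈ →
            S * K - + (d ℕ./ 2) , + 1 , in-range d d∈ , inj₂ (reflect (+ d) (+ (d ℕ./ 2)) S K n n≡ (halved d d∈))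
          where
          b = K - + 1 - + J

          nonneg = farkas ∅ 2 (λ J k → J :+ # 1 ≼ k ⇒ ⊩ # 0 ≼ k :- # 1 :- J) (1 ∷ 1 ∷ [])

          below = farkas ∅ 2 (λ J k → # 0 ≼ J ⇒ ⊩ k :- # 1 :- J :+ # 1 ≼ k) (1 ∷ 1 ∷ [])

          halved : ∀ d → InClass class i d → + d ≡ + 1 + + (d ℕ./ 2) * + 2
          halved d d∈ = halve d 1 (trans (parity sp d∈) i-odd)

          reflect = farkas₂ ∅ 5 (λ d e s k n →
              n ≈ # 2 :* s :* k :+ # 1 ⇒ d ≈ # 1 :+ e :* # 2 ⇒
              ⊩ d ≈ ⊝ (# 2 :* (s :* k :- e)) :+ # 1 :* n)
              (1 ∷ 1 ∷ 0 ∷ 0 ∷ 1 ∷ []) (1 ∷ 0 ∷ 1 ∷ 1 ∷ [])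

          lo = farkas ∅ 5 (λ d e J s k →
              d ≈ # 1 :+ e :* # 2 ⇒ d ≼ # 2 :* J :* s :+ # 2 :* s ⇒
              ⊩ (k :- # 1 :- J) :* s :+ # 1 ≼ s :* k :- e) (2 ∷ 1 ∷ 0 ∷ 1 ∷ [])

          hi = farkas ∅ 5 (λ d e J s k →
              d ≈ # 1 :+ e :* # 2 ⇒ # 2 :* J :* s :+ # 1 ≼ d ⇒
              ⊩ s :* k :- e ≼ (k :- # 1 :- J) :* s :+ s) (2 ∷ 1 ∷ 1 ∷ [])

          in-range : ∀ d → InClass class i d → Range b (S * K - + (d ℕ./ 2))
          in-range d d∈ = lo (+ d) (+ (d ℕ./ 2)) (+ J) S K (halved d d∈) (proj₂ (range d∈)) ,
                          hi (+ d) (+ (d ℕ./ 2)) (+ J) S K (halved d d∈) (proj₁ (range d∈))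

        scaled : Scaled (InClass class i)
        scaled = go (split? J) (i ℕ.% 2) refl (ℕ.m%n<n i 2)
          where
          go : Dec (Split J) → ∀ r → i ℕ.% 2 ≡ r → r ℕ.< 2 → Scaled (InClass class i)
          go (no ¬sp) _ _ _ = whole ¬sp
          go (yes sp) 0 e _ = even sp e
          go (yes sp) 1 e _ = odd sp e
          go (yes _) (suc (suc _)) _ (s≤s (s≤s ()))

      scheme : Scheme
      scheme = record { class = class ; class< = class< ; scaled = Class.scaled }

    module Six (k≡6 : K ≡ + 6) where
      -- The even numbers up to 4 s are twice the blocks 0 and 1 and are split again, into 4 (block
      -- 0) and - 4 (block 5). The odd numbers up to 4 s form - 2 (block 5) and - 2 (block 4), and
      -- the blocks 4 and 5 stay whole.
      data View (d : ℕ) : ℕ → Set where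
        mod-4≡0  : ∀ e → d ℕ.≤ 4 ℕ.* s → + d ≡ + 0 + e * + 4 → View d 0
        mod-4≡2  : ∀ e → + 0 ≤ e → d ℕ.≤ 4 ℕ.* s → + d ≡ + 2 + e * + 4 → View d 1
        odd-low  : ∀ e → + 0 ≤ e → d ℕ.≤ 2 ℕ.* s → + d ≡ + 1 + e * + 2 → View d 2
        odd-high : ∀ e → 2 ℕ.* s ℕ.< d → d ℕ.≤ 4 ℕ.* s → + d ≡ + 1 + e * + 2 → View d 3
        fifth    : 4 ℕ.* s ℕ.< d → d ℕ.≤ 5 ℕ.* s → View d 4
        sixth    : 5 ℕ.* s ℕ.< d → View d 5

      low : ∀ {A : Set} → ℕ → Dec A → ℕ
      low 0 _       = 0
      low 2 _       = 1
      low _ (yes _) = 2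
      low _ (no _)  = 3

      class : ℕ → ℕ
      class d = pick (d ℕ.≤? 4 ℕ.* s) (low (d ℕ.% 4) (d ℕ.≤? 2 ℕ.* s)) (pick (d ℕ.≤? 5 ℕ.* s) 4 5)

      odd₁ = farkas₂ ∅ 2 (λ d e →
          d ≈ # 1 :+ e :* # 4 ⇒ ⊩ d ≈ # 1 :+ # 2 :* e :* # 2) (1 ∷ 1 ∷ []) (1 ∷ 0 ∷ 1 ∷ [])

      odd₃ = farkas₂ ∅ 2 (λ d e →
          d ≈ # 3 :+ e :* # 4 ⇒ ⊩ d ≈ # 1 :+ (# 2 :* e :+ # 1) :* # 2) (1 ∷ 1 ∷ []) (1 ∷ 0 ∷ 1 ∷ [])

      nonneg₁ = farkas ∅ 1 (λ e → # 0 ≼ e ⇒ ⊩ # 0 ≼ # 2 :* e) (1 ∷ 2 ∷ [])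

      nonneg₃ = farkas ∅ 1 (λ e → # 0 ≼ e ⇒ ⊩ # 0 ≼ # 2 :* e :+ # 1) (1 ∷ 2 ∷ [])

      view-low : ∀ d r e → + 0 ≤ e → + d ≡ + r + e * + 4 → r ℕ.< 4 → d ℕ.≤ 4 ℕ.* s →
                 (d≤? : Dec (d ℕ.≤ 2 ℕ.* s)) → View d (low r d≤?)
      view-low d 0 e e≥0 h _ d≤ _ = mod-4≡0 e d≤ h
      view-low d 1 e e≥0 h _ d≤ (yes d≤2s) = odd-low (+ 2 * e) (nonneg₁ e e≥0) d≤2s (odd₁ (+ d) e h)
      view-low d 1 e e≥0 h _ d≤ (no d≰2s)  = odd-high (+ 2 * e) (ℕ.≰⇒> d≰2s) d≤ (odd₁ (+ d) e h)
      view-low d 2 e e≥0 h _ d≤ _ = mod-4≡2 e e≥0 d≤ h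
      view-low d 3 e e≥0 h _ d≤ (yes d≤2s) = odd-low (+ 2 * e + + 1) (nonneg₃ e e≥0) d≤2s (odd₃ (+ d) e h)
      view-low d 3 e e≥0 h _ d≤ (no d≰2s)  = odd-high (+ 2 * e + + 1) (ℕ.≰⇒> d≰2s) d≤ (odd₃ (+ d) e h)
      view-low d (suc (suc (suc (suc _)))) _ _ _ (s≤s (s≤s (s≤s (s≤s ())))) _ _

      view : ∀ d → View d (class d)
      view d with d ℕ.≤? 4 ℕ.* s | d ℕ.≤? 5 ℕ.* s
      ... | yes d≤4s | _ = view-low d (d ℕ.% 4) (+ (d ℕ./ 4)) (+≤+ z≤n) (divide d 4) (ℕ.m%n<n d 4) d≤4s (d ℕ.≤? 2 ℕ.* s)
      ... | no d≰4s | yes d≤5s = fifth (ℕ.≰⇒> d≰4s) d≤5s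
      ... | no d≰4s | no d≰5s  = sixth (ℕ.≰⇒> d≰5s)

      view-class : ∀ {d i} → InClass class i d → View d i
      view-class {d} (_ , e) = subst (View d) e (view d)

      view< : ∀ {d i} → View d i → i ℕ.< 6
      view< (mod-4≡0 _ _ _)    = s≤s z≤n
      view< (mod-4≡2 _ _ _ _)  = s≤s (s≤s z≤n)
      view< (odd-low _ _ _ _)  = s≤s (s≤s (s≤s z≤n))
      view< (odd-high _ _ _ _) = s≤s (s≤s (s≤s (s≤s z≤n)))
      view< (fifth _ _)        = s≤s (s≤s (s≤s (s≤s (s≤s z≤n))))
      view< (sixth _)          = ℕ.≤-refl

      upper : ∀ {d} c → d ℕ.≤ c ℕ.* s → + d ≤ + c * S
      upper {d} c h = subst (+ d ≤_) (pos-* c s) (+≤+ h)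

      lower : ∀ {d} c → c ℕ.* s ℕ.< d → + c * S + + 1 ≤ + d
      lower {d} c h = subst (λ t → t + + 1 ≤ + d) (pos-* c s) (<⇒+1≤ h)

      n≡12s : n ≡ + 12 * S + + 1
      n≡12s = trans n≡ (trans (cong (λ t → + 2 * S * t + + 1) k≡6) (twelve S))
        where
        twelve = farkas₂ ∅ 1 (λ s → ⊩ # 2 :* s :* # 6 :+ # 1 ≈ # 12 :* s :+ # 1) (1 ∷ []) (1 ∷ [])

      d≤6s : ∀ {d} → d ℕ.≤ s ℕ.* k → + d ≤ S * + 6
      d≤6s {d} h = subst (λ t → + d ≤ S * t) k≡6 (d≤SK h)

      good : ∀ b → + 4 ≤ b → GoodBlock b
      good b b≥4 = inj₂ (≤-trans (+≤+ (s≤s (s≤s z≤n))) b≥4 , λ e → clash K b k≡6 b≥4 e)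
        where
        clash = farkas ∅ 2 (λ k b →
            k ≈ # 6 ⇒ # 4 ≼ b ⇒ # 2 :* k ≈ # 3 :* b :+ # 3 ⇒ ⊩⊥) (0 ∷ 1 ∷ 3 ∷ 2 ∷ [])

      below-6 : ∀ {b} → b ≤ + 6 → b ≤ K
      below-6 {b} h = subst (b ≤_) (sym k≡6) h

      4≤5 : + 4 ≤ + 5
      4≤5 = +≤+ (ℕ.n≤1+n 4)

      scaled : ∀ i → i ℕ.< 6 → Scaled (InClass class i)
      scaled 0 _ = scaled₄ (+ 0) ≤-refl (below-6 (+≤+ (s≤s z≤n))) (inj₁ refl) λ d d∈ →
          from-view d (proj₁ (proj₁ d∈)) (view-class d∈)
        where
        lo = farkas ∅ 3 (λ d e s →
            d ≈ # 0 :+ e :* # 4 ⇒ # 1 ≼ d ⇒ ⊩ # 0 :* s :+ # 1 ≼ e) (4 ∷ 1 ∷ 1 ∷ [])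

        hi = farkas ∅ 3 (λ d e s →
            d ≈ # 0 :+ e :* # 4 ⇒ d ≼ # 4 :* s ⇒ ⊩ e ≼ # 0 :* s :+ s) (4 ∷ 1 ∷ 0 ∷ 1 ∷ [])

        multiple = farkas₂ ∅ 3 (λ d e n →
            d ≈ # 0 :+ e :* # 4 ⇒ ⊩ d ≈ # 4 :* e :+ # 0 :* n) (1 ∷ 1 ∷ []) (1 ∷ 0 ∷ 1 ∷ [])

        from-view : ∀ d → 1 ℕ.≤ d → View d 0 → InBlock (+ 0) (+ 4) d
        from-view d d≥1 (mod-4≡0 e d≤ h) = e , + 0 ,
          (lo (+ d) e S h (+≤+ d≥1) , hi (+ d) e S h (upper 4 d≤)) , inj₁ (multiple (+ d) e n h)
      scaled 1 _ = scaled₄ (+ 5) (+≤+ z≤n) (below-6 ≤-refl) (good (+ 5) 4≤5) λ d d∈ → from-view d (view-class d∈)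
        where
        lo = farkas ∅ 3 (λ d e s →
            d ≈ # 2 :+ e :* # 4 ⇒ d ≼ # 4 :* s ⇒ ⊩ # 5 :* s :+ # 1 ≼ # 6 :* s :- e)
            (4 ∷ 1 ∷ 0 ∷ 1 ∷ [])

        hi = farkas ∅ 2 (λ e s → # 0 ≼ e ⇒ ⊩ # 6 :* s :- e ≼ # 5 :* s :+ s) (1 ∷ 1 ∷ [])

        -- Two turns are needed: 2 n = 24 s + 2, so 4 e + 2 = - 4 (6 s - e) + 2 n.
        reflect = farkas₂ ∅ 4 (λ d e s n →
            n ≈ # 12 :* s :+ # 1 ⇒ d ≈ # 2 :+ e :* # 4 ⇒
            ⊩ d ≈ ⊝ (# 4 :* (# 6 :* s :- e)) :+ # 2 :* n)
            (1 ∷ 1 ∷ 0 ∷ 0 ∷ 2 ∷ []) (1 ∷ 0 ∷ 1 ∷ 2 ∷ [])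

        from-view : ∀ d → View d 1 → InBlock (+ 5) (+ 4) d
        from-view d (mod-4≡2 e e≥0 d≤ h) = + 6 * S - e , + 2 ,
          (lo (+ d) e S h (upper 4 d≤) , hi e S e≥0) , inj₂ (reflect (+ d) e S n n≡12s h)
      scaled 2 _ = scaled₂ (+ 5) (+≤+ z≤n) (below-6 ≤-refl) (good (+ 5) 4≤5) λ d d∈ → from-view d (view-class d∈)
        where
        lo = farkas ∅ 3 (λ d e s →
            d ≈ # 1 :+ e :* # 2 ⇒ d ≼ # 2 :* s ⇒ ⊩ # 5 :* s :+ # 1 ≼ # 6 :* s :- e)
            (2 ∷ 1 ∷ 0 ∷ 1 ∷ [])

        hi = farkas ∅ 2 (λ e s → # 0 ≼ e ⇒ ⊩ # 6 :* s :- e ≼ # 5 :* s :+ s) (1 ∷ 1 ∷ [])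

        reflect = farkas₂ ∅ 4 (λ d e s n →
            n ≈ # 12 :* s :+ # 1 ⇒ d ≈ # 1 :+ e :* # 2 ⇒
            ⊩ d ≈ ⊝ (# 2 :* (# 6 :* s :- e)) :+ # 1 :* n)
            (1 ∷ 1 ∷ 0 ∷ 0 ∷ 1 ∷ []) (1 ∷ 0 ∷ 1 ∷ 1 ∷ [])

        from-view : ∀ d → View d 2 → InBlock (+ 5) (+ 2) d
        from-view d (odd-low e e≥0 d≤ h) = + 6 * S - e , + 1 ,
          (lo (+ d) e S h (upper 2 d≤) , hi e S e≥0) , inj₂ (reflect (+ d) e S n n≡12s h)
      scaled 3 _ = scaled₂ (+ 4) (+≤+ z≤n) (below-6 (+≤+ (ℕ.n≤1+n 5))) (good (+ 4) ≤-refl) λ d d∈ → from-view d (view-class d∈)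
        where
        lo = farkas ∅ 3 (λ d e s →
            d ≈ # 1 :+ e :* # 2 ⇒ d ≼ # 4 :* s ⇒ ⊩ # 4 :* s :+ # 1 ≼ # 6 :* s :- e)
            (2 ∷ 1 ∷ 0 ∷ 1 ∷ [])

        hi = farkas ∅ 3 (λ d e s →
            d ≈ # 1 :+ e :* # 2 ⇒ # 2 :* s :+ # 1 ≼ d ⇒ ⊩ # 6 :* s :- e ≼ # 4 :* s :+ s)
            (2 ∷ 1 ∷ 1 ∷ [])

        reflect = farkas₂ ∅ 4 (λ d e s n →
            n ≈ # 12 :* s :+ # 1 ⇒ d ≈ # 1 :+ e :* # 2 ⇒
            ⊩ d ≈ ⊝ (# 2 :* (# 6 :* s :- e)) :+ # 1 :* n)
            (1 ∷ 1 ∷ 0 ∷ 0 ∷ 1 ∷ []) (1 ∷ 0 ∷ 1 ∷ 1 ∷ [])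

        from-view : ∀ d → View d 3 → InBlock (+ 4) (+ 2) d
        from-view d (odd-high e <d d≤ h) = + 6 * S - e , + 1 ,
          (lo (+ d) e S h (upper 4 d≤) , hi (+ d) e S h (lower 2 <d)) , inj₂ (reflect (+ d) e S n n≡12s h)
      scaled 4 _ = scaled₁ (+ 4) (+≤+ z≤n) (below-6 (+≤+ (ℕ.n≤1+n 5))) (good (+ 4) ≤-refl) λ d d∈ → from-view d (view-class d∈)
        where
        hi = farkas ∅ 2 (λ d s → d ≼ # 5 :* s ⇒ ⊩ d ≼ # 4 :* s :+ s) (1 ∷ 1 ∷ [])

        from-view : ∀ d → View d 4 → Range (+ 4) (+ d)
        from-view d (fifth <d d≤) = lower 4 <d , hi (+ d) S (upper 5 d≤)
      scaled 5 _ = scaled₁ (+ 5) (+≤+ z≤n) (below-6 ≤-refl) (good (+ 5) 4≤5) λ d d∈ →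
          from-view d (proj₂ (proj₁ d∈)) (view-class d∈)
        where
        hi = farkas ∅ 2 (λ d s → d ≼ s :* # 6 ⇒ ⊩ d ≼ # 5 :* s :+ s) (1 ∷ 1 ∷ [])

        from-view : ∀ d → d ℕ.≤ s ℕ.* k → View d 5 → Range (+ 5) (+ d)
        from-view d d≤ (sixth <d) = lower 5 <d , hi (+ d) S (d≤6s d≤)
      scaled (suc (suc (suc (suc (suc (suc _)))))) (s≤s (s≤s (s≤s (s≤s (s≤s (s≤s ()))))))

      scheme : Scheme
      scheme = record
        { class  = class
        ; class< = λ d _ _ → subst (class d ℕ.<_) (sym (+-injective k≡6)) (view< (view d))
        ; scaled = λ i i<k → scaled i (subst (i ℕ.<_) (+-injective k≡6) i<k)
        }

    odd-good₀ = farkas ∅ 1 (λ k → # 4 ≼ k ⇒ ⊩ # 2 ≼ k :- # 1 :- # 0) (1 ∷ 1 ∷ [])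

    odd-good₁ = farkas ∅ 1 (λ k →
        # 4 ≼ k ⇒ # 2 :* k ≈ # 3 :* (k :- # 1 :- # 0) :+ # 3 ⇒ ⊩⊥) (0 ∷ 1 ∷ 1 ∷ [])

    last-good : GoodBlock (K - + 1 - + 0)
    last-good = inj₂ (odd-good₀ K (+≤+ k≥4) , odd-good₁ K (+≤+ k≥4))

    -- The equation 2 k = 3 i + 3 would make k divisible by 3, so there is no bad block; with j = 0
    -- only the pair 0 is split.
    indivisible : ∀ r → + k ≡ + r + + (k ℕ./ 3) * + 3 → r ≡ 1 ⊎ r ≡ 2 → Scheme
    indivisible r k≡ r≡ = Layout.scheme 0 (ℕ.≤-trans (s≤s (s≤s z≤n)) k≥4) (inj₁ refl)
        (λ { _ (inj₁ refl) → last-good ; _ (inj₂ refl) → last-good })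
        (λ i e → ⊥-elim (impossible r≡ k≡ i e))
      where
      one-lo = farkas ∅ 3 (λ k i m →
          k ≈ # 1 :+ m :* # 3 ⇒ # 2 :* k ≈ # 3 :* i :+ # 3 ⇒ i ≼ # 2 :* m :- # 1 ⇒ ⊩⊥)
          (3 ∷ 1 ∷ 0 ∷ 0 ∷ 2 ∷ [])

      one-hi = farkas ∅ 3 (λ k i m →
          k ≈ # 1 :+ m :* # 3 ⇒ # 2 :* k ≈ # 3 :* i :+ # 3 ⇒ # 2 :* m :- # 1 :+ # 1 ≼ i ⇒ ⊩⊥)
          (3 ∷ 0 ∷ 1 ∷ 2 ∷ [])

      two-lo = farkas ∅ 3 (λ k i m →
          k ≈ # 2 :+ m :* # 3 ⇒ # 2 :* k ≈ # 3 :* i :+ # 3 ⇒ i ≼ # 2 :* m ⇒ ⊩⊥)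
          (3 ∷ 1 ∷ 0 ∷ 0 ∷ 2 ∷ [])

      two-hi = farkas ∅ 3 (λ k i m →
          k ≈ # 2 :+ m :* # 3 ⇒ # 2 :* k ≈ # 3 :* i :+ # 3 ⇒ # 2 :* m :+ # 1 ≼ i ⇒ ⊩⊥)
          (3 ∷ 0 ∷ 1 ∷ 2 ∷ [])

      impossible : r ≡ 1 ⊎ r ≡ 2 → + k ≡ + r + + (k ℕ./ 3) * + 3 → ∀ i → + 2 * K ≡ + 3 * + i + + 3 → ⊥
      impossible (inj₁ refl) h i e = [ one-lo K (+ i) (+ (k ℕ./ 3)) h e , one-hi K (+ i) (+ (k ℕ./ 3)) h e ]′
        (≤⊎≥ (+ i) (+ 2 * + (k ℕ./ 3) - + 1))
      impossible (inj₂ refl) h i e = [ two-lo K (+ i) (+ (k ℕ./ 3)) h e , two-hi K (+ i) (+ (k ℕ./ 3)) h e ]′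
        (≤⊎≥ (+ i) (+ 2 * + (k ℕ./ 3)))

    half-odd : ∀ j → (1 ℕ.+ j ℕ.* 2) ℕ./ 2 ≡ j
    half-odd j = trans (ℕ.+-distrib-/-∣ʳ 1 {j ℕ.* 2} {2} (divides-refl j)) (ℕ.m*n/n≡m j 2)

    -- For k = 3 (j + 1) the bad block 2 j + 1 is the upper half of the pair j, whose splitting
    -- leads to the blocks j and 2 j + 2. They are good for j ≥ 2.
    divisible : ∀ m → K ≡ + 0 + + m * + 3 → Scheme
    divisible 0 h = ⊥-elim (small K (+≤+ k≥4) h)
      where
      small = farkas ∅ 1 (λ k → # 4 ≼ k ⇒ k ≈ # 0 :+ # 0 :* # 3 ⇒ ⊩⊥) (1 ∷ 0 ∷ 1 ∷ [])

    divisible 1 h = ⊥-elim (small K (+≤+ k≥4) h)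
      where
      small = farkas ∅ 1 (λ k → # 4 ≼ k ⇒ k ≈ # 0 :+ # 1 :* # 3 ⇒ ⊩⊥) (1 ∷ 0 ∷ 1 ∷ [])

    divisible 2 h = Six.scheme h
    divisible (suc j@(suc (suc j′))) h = Layout.scheme j
        (drop‿+≤+ (fits (+ j) K (+≤+ z≤n) h′))
        (inj₂ (+≤+ (s≤s (s≤s z≤n)) , small (+ j) K (+≤+ z≤n) h′))
        (λ { _ (inj₁ refl) → last-good
           ; _ (inj₂ refl) → inj₂ (odd-lo (+ j) K (+≤+ z≤n) h′ , odd-hi (+ j) K (+≤+ z≤n) h′) })
        (λ i e → inj₂ (half i (third (+ i) (+ j) K h′ e)))
      where
      h′ : K ≡ (+ 1 + + j) * + 3
      h′ = trans h (+-identityˡ (+ suc j * + 3))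

      fits = farkas ∅ 2 (λ j k →
          # 0 ≼ j ⇒ k ≈ (# 1 :+ j) :* # 3 ⇒ ⊩ # 1 :+ (j :* # 2 :+ # 1) ≼ k) (1 ∷ 0 ∷ 1 ∷ 1 ∷ [])

      small = farkas ∅ 2 (λ j k →
          # 0 ≼ j ⇒ k ≈ (# 1 :+ j) :* # 3 ⇒ # 2 :* k ≈ # 3 :* j :+ # 3 ⇒ ⊩⊥) (1 ∷ 0 ∷ 0 ∷ 2 ∷ 3 ∷ [])

      odd-lo = farkas ∅ 2 (λ j k →
          # 0 ≼ j ⇒ k ≈ (# 1 :+ j) :* # 3 ⇒ ⊩ # 2 ≼ k :- # 1 :- j) (1 ∷ 0 ∷ 1 ∷ 2 ∷ [])

      odd-hi = farkas ∅ 2 (λ j k →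
          # 0 ≼ j ⇒ k ≈ (# 1 :+ j) :* # 3 ⇒ # 2 :* k ≈ # 3 :* (k :- # 1 :- j) :+ # 3 ⇒ ⊩⊥)
          (0 ∷ 1 ∷ 0 ∷ 1 ∷ [])

      third = farkas₂ ∅ 3 (λ i j k →
          k ≈ (# 1 :+ j) :* # 3 ⇒ # 2 :* k ≈ # 3 :* i :+ # 3 ⇒ ⊩ i ≈ # 1 :+ j :* # 2)
          (3 ∷ 0 ∷ 1 ∷ 2 ∷ []) (3 ∷ 1 ∷ 0 ∷ 0 ∷ 2 ∷ [])

      half : ∀ i → + i ≡ + 1 + + j * + 2 → i ℕ./ 2 ≡ j
      half i e = trans (cong (ℕ._/ 2) (+-injective (trans e (cong (λ t → + 1 + t) (sym (pos-* j 2)))))) (half-odd j)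

    scheme : Scheme
    scheme = go (k ℕ.% 3) (divide k 3) (ℕ.m%n<n k 3)
      where
      go : ∀ r → + k ≡ + r + + (k ℕ./ 3) * + 3 → r ℕ.< 3 → Scheme
      go 0 h _ = divisible (k ℕ./ 3) h
      go 1 h _ = indivisible 1 h (inj₁ refl)
      go 2 h _ = indivisible 2 h (inj₂ refl)
      go (suc (suc (suc _))) _ (s≤s (s≤s (s≤s ())))

  -- The edge partition and the size bound

  from-does : ∀ {A : Set} (a? : Dec A) → does a? ≡ true → A
  from-does (yes a) _ = a

  module Partition {k s : ℕ} {k≥4 : 4 ℕ.≤ k} {s≥1 : 1 ℕ.≤ s} (Sch : Schemes.Scheme k s k≥4 s≥1) where
    open Colouring k s k≥4 s≥1 using (m; Scaled) renaming (bound to scaled-bound)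
    open Schemes k s k≥4 s≥1 using (InClass)
    open Schemes.Scheme Sch

    in-class? : ∀ i d → Dec (InClass class i d)
    in-class? i d = ((1 ℕ.≤? d) ×-dec (d ℕ.≤? s ℕ.* k)) ×-dec (class d ℕ.≟ i)

    conn : Fin k → ℕ → Bool
    conn i d = does (in-class? (toℕ i) d)

    conn⇒ : ∀ i d → conn i d ≡ true → InClass class (toℕ i) d
    conn⇒ i d = from-does (in-class? (toℕ i) d)

    conn⇐ : ∀ i d → InClass class (toℕ i) d → conn i d ≡ true
    conn⇐ i d = dec-true (in-class? (toℕ i) d)

    valid : ∀ i → ValidConnSet (suc m) (conn i)
    valid i d e = proj₁ (proj₁ p) , ℕ.≤-trans (proj₂ (proj₁ p)) half
      where
      p = conn⇒ i d e

      double : ∀ s k → 2 ℕ.* s ℕ.* k ≡ s ℕ.* k ℕ.* 2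
      double = ℕ-solve-∀

      half : s ℕ.* k ℕ.≤ suc m ℕ./ 2
      half = ℕ.≤-trans (ℕ.≤-reflexive (sym (trans (cong (ℕ._/ 2) (double s k)) (ℕ.m*n/n≡m (s ℕ.* k) 2))))
        (ℕ./-monoˡ-≤ 2 (ℕ.n≤1+n m))

    positive-diff : ∀ {x y} → ¬ x ≡ y → 1 ℕ.≤ diffMod m x y
    positive-diff {x} {y} x≢y = ℕ.n≢0⇒n>0 λ d≡0 → x≢y (sym (toℕ-mod-inj m (- proj₁ (diffMod-eq m x y))
        (vanish (+ diffMod m x y) (+ toℕ x) (+ toℕ y) (proj₁ (diffMod-eq m x y)) (+ suc m) (cong +_ d≡0) (proj₂ (diffMod-eq m x y)))))
      where
      vanish = farkas₂ ∅ 5 (λ d x y w n →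
          d ≈ # 0 ⇒ d ≈ x :- y :+ w :* n ⇒ ⊩ x ≈ y :+ ⊝ w :* n)
          (1 ∷ 0 ∷ 1 ∷ 1 ∷ []) (1 ∷ 1 ∷ 0 ∷ 0 ∷ 1 ∷ [])

    module _ {x y : Fin (suc m)} (x≢y : ¬ x ≡ y) where
      d e : ℕ
      d = diffMod m x y
      e = diffMod m y x

      -- The two differences are opposite modulo n and both lie between 1 and n - 1. As n = 2 s k +
      -- 1, exactly one of them is at most s k, and this one decides the colour.
      sum≡ : d ℕ.+ e ≡ suc m
      sum≡ = +-injective (trans (total (+ d) (+ e) (+ toℕ x) (+ toℕ y) w w′ (+ suc m) (proj₂ (diffMod-eq m x y)) (proj₂ (diffMod-eq m y x)))
          (trans (cong (_* + suc m) (mult-unique (w + w′) (+ suc m) (+ 1) (+≤+ (s≤s z≤n))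
            (lo (+ d) (+ e) (+ toℕ x) (+ toℕ y) w w′ (+ suc m) (proj₂ (diffMod-eq m x y)) (proj₂ (diffMod-eq m y x))
              (+≤+ (positive-diff x≢y)) (+≤+ (positive-diff (x≢y ∘ sym))))
            (hi (+ d) (+ e) (+ toℕ x) (+ toℕ y) w w′ (+ suc m) (proj₂ (diffMod-eq m x y)) (proj₂ (diffMod-eq m y x))
              (diffMod< m x y) (diffMod< m y x)))) (*-identityˡ (+ suc m))))
        where
        w = proj₁ (diffMod-eq m x y)
        w′ = proj₁ (diffMod-eq m y x)
        total = farkas₂ ∅ 7 (λ d e x y w w′ n →
            d ≈ x :- y :+ w :* n ⇒ e ≈ y :- x :+ w′ :* n ⇒ ⊩ d :+ e ≈ (w :+ w′) :* n)
            (1 ∷ 1 ∷ 0 ∷ 1 ∷ []) (1 ∷ 0 ∷ 1 ∷ 0 ∷ 1 ∷ [])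

        lo = farkas ∅ 7 (λ d e x y w w′ n →
            d ≈ x :- y :+ w :* n ⇒ e ≈ y :- x :+ w′ :* n ⇒ # 1 ≼ d ⇒ # 1 ≼ e ⇒
            ⊩ (# 1 :- # 1) :* n :+ # 1 ≼ (w :+ w′) :* n) (1 ∷ 1 ∷ 1 ∷ 1 ∷ 0 ∷ 1 ∷ [])

        hi = farkas ∅ 7 (λ d e x y w w′ n →
            d ≈ x :- y :+ w :* n ⇒ e ≈ y :- x :+ w′ :* n ⇒ d :+ # 1 ≼ n ⇒ e :+ # 1 ≼ n ⇒
            ⊩ (w :+ w′) :* n :+ # 1 ≼ (# 1 :+ # 1) :* n) (1 ∷ 1 ∷ 1 ∷ 0 ∷ 1 ∷ 0 ∷ 1 ∷ [])

      twice : m ≡ s ℕ.* k ℕ.+ s ℕ.* k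
      twice = double s k
        where
        double : ∀ s k → 2 ℕ.* s ℕ.* k ≡ s ℕ.* k ℕ.+ s ℕ.* k
        double = ℕ-solve-∀

      one-short : d ℕ.≤ s ℕ.* k ⊎ e ℕ.≤ s ℕ.* k
      one-short with d ℕ.≤? s ℕ.* k
      ... | yes d≤ = inj₁ d≤
      ... | no d≰  = inj₂ (ℕ.+-cancelˡ-≤ (suc (s ℕ.* k)) _ _
        (ℕ.≤-trans (ℕ.+-monoˡ-≤ e (ℕ.≰⇒> d≰)) (ℕ.≤-reflexive (trans sum≡ (cong suc twice)))))

      not-both : d ℕ.≤ s ℕ.* k → e ℕ.≤ s ℕ.* k → ⊥
      not-both d≤ e≤ = ℕ.<-irrefl refl (ℕ.≤-trans (ℕ.≤-reflexive (trans (cong suc (sym twice)) (sym sum≡))) (ℕ.+-mono-≤ d≤ e≤))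

      colour : ∀ d → 1 ℕ.≤ d → d ℕ.≤ s ℕ.* k → ∃ λ i → conn i d ≡ true
      colour d d≥1 d≤ = fromℕ< (class< d d≥1 d≤) ,
        conn⇐ _ d ((d≥1 , d≤) , sym (Fin.toℕ-fromℕ< (class< d d≥1 d≤)))

      exists : ∃ λ i → CircleAdj m (conn i) x y
      exists with one-short
      ... | inj₁ d≤ = let i , e = colour d (positive-diff x≢y) d≤ in i , inj₁ e
      ... | inj₂ e≤ = let i , e = colour e (positive-diff (x≢y ∘ sym)) e≤ in i , inj₂ e

      same : ∀ {i j d} → conn i d ≡ true → conn j d ≡ true → i ≡ j
      same {i} {j} {d} p q = Fin.toℕ-injective (trans (sym (proj₂ (conn⇒ i d p))) (proj₂ (conn⇒ j d q)))

      short : ∀ {i d} → conn i d ≡ true → d ℕ.≤ s ℕ.* k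
      short {i} {d} p = proj₂ (proj₁ (conn⇒ i d p))

      unique : ∀ i j → CircleAdj m (conn i) x y → CircleAdj m (conn j) x y → i ≡ j
      unique i j (inj₁ p) (inj₁ q) = same p q
      unique i j (inj₂ p) (inj₂ q) = same p q
      unique i j (inj₁ p) (inj₂ q) = ⊥-elim (not-both (short {i} p) (short {j} q))
      unique i j (inj₂ p) (inj₁ q) = ⊥-elim (not-both (short {j} q) (short {i} p))

    -- H may have fewer edges than its vertices induce. Its edges enter through `E-sub`, which also
    -- puts the middle vertex of a path into V, so that it has an index in the enumeration.
    size-bound : ∀ i (H : Subgraph (CircleAdj m (conn i))) → DiameterTwo H →
                 Subset.∣ Subgraph.V H ∣ ℕ.≤ 2 ℕ.* s ℕ.+ 7
    size-bound i H diam = scaled-bound (scaled (toℕ i) (Fin.toℕ<n i)) elem elem-inj (CircleAdj m (conn i))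
        (λ { (inj₁ p) → inj₁ (conn⇒ i _ p) ; (inj₂ p) → inj₂ (conn⇒ i _ p) }) diam′
      where
      open Subgraph H
      open Enumeration (enumerate V)

      adjacent : ∀ {x y} → E x y → CircleAdj m (conn i) x y
      adjacent {x} {y} e = proj₂ (proj₂ (E-sub x y e))

      diam′ : ∀ x y → x ≡ y ⊎ CircleAdj m (conn i) (elem x) (elem y) ⊎
              ∃ λ z → CircleAdj m (conn i) (elem x) (elem z) × CircleAdj m (conn i) (elem z) (elem y)
      diam′ x y with diam (elem x) (elem y) (elem∈ x) (elem∈ y)
      ... | inj₁ e                  = inj₁ (elem-inj e)
      ... | inj₂ (inj₁ e)           = inj₂ (inj₁ (adjacent e))
      ... | inj₂ (inj₂ (z , e , f)) with index (proj₁ (E-sub z (elem y) f))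
      ...   | j , refl              = inj₂ (inj₂ (j , adjacent e , adjacent f))

open import Defs
open import Data.Nat using (ℕ; suc; _+_; _*_; _≤_)
open import Data.Fin using (Fin)
open import Data.Fin.Subset using (∣_∣)
open import Data.Bool using (Bool)
open import Data.Product using (_×_; ∃; Σ)
open import Relation.Binary.PropositionalEquality using (_≡_)
open import Relation.Nullary using (¬_)

theorem3 : (k s : ℕ) → 4 ≤ k → 1 ≤ s →
    Σ (Fin k → ℕ → Bool) λ S →
    (∀ i → ValidConnSet (suc (2 * s * k)) (S i))
    × (∀ (x y : Fin (suc (2 * s * k))) → ¬ x ≡ y →
    (∃ λ i → CircleAdj (2 * s * k) (S i) x y)
    × (∀ i j → CircleAdj (2 * s * k) (S i) x y → CircleAdj (2 * s * k) (S j) x y → i ≡ j))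
    × (∀ i (H : Subgraph (CircleAdj (2 * s * k) (S i))) → DiameterTwo H →
    ∣ Subgraph.V H ∣ ≤ 2 * s + 7)
theorem3 k s k≥4 s≥1 = conn , valid , (λ x y x≢y → exists x≢y , unique x≢y) , size-bound
  where open ProofOfTheorem3.Partition (ProofOfTheorem3.Schemes.scheme k s k≥4 s≥1)
        open import Data.Product using (_,_)
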